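{- Let $n\ge1$, let $s_1,\dots,s_n\in\{1,2\}$, and put $s=s_1+\cdots+s_n$. Let $p_s(x)$ be the polynomial satisfying $$\sum_{m\ge0}(m+1)^{s-n}(2m+1)^nx^m=\frac{p_s(x)}{(1-x)^{s+1}},$$ and let $(a,b)$ be its $\mathcal{I}_{s-1}$-decomposition. Then $\mathcal{I}_{s-1}(p_s)\ll p_s$. In particular, $p_s(x)$ is alternatingly increasing and $b\ll a$.
   Context: $p_s(x)$ is the descent polynomial over signed permutations $\pm\pi_1\pm\pi_2\cdots\pm\pi_s$ of the multiset $\{1^{s_1},\dots,n^{s_n}\}$ (with $\pi_0=0$). For a polynomial $p$ of degree at most $d$, $\mathcal{I}_d(p)(x)=x^dp(1/x)$, and the $\mathcal{I}_d$-decomposition of $p$ is the unique pair $(a,b)$ with $p=a+xb$, $\mathcal{I}_d(a)=a$ and $\mathcal{I}_{d-1}(b)=b$. For real-rooted real polynomials $f,g$ with zeros $\{r_i\}$, $\{s_j\}$ in decreasing order, $g\preceq f$ means either $\deg f=\deg g+1=d$ and $r_d\le s_{d-1}\le\cdots\le s_1\le r_1$, or $\deg f=\deg g=d$ and $s_d\le r_d\le\cdots\le s_1\le r_1$; $g\ll f$ means $g\preceq f$ with leading coefficients of the same sign, or $f\preceq g$ with leading coefficients of opposite sign. A polynomial $p=\sum_{j=0}^dp_jx^j$ of degree $d$ is alternatingly increasing if $0\le p_0\le p_d\le p_1\le p_{d-1}\le\cdots\le p_{\lfloor(d+1)/2\rfloor}$.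
   Formalization: If all s_i = 1, p_s has degree s, so I_{s-1}(p_s) and the I_{s-1}-decomposition do not exist (n = 1: p_s = 1 + x); the claims about them are made under the condition deg p_s ≤ s-1, while "alternatingly increasing" is proved for all s. -}

module Defs where

open import Algebra.Bundles using (CommutativeMonoid)
open import Algebra.Properties.CommutativeSemigroup using (interchange)
open import Data.Integer using (+_)
open import Data.List using (List; []; _∷_; applyUpTo; foldr; length; map)
open import Data.List.Relation.Unary.Linked using (Linked)
open import Data.Nat as ℕ using (ℕ; zero; suc; _∸_; _⊔_)
import Data.Nat.Properties as ℕₚ
open import Data.Product using (Σ; ∃; ∃₂; _×_; _,_)
open import Data.Rational as ℚ using (ℚ; 0ℚ; 1ℚ; ½; ∣_∣; Positive; NonZero)
open import Data.Rational.Properties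
open import Data.Sum using (_⊎_)
open import Relation.Binary.PropositionalEquality using (_≡_; refl; sym; trans; cong; cong₂; subst)

-- Real numbers are Cauchy sequences of rationals.
IsCauchy : (ℕ → ℚ) → Set
IsCauchy x = ∀ ε → 0ℚ ℚ.< ε →
  ∃ λ N → ∀ m n → N ℕ.≤ m → N ℕ.≤ n → ∣ x m ℚ.- x n ∣ ℚ.≤ ε

record ℝ : Set where
  constructor mkℝ
  field
    seq    : ℕ → ℚ
    cauchy : IsCauchy seq

open ℝ public

fromℚ : ℚ → ℝ
fromℚ q .seq _ = q
fromℚ q .cauchy ε 0<ε = 0 , λ _ _ _ _ → begin
  ∣ q ℚ.- q ∣  ≡⟨ cong ∣_∣ (+-inverseʳ q) ⟩
  0ℚ           <⟨ 0<ε ⟩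
  ε            ∎
  where open ≤-Reasoning

fromℕ : ℕ → ℝ
fromℕ n = fromℚ (+ n ℚ./ 1)

0ℝ 1ℝ : ℝ
0ℝ = fromℕ 0
1ℝ = fromℕ 1

infixl 6 _+_
infixl 7 _*_
infix  8 -_
infix  4 _≈_ _≤_ _≥_ _<_ _#_

_+_ : ℝ → ℝ → ℝ
(x + y) .seq n = seq x n ℚ.+ seq y n
(x + y) .cauchy ε 0<ε =
  let 0<δ     = positive⁻¹ (½ ℚ.* ε) {{pos*pos⇒pos ½ ε {{ℚ.positive 0<ε}}}}
      M₁ , h₁ = cauchy x (½ ℚ.* ε) 0<δ
      M₂ , h₂ = cauchy y (½ ℚ.* ε) 0<δ
  in M₁ ⊔ M₂ , λ m n M≤m M≤n → begin
    ∣ (seq x m ℚ.+ seq y m) ℚ.- (seq x n ℚ.+ seq y n) ∣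
      ≡⟨ cong ∣_∣ (regroup (seq x m) (seq y m) (seq x n) (seq y n)) ⟩
    ∣ (seq x m ℚ.- seq x n) ℚ.+ (seq y m ℚ.- seq y n) ∣
      ≤⟨ ∣p+q∣≤∣p∣+∣q∣ (seq x m ℚ.- seq x n) (seq y m ℚ.- seq y n) ⟩
    ∣ seq x m ℚ.- seq x n ∣ ℚ.+ ∣ seq y m ℚ.- seq y n ∣
      ≤⟨ +-mono-≤ (h₁ m n (ℕₚ.m⊔n≤o⇒m≤o M₁ M₂ M≤m) (ℕₚ.m⊔n≤o⇒m≤o M₁ M₂ M≤n))
                  (h₂ m n (ℕₚ.m⊔n≤o⇒n≤o M₁ M₂ M≤m) (ℕₚ.m⊔n≤o⇒n≤o M₁ M₂ M≤n)) ⟩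
    ½ ℚ.* ε ℚ.+ ½ ℚ.* ε  ≡⟨ *-distribʳ-+ ε ½ ½ ⟨
    1ℚ ℚ.* ε             ≡⟨ *-identityˡ ε ⟩
    ε                    ∎
  where
  open ≤-Reasoning
  regroup : ∀ a b c d → (a ℚ.+ b) ℚ.- (c ℚ.+ d) ≡ (a ℚ.- c) ℚ.+ (b ℚ.- d)
  regroup a b c d = trans
    (cong (a ℚ.+ b ℚ.+_) (neg-distrib-+ c d))
    (interchange (CommutativeMonoid.commutativeSemigroup +-0-commutativeMonoid)
                 a b (ℚ.- c) (ℚ.- d))

-_ : ℝ → ℝ
(- x) .seq n = ℚ.- seq x n
(- x) .cauchy ε 0<ε =
  let M , h = cauchy x ε 0<ε
  in M , λ m n M≤m M≤n →
       subst (ℚ._≤ ε)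
         (trans (sym (∣-p∣≡∣p∣ (seq x m ℚ.- seq x n)))
                (cong ∣_∣ (neg-distrib-+ (seq x m) (ℚ.- seq x n))))
         (h m n M≤m M≤n)

private
  eventuallyBounded : (x : ℝ) →
    ∃₂ λ B N → Positive B × (∀ n → N ℕ.≤ n → ∣ seq x n ∣ ℚ.≤ B)
  eventuallyBounded x =
    let N , h = cauchy x 1ℚ (positive⁻¹ 1ℚ)
        c     = seq x N
    in 1ℚ ℚ.+ ∣ c ∣ , N ,
       pos+nonNeg⇒pos 1ℚ ∣ c ∣ {{∣-∣-nonNeg c}} ,
       λ n N≤n → begin
         ∣ seq x n ∣                      ≡⟨ cong ∣_∣ (split (seq x n) c) ⟩
         ∣ (seq x n ℚ.- c) ℚ.+ c ∣        ≤⟨ ∣p+q∣≤∣p∣+∣q∣ (seq x n ℚ.- c) c ⟩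
         ∣ seq x n ℚ.- c ∣ ℚ.+ ∣ c ∣      ≤⟨ +-monoˡ-≤ ∣ c ∣ (h n N N≤n ℕₚ.≤-refl) ⟩
         1ℚ ℚ.+ ∣ c ∣                     ∎
    where
    open ≤-Reasoning
    split : ∀ a b → a ≡ (a ℚ.- b) ℚ.+ b
    split a b = sym (trans (+-assoc a (ℚ.- b) b)
                    (trans (cong (a ℚ.+_) (+-inverseˡ b)) (+-identityʳ a)))

_*_ : ℝ → ℝ → ℝ
(x * y) .seq n = seq x n ℚ.* seq y n
(x * y) .cauchy ε 0<ε with eventuallyBounded x | eventuallyBounded y
... | B , N₁ , B>0 , x≤B | C , N₂ , C>0 , y≤C =
  let M₁ , h₁ = cauchy x δ 0<δ
      M₂ , h₂ = cauchy y δ 0<δ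
  in (N₁ ⊔ N₂) ⊔ (M₁ ⊔ M₂) , λ m n N≤m N≤n →
    let N₁≤m = ℕₚ.m⊔n≤o⇒m≤o N₁ N₂ (ℕₚ.m⊔n≤o⇒m≤o (N₁ ⊔ N₂) (M₁ ⊔ M₂) N≤m)
        N₂≤n = ℕₚ.m⊔n≤o⇒n≤o N₁ N₂ (ℕₚ.m⊔n≤o⇒m≤o (N₁ ⊔ N₂) (M₁ ⊔ M₂) N≤n)
        M≤m  = ℕₚ.m⊔n≤o⇒n≤o (N₁ ⊔ N₂) (M₁ ⊔ M₂) N≤m
        M≤n  = ℕₚ.m⊔n≤o⇒n≤o (N₁ ⊔ N₂) (M₁ ⊔ M₂) N≤n
        Δx   = seq x m ℚ.- seq x n
        Δy   = seq y m ℚ.- seq y n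
    in begin
      ∣ seq x m ℚ.* seq y m ℚ.- seq x n ℚ.* seq y n ∣
        ≡⟨ cong ∣_∣ (regroup (seq x m) (seq y m) (seq x n) (seq y n)) ⟩
      ∣ seq x m ℚ.* Δy ℚ.+ Δx ℚ.* seq y n ∣
        ≤⟨ ∣p+q∣≤∣p∣+∣q∣ (seq x m ℚ.* Δy) (Δx ℚ.* seq y n) ⟩
      ∣ seq x m ℚ.* Δy ∣ ℚ.+ ∣ Δx ℚ.* seq y n ∣
        ≡⟨ cong₂ ℚ._+_ (∣p*q∣≡∣p∣*∣q∣ (seq x m) Δy) (∣p*q∣≡∣p∣*∣q∣ Δx (seq y n)) ⟩
      ∣ seq x m ∣ ℚ.* ∣ Δy ∣ ℚ.+ ∣ Δx ∣ ℚ.* ∣ seq y n ∣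
        ≤⟨ +-mono-≤
             (mono* (seq x m) Δy (x≤B m N₁≤m)
               (h₂ m n (ℕₚ.m⊔n≤o⇒n≤o M₁ M₂ M≤m) (ℕₚ.m⊔n≤o⇒n≤o M₁ M₂ M≤n)) {{B>0}})
             (mono* Δx (seq y n)
               (h₁ m n (ℕₚ.m⊔n≤o⇒m≤o M₁ M₂ M≤m) (ℕₚ.m⊔n≤o⇒m≤o M₁ M₂ M≤n))
               (y≤C n N₂≤n) {{δ>0}}) ⟩
      B ℚ.* δ ℚ.+ δ ℚ.* C        ≡⟨ collect B C ε (ℚ.1/ K) ⟩
      ε ℚ.* (K ℚ.* ℚ.1/ K)       ≡⟨ cong (ε ℚ.*_) (*-inverseʳ K) ⟩
      ε ℚ.* 1ℚ                   ≡⟨ *-identityʳ ε ⟩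
      ε                          ∎
  where
  open ≤-Reasoning
  K : ℚ
  K = B ℚ.+ C
  K>0 : Positive K
  K>0 = pos+pos⇒pos B {{B>0}} C {{C>0}}
  instance
    K≢0 : NonZero K
    K≢0 = pos⇒nonZero K {{K>0}}
  δ : ℚ
  δ = ε ℚ.* ℚ.1/ K
  δ>0 : Positive δ
  δ>0 = pos*pos⇒pos ε {{ℚ.positive 0<ε}} (ℚ.1/ K) {{1/pos⇒pos K {{K>0}}}}
  0<δ : 0ℚ ℚ.< δ
  0<δ = positive⁻¹ δ {{δ>0}}
  mono* : ∀ p q {u v} → ∣ p ∣ ℚ.≤ u → ∣ q ∣ ℚ.≤ v → {{Positive u}} →
          ∣ p ∣ ℚ.* ∣ q ∣ ℚ.≤ u ℚ.* v
  mono* p q {u} {v} p≤u q≤v = ≤-trans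
    (*-monoʳ-≤-nonNeg ∣ q ∣ {{∣-∣-nonNeg q}} p≤u)
    (*-monoˡ-≤-nonNeg u {{pos⇒nonNeg u}} q≤v)
  regroup : ∀ a b c d → a ℚ.* b ℚ.- c ℚ.* d ≡ a ℚ.* (b ℚ.- d) ℚ.+ (a ℚ.- c) ℚ.* d
  regroup a b c d = sym (begin-equality
    a ℚ.* (b ℚ.- d) ℚ.+ (a ℚ.- c) ℚ.* d
      ≡⟨ cong₂ ℚ._+_ (*-distribˡ-+ a b (ℚ.- d)) (*-distribʳ-+ d a (ℚ.- c)) ⟩
    (a ℚ.* b ℚ.+ a ℚ.* ℚ.- d) ℚ.+ (a ℚ.* d ℚ.+ ℚ.- c ℚ.* d)
      ≡⟨ +-assoc (a ℚ.* b) (a ℚ.* ℚ.- d) _ ⟩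
    a ℚ.* b ℚ.+ (a ℚ.* ℚ.- d ℚ.+ (a ℚ.* d ℚ.+ ℚ.- c ℚ.* d))
      ≡⟨ cong (a ℚ.* b ℚ.+_) (+-assoc (a ℚ.* ℚ.- d) (a ℚ.* d) _) ⟨
    a ℚ.* b ℚ.+ ((a ℚ.* ℚ.- d ℚ.+ a ℚ.* d) ℚ.+ ℚ.- c ℚ.* d)
      ≡⟨ cong (λ t → a ℚ.* b ℚ.+ (t ℚ.+ ℚ.- c ℚ.* d))
           (trans (sym (*-distribˡ-+ a (ℚ.- d) d))
                  (trans (cong (a ℚ.*_) (+-inverseˡ d)) (*-zeroʳ a))) ⟩
    a ℚ.* b ℚ.+ (0ℚ ℚ.+ ℚ.- c ℚ.* d)
      ≡⟨ cong (a ℚ.* b ℚ.+_)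
           (trans (+-identityˡ _) (sym (neg-distribˡ-* c d))) ⟩
    a ℚ.* b ℚ.- c ℚ.* d ∎)
  collect : ∀ b c e k → b ℚ.* (e ℚ.* k) ℚ.+ (e ℚ.* k) ℚ.* c ≡ e ℚ.* ((b ℚ.+ c) ℚ.* k)
  collect b c e k = begin-equality
    b ℚ.* (e ℚ.* k) ℚ.+ (e ℚ.* k) ℚ.* c  ≡⟨ cong (ℚ._+ (e ℚ.* k) ℚ.* c) (*-comm b _) ⟩
    (e ℚ.* k) ℚ.* b ℚ.+ (e ℚ.* k) ℚ.* c  ≡⟨ *-distribˡ-+ (e ℚ.* k) b c ⟨
    (e ℚ.* k) ℚ.* (b ℚ.+ c)              ≡⟨ *-assoc e k (b ℚ.+ c) ⟩
    e ℚ.* (k ℚ.* (b ℚ.+ c))              ≡⟨ cong (e ℚ.*_) (*-comm k (b ℚ.+ c)) ⟩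
    e ℚ.* ((b ℚ.+ c) ℚ.* k)              ∎

_≈_ _≤_ _≥_ _<_ _#_ : ℝ → ℝ → Set
x ≈ y = ∀ ε → 0ℚ ℚ.< ε → ∃ λ N → ∀ n → N ℕ.≤ n → ∣ seq x n ℚ.- seq y n ∣ ℚ.≤ ε
x ≤ y = ∀ ε → 0ℚ ℚ.< ε → ∃ λ N → ∀ n → N ℕ.≤ n → seq x n ℚ.≤ seq y n ℚ.+ ε
x ≥ y = y ≤ x
x < y = Σ ℚ λ ε → 0ℚ ℚ.< ε × ∃ λ N → ∀ n → N ℕ.≤ n → seq x n ℚ.+ ε ℚ.≤ seq y n
-- Apartness, the constructive form of x ≠ y.
x # y = x < y ⊎ y < x

-- Coefficient lists, constant term first.
Poly : Set
Poly = List ℝ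

coeff : Poly → ℕ → ℝ
coeff []      _       = 0ℝ
coeff (c ∷ p) zero    = c
coeff (c ∷ p) (suc j) = coeff p j

infix  4 _≋_
infixl 6 _⊕_
infixl 7 _⊛_
infixr 7 _·_
infixr 8 _⊛^_

-- Trailing zero coefficients are irrelevant.
_≋_ : Poly → Poly → Set
p ≋ q = ∀ j → coeff p j ≈ coeff q j

_⊕_ : Poly → Poly → Poly
[]      ⊕ q       = q
(a ∷ p) ⊕ []      = a ∷ p
(a ∷ p) ⊕ (b ∷ q) = a + b ∷ p ⊕ q

_·_ : ℝ → Poly → Poly
c · p = map (c *_) p

X·_ : Poly → Poly
X· p = 0ℝ ∷ p

_⊛_ : Poly → Poly → Poly
[]      ⊛ q = []
(a ∷ p) ⊛ q = a · q ⊕ (X· (p ⊛ q))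

_⊛^_ : Poly → ℕ → Poly
p ⊛^ zero  = 1ℝ ∷ []
p ⊛^ suc k = p ⊛ (p ⊛^ k)

1-X : Poly
1-X = 1ℝ ∷ - 1ℝ ∷ []

X-_ : ℝ → Poly
X- r = - r ∷ 1ℝ ∷ []

DegreeAtMost : ℕ → Poly → Set
DegreeAtMost d p = ∀ j → d ℕ.< j → coeff p j ≈ 0ℝ

HasDegree : ℕ → Poly → Set
HasDegree d p = coeff p d # 0ℝ × DegreeAtMost d p

LeadingCoeff : Poly → ℝ → Set
LeadingCoeff p c = ∃ λ d → HasDegree d p × coeff p d ≈ c

Series : Set
Series = ℕ → ℝ

∑≤ : ℕ → (ℕ → ℝ) → ℝ
∑≤ m f = foldr _+_ 0ℝ (applyUpTo f (suc m))

_⊗_ : Series → Series → Series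
(f ⊗ g) m = ∑≤ m λ i → f i * g (m ∸ i)

-- F = p / (1 - x) ^ e; as 1 - x is invertible in ℝ⟦x⟧, this says F (1 - x) ^ e = p.
_IsQuotientOf_By1-X^_ : Series → Poly → ℕ → Set
F IsQuotientOf p By1-X^ e = ∀ m → (F ⊗ coeff (1-X ⊛^ e)) m ≈ coeff p m

-- x ^ d p(1/x), which is a polynomial only when deg p ≤ d: the proof is
-- therefore an argument, although the coefficients do not depend on it.
ℐ : ∀ d p → DegreeAtMost d p → Poly
ℐ d p _ = applyUpTo (λ j → coeff p (d ∸ j)) (suc d)

-- For d = 0 the second component should satisfy ℐ_{-1}(b) = b, i.e. b = 0.
-- Here d ∸ 1 = 0 only makes b constant, but then p = a + x b and deg p ≤ 0
-- force b = 0.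
record IsℐDecomposition (d : ℕ) (p a b : Poly) : Set where
  field
    deg-p : DegreeAtMost d p
    deg-a : DegreeAtMost d a
    deg-b : DegreeAtMost (d ∸ 1) b
    sum≋  : p ≋ a ⊕ (X· b)
    sym-a : ℐ d a deg-a ≋ a
    sym-b : ℐ (d ∸ 1) b deg-b ≋ b

-- f is a nonzero real-rooted polynomial and rs lists its zeros, with
-- multiplicity, in decreasing order (so deg f = length rs).
Zeros : Poly → List ℝ → Set
Zeros f rs =
  Linked _≥_ rs ×
  ∃ λ c → c # 0ℝ × f ≋ c · foldr (λ r q → (X- r) ⊛ q) (1ℝ ∷ []) rs

alternate : List ℝ → List ℝ → List ℝ
alternate []       ss = ss
alternate (r ∷ rs) ss = r ∷ alternate ss rs

infix 4 _⪯_ _≪_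

-- In both admissible cases the zeros satisfy r₁ ≥ s₁ ≥ r₂ ≥ s₂ ≥ …, the chain
-- ending in s_{d-1} ≥ r_d when deg f = deg g + 1 and in r_d ≥ s_d when
-- deg f = deg g.
_⪯_ : Poly → Poly → Set
g ⪯ f = ∃₂ λ rs ss →
  Zeros f rs × Zeros g ss ×
  (length rs ≡ suc (length ss) ⊎ length rs ≡ length ss) ×
  Linked _≥_ (alternate rs ss)

SameSign OppositeSign : Poly → Poly → Set
SameSign     f g = ∃₂ λ c e → LeadingCoeff f c × LeadingCoeff g e × 0ℝ < c * e
OppositeSign f g = ∃₂ λ c e → LeadingCoeff f c × LeadingCoeff g e × c * e < 0ℝ

_≪_ : Poly → Poly → Set
g ≪ f = (g ⪯ f × SameSign g f) ⊎ (f ⪯ g × OppositeSign g f)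

-- 0 ≤ p₀ ≤ p_d ≤ p₁ ≤ p_{d-1} ≤ … ≤ p_{⌊(d+1)/2⌋}: the links of the chain are
-- p_i ≤ p_{d-i} and p_{d-i} ≤ p_{i+1}, as long as the index moves inwards.
AlternatinglyIncreasing : Poly → Set
AlternatinglyIncreasing p = ∃ λ d →
  HasDegree d p ×
  0ℝ ≤ coeff p 0 ×
  (∀ i → 2 ℕ.* i ℕ.+ 1 ℕ.≤ d → coeff p i ≤ coeff p (d ∸ i)) ×
  (∀ i → 2 ℕ.* i ℕ.+ 2 ℕ.≤ d → coeff p (d ∸ i) ≤ coeff p (suc i))

descentSeries : (n s : ℕ) → Series
descentSeries n s m = fromℕ ((m ℕ.+ 1) ℕ.^ (s ∸ n) ℕ.* (2 ℕ.* m ℕ.+ 1) ℕ.^ n)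

IsDescentPolynomial : (n s : ℕ) → Poly → Set
IsDescentPolynomial n s p = descentSeries n s IsQuotientOf p By1-X^ (s ℕ.+ 1)

module Submission where

-- Let k = s - n and let p be the numerator of Σ (m + 1)^k (2m + 1)^n x^m.
-- Multiplying the m-th term by c m + 1 acts on numerators of degree d as
-- T p = c x (1 - x) p′ + (1 + (c d + 1) x) p, and the same T acts on q = ℐ p.
-- At a zero r of p, T p = c r (1 - r) p′, so the zeros of T p interlace those
-- of p.  At a zero ρ of T p, p T q = - c ρ (1 - ρ) (q p′ - q′ p), and the
-- Wronskian q p′ - q′ p is positive when q alternates in sign at the zeros of
-- p; hence T q alternates at the zeros of T p.  Starting from the type B
-- Eulerian polynomials this yields ℐ p ≪ p.  Since (1 - x) a = p - x q and
-- (1 - x) b = q - p, the signs of a and b at the zeros of p and q are known,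
-- and these signs separate the zeros of a and b.  The inequalities between
-- coefficients follow from the unimodality of a and b, which T preserves.
-- For k = 0 the degree of p is s, so that only they remain to be shown.

open import Algebra.Bundles using (CommutativeRing)
import Algebra.Solver.Ring
import Algebra.Solver.Ring.AlmostCommutativeRing as ACR
import Data.Fin
open import Data.Integer as ℤ using (ℤ; +_; -[1+_])
import Data.Integer.Properties as ℤₚ
import Data.Integer.Solver
open import Data.List using (List; []; _∷_; length; map; applyUpTo; foldr)
import Data.List.Properties as Listₚ
open import Data.List.Relation.Unary.Linked using (Linked; []; [-]; _∷_)
import Data.List.Relation.Unary.Linked.Properties as Linkedₚ
open import Data.Maybe using (Maybe; just; nothing)
open import Data.Nat as ℕ using (ℕ; zero; suc; z≤n; s≤s; _∸_)
import Data.Nat.Properties as ℕₚ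
import Data.Nat.Solver
open import Data.Product using (∃; _×_; _,_; proj₁; proj₂)
open import Data.Rational as ℚ using (ℚ; 0ℚ; 1ℚ; ½; ∣_∣; toℚᵘ)
import Data.Rational.Properties as ℚₚ
import Data.Rational.Solver
open import Data.Rational.Unnormalised as ℚᵘ using (mkℚᵘ)
import Data.Rational.Unnormalised.Properties as ℚᵘₚ
open import Data.Sum using (_⊎_; inj₁; inj₂)
open import Data.Vec as Vec using (Vec; lookup; sum)
import Defs as D
open D using (ℝ; mkℝ; seq; cauchy; fromℚ; IsCauchy)
open import Function using (_∘_)
open import Level using (0ℓ)
open import Relation.Binary.PropositionalEquality as ≡ using (_≡_)
open import Relation.Nullary using (¬_; Dec; yes; no; contradiction)

-- The reals are constructive and their signs cannot be decided, so zeros are never sorted by case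
-- distinction. Each new zero comes from bisection between points where strict signs are already
-- known, and the strict inequalities it satisfies supply the signs for the next stage. Bisection
-- itself decides signs of rational values. Therefore p, q, a and b are carried as polynomials with
-- natural number coefficients, given by recurrences, and are only at the end identified with the
-- real polynomials of the statement, which the series and the symmetry conditions determine.
--
-- The Wronskian is positive because q / p = γ + Σ λ_i / (x - r_i) with λ_i = q(r_i) / p′(r_i) > 0,
-- whence q p′ - q′ p = p² Σ λ_i / (x - r_i)². The induction replaces these fractions by splitting
-- off one zero at a time.
--
-- The induction on k begins at k = 1: the numerator of (2m + 1)^n is palindromic of degree n, so
-- reversing it gives the same polynomial and no alternation of signs.

-- Polynomial evaluation and the axioms for the reals

module Evaluation (R : CommutativeRing 0ℓ 0ℓ) where
  open CommutativeRing R

  ev dv : List Carrier → Carrier → Carrier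
  ev []      x = 0#
  ev (a ∷ p) x = a + x * ev p x
  dv []      x = 0#
  dv (a ∷ p) x = ev p x + x * dv p x

  ev-cong : ∀ p {x y} → x ≈ y → ev p x ≈ ev p y
  ev-cong []      x≈y = refl
  ev-cong (a ∷ p) x≈y = +-congˡ (*-cong x≈y (ev-cong p x≈y))

-- What the argument needs of the reals; working over an abstract ring keeps
-- the Cauchy sequences from being unfolded.
record OrderedRing : Set₁ where
  field
    commutativeRing : CommutativeRing 0ℓ 0ℓ

  open CommutativeRing commutativeRing public
  open Evaluation commutativeRing public

  field
    fromℤ     : ℤ → Carrier
    fromℤ-+   : ∀ i j → fromℤ (i ℤ.+ j) ≈ fromℤ i + fromℤ j
    fromℤ-*   : ∀ i j → fromℤ (i ℤ.* j) ≈ fromℤ i * fromℤ j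
    fromℤ-neg : ∀ i → fromℤ (ℤ.- i) ≈ - fromℤ i
    fromℤ-1   : fromℤ (+ 1) ≈ 1#

    Pos NonNeg  : Carrier → Set
    Pos-resp    : ∀ {x y} → x ≈ y → Pos x → Pos y
    NonNeg-resp : ∀ {x y} → x ≈ y → NonNeg x → NonNeg y
    Pos-1       : Pos 1#
    Pos⇒NonNeg  : ∀ {x} → Pos x → NonNeg x
    Pos-+       : ∀ {x y} → Pos x → NonNeg y → Pos (x + y)
    Pos-*       : ∀ {x y} → Pos x → Pos y → Pos (x * y)
    NonNeg-+    : ∀ {x y} → NonNeg x → NonNeg y → NonNeg (x + y)
    NonNeg-*    : ∀ {x y} → NonNeg x → NonNeg y → NonNeg (x * y)
    NonNeg-sq   : ∀ x → NonNeg (x * x)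
    Pos-cancel  : ∀ {x y} → Pos x → Pos (x * y) → Pos y
    NonNeg-cancel : ∀ {x y} → Pos x → NonNeg (x * y) → NonNeg y
    -- Replaces the test whether x is zero: a positive product bounds x away from 0.
    NonNeg⇒Pos  : ∀ {x y} → NonNeg x → Pos (x * y) → Pos x
    cancel-0    : ∀ {x y} → Pos x → x * y ≈ 0# → y ≈ 0#
    archimedean : ∀ x → ∃ λ n → Pos (fromℤ (+ n) + x)
    -- Integer coefficients give rational values at rational points, where signs are decidable. The
    -- weak inequalities for ρ are sharpened in `bracket`.
    ivt         : ∀ (f : List ℤ) {u v} → Pos (u - v) →
                  Pos (ev (map fromℤ f) u) → Pos (- ev (map fromℤ f) v) →
                  ∃ λ ρ → NonNeg (u - ρ) × NonNeg (ρ - v) × ev (map fromℤ f) ρ ≈ 0#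

-- Normalisation of ring identities

module RingSolver (R : OrderedRing) where
  open OrderedRing R

  fromℤ-0 : fromℤ (+ 0) ≈ 0#
  fromℤ-0 = trans (fromℤ-+ (+ 1) -[1+ 0 ])
            (trans (+-congˡ (fromℤ-neg (+ 1))) (-‿inverseʳ _))

  -- The solver interprets the constants 0 and 1 by 0# and 1#.
  ⟦_⟧ : ℤ → Carrier
  ⟦ + 0 ⟧ = 0#
  ⟦ + 1 ⟧ = 1#
  ⟦ i ⟧   = fromℤ i

  ⟦⟧≈fromℤ : ∀ i → ⟦ i ⟧ ≈ fromℤ i
  ⟦⟧≈fromℤ (+ 0)           = sym fromℤ-0
  ⟦⟧≈fromℤ (+ 1)           = sym fromℤ-1
  ⟦⟧≈fromℤ (+ suc (suc _)) = refl
  ⟦⟧≈fromℤ -[1+ _ ]        = refl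

  almostCommutativeRing : ACR.AlmostCommutativeRing 0ℓ 0ℓ
  almostCommutativeRing = ACR.fromCommutativeRing commutativeRing

  morphism : CommutativeRing.rawRing ℤₚ.+-*-commutativeRing
             ACR.-Raw-AlmostCommutative⟶ almostCommutativeRing
  morphism = record
    { ⟦_⟧    = ⟦_⟧
    ; +-homo = λ i j → trans (⟦⟧≈fromℤ (i ℤ.+ j)) (trans (fromℤ-+ i j)
                 (+-cong (sym (⟦⟧≈fromℤ i)) (sym (⟦⟧≈fromℤ j))))
    ; *-homo = λ i j → trans (⟦⟧≈fromℤ (i ℤ.* j)) (trans (fromℤ-* i j)
                 (*-cong (sym (⟦⟧≈fromℤ i)) (sym (⟦⟧≈fromℤ j))))
    ; -‿homo = λ i → trans (⟦⟧≈fromℤ (ℤ.- i)) (trans (fromℤ-neg i)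
                 (-‿cong (sym (⟦⟧≈fromℤ i))))
    ; 0-homo = refl
    ; 1-homo = refl
    }

  coeff≟ : ∀ i j → Maybe (⟦ i ⟧ ≈ ⟦ j ⟧)
  coeff≟ i j with i ℤ.≟ j
  ... | yes i≡j = just (reflexive (≡.cong ⟦_⟧ i≡j))
  ... | no _    = nothing

  open Algebra.Solver.Ring (CommutativeRing.rawRing ℤₚ.+-*-commutativeRing)
    almostCommutativeRing morphism coeff≟ public
    using (solve; _:=_; _:+_; _:*_; _:-_; :-_; con)

-- Coefficient lists, division by linear factors, factorisation

module Polynomials (R : OrderedRing) where
  open OrderedRing R
  open RingSolver R

  Poly : Set
  Poly = List Carrier

  coeff : Poly → ℕ → Carrier
  coeff []      _       = 0#
  coeff (a ∷ p) zero    = a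
  coeff (a ∷ p) (suc j) = coeff p j

  infix 4 _≋_
  _≋_ : Poly → Poly → Set
  p ≋ q = ∀ j → coeff p j ≈ coeff q j

  ev-zero : ∀ p x → p ≋ [] → ev p x ≈ 0#
  ev-zero []      x p≋ = refl
  ev-zero (a ∷ p) x p≋ = trans (+-cong (p≋ 0) (*-congˡ (ev-zero p x (p≋ ∘ suc))))
    (solve 1 (λ x → con (+ 0) :+ x :* con (+ 0) := con (+ 0)) refl x)

  dv-zero : ∀ p x → p ≋ [] → dv p x ≈ 0#
  dv-zero []      x p≋ = refl
  dv-zero (a ∷ p) x p≋ =
    trans (+-cong (ev-zero p x (p≋ ∘ suc)) (*-congˡ (dv-zero p x (p≋ ∘ suc))))
    (solve 1 (λ x → con (+ 0) :+ x :* con (+ 0) := con (+ 0)) refl x)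

  ev-≋ : ∀ p q x → p ≋ q → ev p x ≈ ev q x
  ev-≋ []      q       x p≋q = sym (ev-zero q x (sym ∘ p≋q))
  ev-≋ (a ∷ p) []      x p≋q = ev-zero (a ∷ p) x p≋q
  ev-≋ (a ∷ p) (b ∷ q) x p≋q =
    +-cong (p≋q 0) (*-congˡ (ev-≋ p q x (p≋q ∘ suc)))

  dv-≋ : ∀ p q x → p ≋ q → dv p x ≈ dv q x
  dv-≋ []      q       x p≋q = sym (dv-zero q x (sym ∘ p≋q))
  dv-≋ (a ∷ p) []      x p≋q = dv-zero (a ∷ p) x p≋q
  dv-≋ (a ∷ p) (b ∷ q) x p≋q =
    +-cong (ev-≋ p q x (p≋q ∘ suc)) (*-congˡ (dv-≋ p q x (p≋q ∘ suc)))

  ev-0 : ∀ p → ev p 0# ≈ coeff p 0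
  ev-0 []      = refl
  ev-0 (a ∷ p) = solve 2 (λ a e → a :+ con (+ 0) :* e := a) refl a (ev p 0#)

  coeff-beyond : ∀ p {j} → length p ℕ.≤ j → coeff p j ≈ 0#
  coeff-beyond []      _         = refl
  coeff-beyond (a ∷ p) (s≤s p≤j) = coeff-beyond p p≤j

  comb : Carrier → Poly → Carrier → Poly → Poly
  comb s []      t []      = []
  comb s []      t (b ∷ q) = t * b ∷ comb s [] t q
  comb s (a ∷ p) t []      = s * a ∷ comb s p t []
  comb s (a ∷ p) t (b ∷ q) = s * a + t * b ∷ comb s p t q

  length-comb : ∀ s p t q → length (comb s p t q) ≡ length p ℕ.⊔ length q
  length-comb s []      t []      = ≡.refl
  length-comb s []      t (b ∷ q) = ≡.cong suc (length-comb s [] t q)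
  length-comb s (a ∷ p) t []      =
    ≡.cong suc (≡.trans (length-comb s p t []) (ℕₚ.⊔-identityʳ (length p)))
  length-comb s (a ∷ p) t (b ∷ q) = ≡.cong suc (length-comb s p t q)

  ev-comb : ∀ s p t q x → ev (comb s p t q) x ≈ s * ev p x + t * ev q x
  ev-comb s [] t [] x =
    solve 2 (λ s t → con (+ 0) := s :* con (+ 0) :+ t :* con (+ 0)) refl s t
  ev-comb s [] t (b ∷ q) x = trans (+-congˡ (*-congˡ (ev-comb s [] t q x)))
    (solve 5 (λ s t b x e → t :* b :+ x :* (s :* con (+ 0) :+ t :* e)
      := s :* con (+ 0) :+ t :* (b :+ x :* e)) refl s t b x (ev q x))
  ev-comb s (a ∷ p) t [] x = trans (+-congˡ (*-congˡ (ev-comb s p t [] x)))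
    (solve 5 (λ s t a x e → s :* a :+ x :* (s :* e :+ t :* con (+ 0))
      := s :* (a :+ x :* e) :+ t :* con (+ 0)) refl s t a x (ev p x))
  ev-comb s (a ∷ p) t (b ∷ q) x = trans (+-congˡ (*-congˡ (ev-comb s p t q x)))
    (solve 7 (λ s t a b x e f → s :* a :+ t :* b :+ x :* (s :* e :+ t :* f)
      := s :* (a :+ x :* e) :+ t :* (b :+ x :* f)) refl s t a b x (ev p x) (ev q x))

  dv-comb : ∀ s p t q x → dv (comb s p t q) x ≈ s * dv p x + t * dv q x
  dv-comb s [] t [] x =
    solve 2 (λ s t → con (+ 0) := s :* con (+ 0) :+ t :* con (+ 0)) refl s t
  dv-comb s [] t (b ∷ q) x =
    trans (+-cong (ev-comb s [] t q x) (*-congˡ (dv-comb s [] t q x)))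
    (solve 5 (λ s t x e d → s :* con (+ 0) :+ t :* e :+ x :* (s :* con (+ 0) :+ t :* d)
      := s :* con (+ 0) :+ t :* (e :+ x :* d)) refl s t x (ev q x) (dv q x))
  dv-comb s (a ∷ p) t [] x =
    trans (+-cong (ev-comb s p t [] x) (*-congˡ (dv-comb s p t [] x)))
    (solve 5 (λ s t x e d → s :* e :+ t :* con (+ 0) :+ x :* (s :* d :+ t :* con (+ 0))
      := s :* (e :+ x :* d) :+ t :* con (+ 0)) refl s t x (ev p x) (dv p x))
  dv-comb s (a ∷ p) t (b ∷ q) x =
    trans (+-cong (ev-comb s p t q x) (*-congˡ (dv-comb s p t q x)))
    (solve 7 (λ s t x e d f g → s :* e :+ t :* f :+ x :* (s :* d :+ t :* g)
      := s :* (e :+ x :* d) :+ t :* (f :+ x :* g)) refl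
      s t x (ev p x) (dv p x) (ev q x) (dv q x))

  -- a + (x - r) q
  linear : Carrier → Carrier → Poly → Poly
  linear r a []      = a ∷ []
  linear r a (b ∷ q) = a - r * b ∷ linear r b q

  length-linear : ∀ r a q → length (linear r a q) ≡ suc (length q)
  length-linear r a []      = ≡.refl
  length-linear r a (b ∷ q) = ≡.cong suc (length-linear r b q)

  coeff-linear-0 : ∀ r a q → coeff (linear r a q) 0 ≈ a - r * coeff q 0
  coeff-linear-0 r a [] = solve 2 (λ r a → a := a :- r :* con (+ 0)) refl r a
  coeff-linear-0 r a (b ∷ q) = refl

  coeff-linear-suc : ∀ r a q j →
    coeff (linear r a q) (suc j) ≈ coeff q j - r * coeff q (suc j)
  coeff-linear-suc r a []      j = solve 1 (λ r → con (+ 0) := con (+ 0) :- r :* con (+ 0)) refl r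
  coeff-linear-suc r a (b ∷ q) zero    = coeff-linear-0 r b q
  coeff-linear-suc r a (b ∷ q) (suc j) = coeff-linear-suc r b q j

  ev-linear : ∀ r a q x → ev (linear r a q) x ≈ a + (x - r) * ev q x
  ev-linear r a [] x =
    solve 3 (λ r a x → a :+ x :* con (+ 0) := a :+ (x :- r) :* con (+ 0)) refl r a x
  ev-linear r a (b ∷ q) x = trans (+-congˡ (*-congˡ (ev-linear r b q x)))
    (solve 5 (λ r a b x e → a :- r :* b :+ x :* (b :+ (x :- r) :* e)
      := a :+ (x :- r) :* (b :+ x :* e)) refl r a b x (ev q x))

  dv-linear : ∀ r a q x → dv (linear r a q) x ≈ ev q x + (x - r) * dv q x
  dv-linear r a [] x =
    solve 2 (λ r x → con (+ 0) :+ x :* con (+ 0) := con (+ 0) :+ (x :- r) :* con (+ 0)) refl r x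
  dv-linear r a (b ∷ q) x =
    trans (+-cong (ev-linear r b q x) (*-congˡ (dv-linear r b q x)))
    (solve 5 (λ r b x e d → b :+ (x :- r) :* e :+ x :* (e :+ (x :- r) :* d)
      := b :+ x :* e :+ (x :- r) :* (e :+ x :* d)) refl r b x (ev q x) (dv q x))

  linear-cong : ∀ r {a a′} q {q′} → a ≈ a′ → q ≋ q′ → linear r a q ≋ linear r a′ q′
  linear-cong r q {q′} a≈ q≋ zero = trans (coeff-linear-0 r _ q)
    (trans (+-cong a≈ (-‿cong (*-congˡ (q≋ 0)))) (sym (coeff-linear-0 r _ q′)))
  linear-cong r q {q′} a≈ q≋ (suc j) = trans (coeff-linear-suc r _ q j)
    (trans (+-cong (q≋ j) (-‿cong (*-congˡ (q≋ (suc j))))) (sym (coeff-linear-suc r _ q′ j)))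

  -- Horner's scheme: the coefficients of the quotient by x - r are the values at r of the tails of
  -- p.
  quo : Poly → Carrier → Poly
  quo []          r = []
  quo (a ∷ [])    r = []
  quo (a ∷ b ∷ p) r = ev (b ∷ p) r ∷ quo (b ∷ p) r

  length-quo : ∀ a p r → length (quo (a ∷ p) r) ≡ length p
  length-quo a []      r = ≡.refl
  length-quo a (b ∷ p) r = ≡.cong suc (length-quo b p r)

  division : ∀ p r → p ≋ linear r (ev p r) (quo p r)
  division []          r zero    = refl
  division []          r (suc j) = refl
  division (a ∷ [])    r zero    = solve 2 (λ a r → a := a :+ r :* con (+ 0)) refl a r
  division (a ∷ [])    r (suc j) = refl
  division (a ∷ b ∷ p) r zero    =
    solve 3 (λ a r e → a := a :+ r :* e :- r :* e) refl a r (ev (b ∷ p) r)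
  division (a ∷ b ∷ p) r (suc j) = division (b ∷ p) r j

  ev-division : ∀ p r x → ev p x ≈ ev p r + (x - r) * ev (quo p r) x
  ev-division p r x = trans (ev-≋ p (linear r (ev p r) (quo p r)) x (division p r)) (ev-linear r _ (quo p r) x)

  ∏ : (ℕ → Carrier) → ℕ → Poly
  ∏ r zero    = 1# ∷ []
  ∏ r (suc d) = linear (r 0) 0# (∏ (r ∘ suc) d)

  ev-∏ : ∀ r d x → ev (∏ r (suc d)) x ≈ (x - r 0) * ev (∏ (r ∘ suc) d) x
  ev-∏ r d x = trans (ev-linear _ _ (∏ (r ∘ suc) d) x) (+-identityˡ _)

  length-∏ : ∀ r d → length (∏ r d) ≡ suc d
  length-∏ r zero    = ≡.refl
  length-∏ r (suc d) = ≡.trans (length-linear _ _ (∏ (r ∘ suc) d)) (≡.cong suc (length-∏ (r ∘ suc) d))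

  ∏-monic : ∀ r d → coeff (∏ r d) d ≈ 1#
  ∏-monic r zero    = refl
  ∏-monic r (suc d) = trans (coeff-linear-suc (r 0) 0# P d)
    (trans (+-cong (∏-monic (r ∘ suc) d)
              (-‿cong (*-congˡ (coeff-beyond P (ℕₚ.≤-reflexive (length-∏ (r ∘ suc) d))))))
      (solve 1 (λ r → con (+ 1) :- r :* con (+ 0) := con (+ 1)) refl (r 0)))
    where
    P : Poly
    P = ∏ (r ∘ suc) d

  infix 4 _<_
  _<_ : Carrier → Carrier → Set
  x < y = Pos (y - x)

  <-trans : ∀ {x y z} → x < y → y < z → x < z
  <-trans {x} {y} {z} x<y y<z = Pos-resp
    (solve 3 (λ x y z → (y :- x) :+ (z :- y) := z :- x) refl x y z)
    (Pos-+ x<y (Pos⇒NonNeg y<z))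

  Decreasing : ℕ → (ℕ → Carrier) → Set
  Decreasing d r = ∀ i → suc i ℕ.< d → r (suc i) < r i

  decreasing : ∀ {d r} → Decreasing d r → ∀ i j → i ℕ.< j → j ℕ.< d → r j < r i
  decreasing dec i (suc j) i<1+j 1+j<d with ℕₚ.m≤n⇒m<n∨m≡n (ℕₚ.≤-pred i<1+j)
  ... | inj₁ i<j    = <-trans (dec j 1+j<d) (decreasing dec i j i<j (ℕₚ.<⇒≤ 1+j<d))
  ... | inj₂ ≡.refl = dec j 1+j<d

  -- The zeros split off one at a time. After division by x - r₀ the remaining r_i are zeros of the
  -- quotient, because r₀ - r_i is positive and can be cancelled; after d divisions the length
  -- leaves only a constant, the leading coefficient.
  factorisation : ∀ d r f → length f ≡ suc d → Decreasing d r →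
    (∀ i → i ℕ.< d → ev f (r i) ≈ 0#) → ∀ j → coeff f j ≈ coeff f d * coeff (∏ r d) j
  factorisation zero r (c ∷ []) len dec root zero    = sym (*-identityʳ c)
  factorisation zero r (c ∷ []) len dec root (suc j) = sym (zeroʳ c)
  factorisation (suc d) r (a ∷ f) len dec root = result
    where
    g P : Poly
    g = quo (a ∷ f) (r 0)
    P = ∏ (r ∘ suc) d
    f≋ : a ∷ f ≋ linear (r 0) 0# g
    f≋ j = trans (division (a ∷ f) (r 0) j) (linear-cong (r 0) g {g} (root 0 (s≤s z≤n)) (λ _ → refl) j)
    g-root : ∀ i → i ℕ.< d → ev g (r (suc i)) ≈ 0#
    g-root i i<d = cancel-0 (decreasing dec 0 (suc i) (s≤s z≤n) (s≤s i<d)) (begin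
      (r 0 - r (suc i)) * ev g (r (suc i))
        ≈⟨ solve 3 (λ x y e → (x :- y) :* e := :- (con (+ 0) :+ (y :- x) :* e)) refl
             (r 0) (r (suc i)) (ev g (r (suc i))) ⟩
      - (0# + (r (suc i) - r 0) * ev g (r (suc i)))
        ≈⟨ -‿cong (ev-linear (r 0) 0# g (r (suc i))) ⟨
      - ev (linear (r 0) 0# g) (r (suc i))
        ≈⟨ -‿cong (ev-≋ (a ∷ f) (linear (r 0) 0# g) _ f≋) ⟨
      - ev (a ∷ f) (r (suc i))
        ≈⟨ -‿cong (root (suc i) (s≤s i<d)) ⟩
      - 0#
        ≈⟨ solve 0 (:- con (+ 0) := con (+ 0)) refl ⟩
      0# ∎)
      where
      open import Relation.Binary.Reasoning.Setoid setoid
    len-f : length f ≡ suc d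
    len-f = ≡.cong ℕ.pred len
    len-g : length g ≡ suc d
    len-g = ≡.trans (length-quo a f (r 0)) len-f
    g≈ : ∀ j → coeff g j ≈ coeff g d * coeff P j
    g≈ = factorisation d (r ∘ suc) g len-g (λ i lt → dec (suc i) (s≤s lt)) g-root
    top : coeff (a ∷ f) (suc d) ≈ coeff g d
    top = trans (f≋ (suc d)) (trans (coeff-linear-suc (r 0) 0# g d)
      (trans (+-congˡ (-‿cong (*-congˡ (coeff-beyond g (ℕₚ.≤-reflexive len-g)))))
        (solve 2 (λ c r → c :- r :* con (+ 0) := c) refl (coeff g d) (r 0))))
    result : ∀ j → coeff (a ∷ f) j ≈ coeff (a ∷ f) (suc d) * coeff (∏ r (suc d)) j
    result zero = trans (f≋ 0) (trans (coeff-linear-0 (r 0) 0# g)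
      (trans (+-congˡ (-‿cong (*-congˡ (g≈ 0))))
      (trans (solve 3 (λ r c e → con (+ 0) :- r :* (c :* e) := c :* (con (+ 0) :- r :* e)) refl
               (r 0) (coeff g d) (coeff P 0))
        (*-cong (sym top) (sym (coeff-linear-0 (r 0) 0# P))))))
    result (suc j) = trans (f≋ (suc j)) (trans (coeff-linear-suc (r 0) 0# g j)
      (trans (+-cong (g≈ j) (-‿cong (*-congˡ (g≈ (suc j)))))
      (trans (solve 4 (λ r c e e′ → c :* e :- r :* (c :* e′) := c :* (e :- r :* e′)) refl
               (r 0) (coeff g d) (coeff P j) (coeff P (suc j)))
        (*-cong (sym top) (sym (coeff-linear-suc (r 0) 0# P j))))))

-- Sign patterns at interlacing points and the Wronskian

module Signs (R : OrderedRing) where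
  open OrderedRing R
  open RingSolver R
  open Polynomials R

  -- The sign (-1)^i. `Pos (σ i * x)` says that x is strictly of this sign, which spares a
  -- distinction by the parity of i.
  σ : ℕ → Carrier
  σ zero    = 1#
  σ (suc i) = - σ i

  σ-sq : ∀ i → σ i * σ i ≈ 1#
  σ-sq zero    = *-identityˡ 1#
  σ-sq (suc i) = trans (solve 1 (λ s → :- s :* :- s := s :* s) refl (σ i)) (σ-sq i)

  same-sign : ∀ i {x y} → Pos (σ i * x) → Pos (x * y) → Pos (σ i * y)
  same-sign i {x} {y} σx xy = Pos-cancel σx (Pos-resp (begin
    x * y                   ≈⟨ *-identityˡ _ ⟨
    1# * (x * y)            ≈⟨ *-congʳ (σ-sq i) ⟨
    σ i * σ i * (x * y)     ≈⟨ solve 3 (λ s x y → s :* s :* (x :* y) := s :* x :* (s :* y)) refl (σ i) x y ⟩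
    σ i * x * (σ i * y)     ∎) xy)
    where open import Relation.Binary.Reasoning.Setoid setoid

  σ-Pos-sq : ∀ i {x} → Pos (σ i * x) → Pos (x * x)
  σ-Pos-sq i {x} σx = Pos-resp (begin
    σ i * x * (σ i * x)  ≈⟨ solve 2 (λ s x → s :* x :* (s :* x) := s :* s :* (x :* x)) refl (σ i) x ⟩
    σ i * σ i * (x * x)  ≈⟨ *-congʳ (σ-sq i) ⟩
    1# * (x * x)         ≈⟨ *-identityˡ _ ⟩
    x * x                ∎) (Pos-* σx σx)
    where open import Relation.Binary.Reasoning.Setoid setoid

  -- Exactly the first i factors x - r_j are negative.
  ∏-sign : ∀ d i r x → i ℕ.≤ d → (∀ j → j ℕ.< i → x < r j) →
    (∀ j → i ℕ.≤ j → j ℕ.< d → r j < x) → Pos (σ i * ev (∏ r d) x)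
  ∏-sign zero zero r x i≤d above below = Pos-resp
    (solve 1 (λ x → con (+ 1) := con (+ 1) :* (con (+ 1) :+ x :* con (+ 0))) refl x) Pos-1
  ∏-sign (suc d) zero r x i≤d above below = Pos-resp
    (trans (solve 3 (λ x y e → (x :- y) :* (con (+ 1) :* e) := con (+ 1) :* ((x :- y) :* e)) refl
             x (r 0) (ev (∏ (r ∘ suc) d) x))
      (*-congˡ (sym (ev-∏ r d x))))
    (Pos-* (below 0 z≤n (s≤s z≤n))
      (∏-sign d 0 (r ∘ suc) x z≤n (λ _ ()) (λ j _ j<d → below (suc j) z≤n (s≤s j<d))))
  ∏-sign (suc d) (suc i) r x (s≤s i≤d) above below = Pos-resp
    (trans (solve 4 (λ s x y e → (y :- x) :* (s :* e) := :- s :* ((x :- y) :* e)) refl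
             (σ i) x (r 0) (ev (∏ (r ∘ suc) d) x))
      (*-congˡ (sym (ev-∏ r d x))))
    (Pos-* (above 0 (s≤s z≤n))
      (∏-sign d i (r ∘ suc) x i≤d (λ j j<i → above (suc j) (s≤s j<i))
        (λ j i≤j j<d → below (suc j) (s≤s i≤j) (s≤s j<d))))

  ∏-root : ∀ d r i → i ℕ.< d → ev (∏ r d) (r i) ≈ 0#
  ∏-root (suc d) r zero _ = trans (ev-∏ r d (r 0))
    (solve 2 (λ x e → (x :- x) :* e := con (+ 0)) refl (r 0) (ev (∏ (r ∘ suc) d) (r 0)))
  ∏-root (suc d) r (suc i) (s≤s i<d) = trans (ev-∏ r d (r (suc i)))
    (trans (*-congˡ (∏-root d (r ∘ suc) i i<d)) (zeroʳ _))

  -- The derivative at r_i is the product of the differences r_i - r_j over j ≠ i, and the negative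
  -- ones are those with j < i.
  ∏-dv-sign : ∀ d r → Decreasing d r → ∀ i → i ℕ.< d → Pos (σ i * dv (∏ r d) (r i))
  ∏-dv-sign (suc d) r dec zero _ = Pos-resp
    (*-congˡ (sym (trans (dv-linear (r 0) 0# P (r 0))
      (solve 3 (λ x e d → e :+ (x :- x) :* d := e) refl (r 0) (ev P (r 0)) (dv P (r 0))))))
    (∏-sign d 0 (r ∘ suc) (r 0) z≤n (λ _ ())
      (λ j _ j<d → decreasing dec 0 (suc j) (s≤s z≤n) (s≤s j<d)))
    where
    P : Poly
    P = ∏ (r ∘ suc) d
  ∏-dv-sign (suc d) r dec (suc i) (s≤s i<d) = Pos-resp
    (sym (trans (*-congˡ (trans (dv-linear (r 0) 0# P (r (suc i)))
            (+-congʳ (∏-root d (r ∘ suc) i i<d))))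
      (solve 4 (λ s x y d → :- s :* (con (+ 0) :+ (x :- y) :* d) := (y :- x) :* (s :* d)) refl
        (σ i) (r (suc i)) (r 0) (dv P (r (suc i))))))
    (Pos-* (decreasing dec 0 (suc i) (s≤s z≤n) (s≤s i<d))
      (∏-dv-sign d (r ∘ suc) (λ i lt → dec (suc i) (s≤s lt)) i i<d))
    where
    P : Poly
    P = ∏ (r ∘ suc) d

  wronskian : Poly → Poly → Carrier → Carrier
  wronskian q p x = ev q x * dv p x - dv q x * ev p x

  -- Peeling off the largest zero r₀: with P = (x - r₀) P′ and κ = P′(r₀) > 0,
  -- κ q - q(r₀) P′ is divisible by x - r₀, and for the quotient g
  -- κ W(q, P) = q(r₀) P′² + (x - r₀)² W(g, P′).
  module Peel (d : ℕ) (r : ℕ → Carrier) (q : Poly) (q≤ : length q ℕ.≤ suc (suc d))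
      (dec : Decreasing (suc d) r)
      (alt : ∀ i → i ℕ.< suc d → Pos (σ i * ev q (r i))) where

    P′ E g : Poly
    P′ = ∏ (r ∘ suc) d
    κ q₀ : Carrier
    κ  = ev P′ (r 0)
    q₀ = ev q (r 0)
    E = comb κ q (- q₀) P′
    g = quo E (r 0)

    κ-Pos : Pos κ
    κ-Pos = Pos-resp (*-identityˡ κ) (∏-sign d 0 (r ∘ suc) (r 0) z≤n (λ _ ())
      (λ j _ j<d → decreasing dec 0 (suc j) (s≤s z≤n) (s≤s j<d)))

    q₀-Pos : Pos q₀
    q₀-Pos = Pos-resp (*-identityˡ q₀) (alt 0 (s≤s z≤n))

    E-length : length E ℕ.≤ suc (suc d)
    E-length = ℕₚ.≤-trans (ℕₚ.≤-reflexive (length-comb κ q (- q₀) P′))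
      (ℕₚ.⊔-lub q≤ (ℕₚ.≤-trans (ℕₚ.≤-reflexive (length-∏ (r ∘ suc) d)) (ℕₚ.n≤1+n (suc d))))

    length-quo-≤ : ∀ p → length p ℕ.≤ suc (suc d) → length (quo p (r 0)) ℕ.≤ suc d
    length-quo-≤ []      _ = z≤n
    length-quo-≤ (a ∷ p) l = ℕₚ.≤-trans (ℕₚ.≤-reflexive (length-quo a p (r 0))) (ℕₚ.≤-pred l)

    g-length : length g ℕ.≤ suc d
    g-length = length-quo-≤ E E-length

    E-root : ev E (r 0) ≈ 0#
    E-root = trans (ev-comb κ q (- q₀) P′ (r 0))
      (solve 2 (λ k q → k :* q :+ (:- q) :* k := con (+ 0)) refl κ q₀)

    E≋ : E ≋ linear (r 0) 0# g
    E≋ j = trans (division E (r 0) j) (linear-cong (r 0) g {g} E-root (λ _ → refl) j)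

    g-ev : ∀ x → κ * ev q x - q₀ * ev P′ x ≈ (x - r 0) * ev g x
    g-ev x = begin
      κ * ev q x - q₀ * ev P′ x       ≈⟨ solve 4 (λ k q c p → k :* q :- c :* p := k :* q :+ (:- c) :* p) refl κ (ev q x) q₀ (ev P′ x) ⟩
      κ * ev q x + (- q₀) * ev P′ x   ≈⟨ ev-comb κ q (- q₀) P′ x ⟨
      ev E x                          ≈⟨ ev-≋ E (linear (r 0) 0# g) x E≋ ⟩
      ev (linear (r 0) 0# g) x        ≈⟨ ev-linear (r 0) 0# g x ⟩
      0# + (x - r 0) * ev g x         ≈⟨ +-identityˡ _ ⟩
      (x - r 0) * ev g x              ∎
      where open import Relation.Binary.Reasoning.Setoid setoid

    g-dv : ∀ x → κ * dv q x - q₀ * dv P′ x ≈ ev g x + (x - r 0) * dv g x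
    g-dv x = begin
      κ * dv q x - q₀ * dv P′ x       ≈⟨ solve 4 (λ k q c p → k :* q :- c :* p := k :* q :+ (:- c) :* p) refl κ (dv q x) q₀ (dv P′ x) ⟩
      κ * dv q x + (- q₀) * dv P′ x   ≈⟨ dv-comb κ q (- q₀) P′ x ⟨
      dv E x                          ≈⟨ dv-≋ E (linear (r 0) 0# g) x E≋ ⟩
      dv (linear (r 0) 0# g) x        ≈⟨ dv-linear (r 0) 0# g x ⟩
      ev g x + (x - r 0) * dv g x     ∎
      where open import Relation.Binary.Reasoning.Setoid setoid

    -- At the other zeros P′ vanishes, so κ q = (x - r₀) g there. The negative factor x - r₀ flips
    -- the sign, which makes up for the shift of the index: the hypotheses are restored for P′ and
    -- g.
    g-alt : ∀ i → i ℕ.< d → Pos (σ i * ev g (r (suc i)))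
    g-alt i i<d = Pos-cancel (decreasing dec 0 (suc i) (s≤s z≤n) (s≤s i<d))
      (Pos-resp (begin
        κ * (- σ i * ev q (r (suc i)))
          ≈⟨ solve 4 (λ k s q c → k :* (:- s :* q) := :- s :* (k :* q :- c :* con (+ 0))) refl
               κ (σ i) (ev q (r (suc i))) q₀ ⟩
        - σ i * (κ * ev q (r (suc i)) - q₀ * 0#)
          ≈⟨ *-congˡ (+-congˡ (-‿cong (*-congˡ (∏-root d (r ∘ suc) i i<d)))) ⟨
        - σ i * (κ * ev q (r (suc i)) - q₀ * ev P′ (r (suc i)))
          ≈⟨ *-congˡ (g-ev (r (suc i))) ⟩
        - σ i * ((r (suc i) - r 0) * ev g (r (suc i)))
          ≈⟨ solve 4 (λ s x y e → :- s :* ((x :- y) :* e) := (y :- x) :* (s :* e)) refl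
               (σ i) (r (suc i)) (r 0) (ev g (r (suc i))) ⟩
        (r 0 - r (suc i)) * (σ i * ev g (r (suc i))) ∎)
        (Pos-* κ-Pos (alt (suc i) (s≤s i<d))))
      where open import Relation.Binary.Reasoning.Setoid setoid

    wronskian-peel : ∀ x → ev P′ x * ev P′ x * q₀ + (x - r 0) * (x - r 0) * wronskian g P′ x
                           ≈ κ * wronskian q (∏ r (suc d)) x
    wronskian-peel x = begin
      p * p * q₀ + y * y * (e * p′ - e′ * p)
        ≈⟨ solve 6 (λ p p′ q₀ y e e′ → p :* p :* q₀ :+ y :* y :* (e :* p′ :- e′ :* p)
             := (y :* e :+ q₀ :* p) :* (p :+ y :* p′) :- (e :+ y :* e′ :+ q₀ :* p′) :* (y :* p)) refl
             p p′ q₀ y e e′ ⟩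
      (y * e + q₀ * p) * (p + y * p′) - (e + y * e′ + q₀ * p′) * (y * p)
        ≈⟨ +-cong (*-congʳ (+-congʳ (g-ev x))) (-‿cong (*-congʳ (+-congʳ (g-dv x)))) ⟨
      (κ * ev q x - q₀ * p + q₀ * p) * (p + y * p′)
        - (κ * dv q x - q₀ * p′ + q₀ * p′) * (y * p)
        ≈⟨ solve 7 (λ k f f′ q₀ p p′ y →
             (k :* f :- q₀ :* p :+ q₀ :* p) :* (p :+ y :* p′)
               :- (k :* f′ :- q₀ :* p′ :+ q₀ :* p′) :* (y :* p)
             := k :* (f :* (p :+ y :* p′) :- f′ :* (y :* p))) refl
             κ (ev q x) (dv q x) q₀ p p′ y ⟩
      κ * (ev q x * (p + y * p′) - dv q x * (y * p))
        ≈⟨ *-congˡ (+-cong (*-congˡ (dv-linear (r 0) 0# P′ x)) (-‿cong (*-congˡ (ev-∏ r d x)))) ⟨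
      κ * wronskian q (∏ r (suc d)) x ∎
      where
      open import Relation.Binary.Reasoning.Setoid setoid
      y p p′ e e′ : Carrier
      y = x - r 0
      p = ev P′ x
      p′ = dv P′ x
      e = ev g x
      e′ = dv g x

  -- Every use of `wronskian-peel` contributes a square times q₀ > 0 and leaves a Wronskian with one
  -- zero less. At the end q is constant and the Wronskian is 0, so the induction carries a weak
  -- inequality.
  wronskian-NonNeg : ∀ d r q → length q ℕ.≤ suc d → Decreasing d r →
    (∀ i → i ℕ.< d → Pos (σ i * ev q (r i))) → ∀ x → NonNeg (wronskian q (∏ r d) x)
  wronskian-NonNeg zero r q q≤ dec alt x = NonNeg-resp
    (trans (solve 2 (λ e x → con (+ 0) := e :* (con (+ 0) :+ x :* con (+ 0))
                              :- con (+ 0) :* (con (+ 1) :+ x :* con (+ 0))) refl (ev q x) x)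
      (+-congˡ (-‿cong (*-congʳ (sym (dv-const q q≤))))))
    (NonNeg-resp (zeroˡ 0#) (NonNeg-sq 0#))
    where
    dv-const : ∀ q → length q ℕ.≤ 1 → dv q x ≈ 0#
    dv-const []            _        = refl
    dv-const (a ∷ [])      _        = solve 1 (λ x → con (+ 0) :+ x :* con (+ 0) := con (+ 0)) refl x
    dv-const (a ∷ b ∷ q)   (s≤s ())
  wronskian-NonNeg (suc d) r q q≤ dec alt x = NonNeg-cancel κ-Pos
    (NonNeg-resp (wronskian-peel x)
      (NonNeg-+ (NonNeg-* (NonNeg-sq (ev P′ x)) (Pos⇒NonNeg q₀-Pos))
        (NonNeg-* (NonNeg-sq (x - r 0))
          (wronskian-NonNeg d (r ∘ suc) g g-length (λ i lt → dec (suc i) (s≤s lt)) g-alt x))))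
    where open Peel d r q q≤ dec alt

  -- A single peeling suffices for strictness. The nonzero value P = (x - r₀) P′ makes P′² (x - r₀)²
  -- positive, hence also its nonnegative factor P′²; the summand P′² q₀ is then positive and the
  -- other one is nonnegative.
  wronskian-Pos : ∀ d r q → length q ℕ.≤ suc (suc d) → Decreasing (suc d) r →
    (∀ i → i ℕ.< suc d → Pos (σ i * ev q (r i))) → ∀ i x → Pos (σ i * ev (∏ r (suc d)) x) →
    Pos (wronskian q (∏ r (suc d)) x)
  wronskian-Pos d r q q≤ dec alt i x σP = Pos-cancel κ-Pos
    (Pos-resp (wronskian-peel x)
      (Pos-+ (Pos-* P′²-Pos q₀-Pos)
        (NonNeg-* (NonNeg-sq (x - r 0))
          (wronskian-NonNeg d (r ∘ suc) g g-length (λ i lt → dec (suc i) (s≤s lt)) g-alt x))))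
    where
    open Peel d r q q≤ dec alt
    P′²-Pos : Pos (ev P′ x * ev P′ x)
    P′²-Pos = NonNeg⇒Pos (NonNeg-sq (ev P′ x)) (Pos-resp
      (trans (*-cong (ev-∏ r d x) (ev-∏ r d x))
        (solve 2 (λ y p → y :* p :* (y :* p) := p :* p :* (y :* y)) refl (x - r 0) (ev P′ x)))
      (σ-Pos-sq i σP))

-- G j l is the coefficient of x ^ j in a polynomial of degree j + l; a grid
-- thus holds one polynomial of every degree.
Grid : Set
Grid = ℕ → ℕ → ℕ

-- Coefficient recurrences, symmetry and unimodality

module Grids where
  open import Data.Nat using (_+_; _*_; _≤_)
  open Data.Nat.Solver.+-*-Solver using (solve; _:=_; _:+_; _:*_; con)

  -- `shiftˡ` is the same polynomial counted as one of degree one higher, `shiftʳ` is multiplication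
  -- by x, and `diagonal` is multiplication by x with the degree raised by two. Exchanging j and l
  -- is ℐ, so `diagonal` preserves palindromes.
  shiftˡ shiftʳ diagonal : Grid → Grid
  shiftˡ G j zero    = 0
  shiftˡ G j (suc l) = G j l
  shiftʳ G zero    l = 0
  shiftʳ G (suc j) l = G j l
  diagonal G j l = shiftˡ (shiftʳ G) j l

  infixl 6 _⊞_
  _⊞_ : Grid → Grid → Grid
  (G ⊞ H) j l = G j l + H j l

  -- The operator T of the introduction.
  step : ℕ → Grid → Grid
  step c G j l = (c * j + 1) * shiftˡ G j l + (c * l + 1) * shiftʳ G j l

  -- Sends C of degree d + 1 to (1 - x) C′ + (d + 1) C of degree d. If B is the numerator of (2m +
  -- 1)^n with n ≥ 1, then B + x `mixed` B is the numerator of (m + 1) (2m + 1)^n.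
  mixed : Grid → Grid
  mixed G j l = (j + 1) * G (suc j) l + (l + 1) * G j (suc l)

  -- typeB n belongs to (2m + 1)^n, and descent n k to (m + 1)^(k + 1) (2m + 1)^n:
  -- the exponent of m + 1 is shifted by one, because the numerator of
  -- (2m + 1)^n does not have the degree n - 1 that the pattern would require.
  typeB : ℕ → Grid
  typeB zero    j l = 1
  typeB (suc n)     = step 2 (typeB n)

  -- The components of the ℐ-decomposition of descent n k.
  partB partA descent : ℕ → ℕ → Grid
  partB n zero    = mixed (typeB n)
  partB n (suc k) = step 1 (partB n k)
  partA n zero    = typeB n
  partA n (suc k) = step 1 (partA n k) ⊞ diagonal (partB n k)
  descent n k = partA n k ⊞ shiftʳ (partB n k)

  -- T (x b) = x T b + x b, where T acts in degree d on the left and in degree d - 1 on the right.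
  -- The surplus x b is palindromic in degree d + 1, the degree of T a, and is therefore counted in
  -- the component a.
  descent-step : ∀ n k j l → descent n (suc k) j l ≡ step 1 (descent n k) j l
  descent-step n k zero zero = ≡.refl
  descent-step n k zero (suc l) =
    solve 2 (λ a l → con 1 :* a :+ (con 1 :* (con 1 :+ l) :+ con 1) :* con 0 :+ con 0 :+ con 0
      := con 1 :* (a :+ con 0) :+ (con 1 :* (con 1 :+ l) :+ con 1) :* con 0) ≡.refl
      (partA n k 0 l) l
  descent-step n k (suc j) zero =
    solve 3 (λ a b j → (con 1 :* (con 1 :+ j) :+ con 1) :* con 0 :+ con 1 :* a :+ con 0
        :+ ((con 1 :* j :+ con 1) :* con 0 :+ con 1 :* b)
      := (con 1 :* (con 1 :+ j) :+ con 1) :* con 0 :+ con 1 :* (a :+ b)) ≡.refl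
      (partA n k j 0) (shiftʳ (partB n k) j 0) j
  descent-step n k (suc j) (suc l) =
    solve 6 (λ a a′ b b′ j l →
      ((con 1 :* (con 1 :+ j) :+ con 1) :* a :+ (con 1 :* (con 1 :+ l) :+ con 1) :* a′ :+ b)
        :+ ((con 1 :* j :+ con 1) :* b :+ (con 1 :* (con 1 :+ l) :+ con 1) :* b′)
      := (con 1 :* (con 1 :+ j) :+ con 1) :* (a :+ b)
         :+ (con 1 :* (con 1 :+ l) :+ con 1) :* (a′ :+ b′)) ≡.refl
      (partA n k (suc j) l) (partA n k j (suc l)) (partB n k j l) (shiftʳ (partB n k) j (suc l)) j l

  reversed : ℕ → ℕ → Grid
  reversed n k j l = descent n k l j

  -- T commutes with ℐ: the transposition swaps the weights c j + 1 and c l + 1 together with the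
  -- two shifts.
  step-transpose : ∀ c G j l → step c (λ j l → G l j) j l ≡ step c G l j
  step-transpose c G zero    zero    = ≡.refl
  step-transpose c G zero    (suc l) = ℕₚ.+-comm ((c * 0 + 1) * G l 0) _
  step-transpose c G (suc j) zero    = ℕₚ.+-comm ((c * suc j + 1) * 0) _
  step-transpose c G (suc j) (suc l) = ℕₚ.+-comm ((c * suc j + 1) * G l (suc j)) _

  reversed-step : ∀ n k j l → reversed n (suc k) j l ≡ step 1 (reversed n k) j l
  reversed-step n k j l = ≡.trans (descent-step n k l j) (≡.sym (step-transpose 1 (descent n k) j l))

  Symmetric : Grid → Set
  Symmetric G = ∀ j l → G j l ≡ G l j

  step-symmetric : ∀ c {G} → Symmetric G → Symmetric (step c G)
  step-symmetric c sym zero    zero    = ≡.refl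
  step-symmetric c {G} sym zero (suc l) = ≡.trans (ℕₚ.+-comm ((c * 0 + 1) * G 0 l) _)
    (≡.cong (λ t → (c * suc l + 1) * 0 + (c * 0 + 1) * t) (sym 0 l))
  step-symmetric c {G} sym (suc j) zero = ≡.trans (ℕₚ.+-comm ((c * suc j + 1) * 0) _)
    (≡.cong (λ t → (c * 0 + 1) * t + (c * suc j + 1) * 0) (sym j 0))
  step-symmetric c {G} sym (suc j) (suc l) = ≡.trans (ℕₚ.+-comm ((c * suc j + 1) * G (suc j) l) _)
    (≡.cong₂ (λ t u → (c * suc l + 1) * t + (c * suc j + 1) * u) (sym j (suc l)) (sym (suc j) l))

  mixed-symmetric : ∀ {G} → Symmetric G → Symmetric (mixed G)
  mixed-symmetric {G} sym j l = ≡.trans (ℕₚ.+-comm ((j + 1) * G (suc j) l) _)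
    (≡.cong₂ (λ t u → (l + 1) * t + (j + 1) * u) (sym j (suc l)) (sym (suc j) l))

  diagonal-symmetric : ∀ {G} → Symmetric G → Symmetric (diagonal G)
  diagonal-symmetric sym zero    zero    = ≡.refl
  diagonal-symmetric sym zero    (suc l) = ≡.refl
  diagonal-symmetric sym (suc j) zero    = ≡.refl
  diagonal-symmetric sym (suc j) (suc l) = sym j l

  typeB-symmetric : ∀ n → Symmetric (typeB n)
  typeB-symmetric zero    j l = ≡.refl
  typeB-symmetric (suc n)     = step-symmetric 2 (typeB-symmetric n)

  partB-symmetric : ∀ n k → Symmetric (partB n k)
  partB-symmetric n zero    = mixed-symmetric (typeB-symmetric n)
  partB-symmetric n (suc k) = step-symmetric 1 (partB-symmetric n k)

  partA-symmetric : ∀ n k → Symmetric (partA n k)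
  partA-symmetric n zero    = typeB-symmetric n
  partA-symmetric n (suc k) j l = ≡.cong₂ _+_ (step-symmetric 1 (partA-symmetric n k) j l)
    (diagonal-symmetric (partB-symmetric n k) j l)

  -- ℐ fixes a and takes x b to b, both being palindromic; hence q = a + b.
  descent-reversed : ∀ n k j l → descent n k l j ≡ (partA n k ⊞ shiftˡ (partB n k)) j l
  descent-reversed n k j zero    = ≡.cong (_+ 0) (partA-symmetric n k 0 j)
  descent-reversed n k j (suc l) =
    ≡.cong₂ _+_ (partA-symmetric n k (suc l) j) (partB-symmetric n k l j)

  -- Growth towards the middle, in degree j + l + 1. For j = l the two entries are the mirror images
  -- in the centre.
  Unimodal : Grid → Set
  Unimodal G = ∀ j l → j ≤ l → G j (suc l) ≤ G (suc j) l

  -- Both sides have total weight α + β + γ. From left to right α moves from y to z, β from x to y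
  -- and γ from x to z, always upwards.
  exchange : ∀ α β γ {x y z} → x ≤ y → y ≤ z →
             α * y + (β + γ) * x ≤ (α + γ) * z + β * y
  exchange α β γ {x} x≤y y≤z with ℕₚ.m≤n⇒∃[o]m+o≡n x≤y | ℕₚ.m≤n⇒∃[o]m+o≡n y≤z
  ... | u , ≡.refl | v , ≡.refl = ℕₚ.≤-trans (ℕₚ.m≤m+n _ ((β + γ) * u + (α + γ) * v))
    (ℕₚ.≤-reflexive (solve 6 (λ α β γ x u v →
      α :* (x :+ u) :+ (β :+ γ) :* x :+ ((β :+ γ) :* u :+ (α :+ γ) :* v)
      := (α :+ γ) :* (x :+ u :+ v) :+ β :* (x :+ u)) ≡.refl α β γ x u v))

  shiftʳ-≤ : ∀ {G} → Unimodal G → ∀ j l → j ≤ l → shiftʳ G j (suc l) ≤ G j l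
  shiftʳ-≤ uni zero    l j≤l = z≤n
  shiftʳ-≤ uni (suc j) l j≤l = uni j l (ℕₚ.<⇒≤ j≤l)

  -- Passing from j to j + 1 raises the first weight by c and lowers the second by c, so `exchange`
  -- with γ = c applies to three consecutive coefficients of G. In the centre the two sides are
  -- mirror images.
  step-unimodal : ∀ c {G} → Symmetric G → Unimodal G → Unimodal (step c G)
  step-unimodal c {G} sym uni j l j≤l with ℕₚ.m≤n⇒m<n∨m≡n j≤l
  ... | inj₂ ≡.refl = ℕₚ.≤-reflexive (step-symmetric c sym j (suc j))
  step-unimodal c {G} sym uni j (suc l) j≤l | inj₁ (s≤s j≤l′) = begin
    (c * j + 1) * G j (suc l) + (c * suc (suc l) + 1) * shiftʳ G j (suc (suc l))
      ≡⟨ ≡.cong (λ t → (c * j + 1) * G j (suc l) + t * shiftʳ G j (suc (suc l)))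
           (solve 2 (λ c l → c :* (con 2 :+ l) :+ con 1 := c :* (con 1 :+ l) :+ con 1 :+ c) ≡.refl c l) ⟩
    (c * j + 1) * G j (suc l) + (c * suc l + 1 + c) * shiftʳ G j (suc (suc l))
      ≤⟨ exchange (c * j + 1) (c * suc l + 1) c (shiftʳ-≤ uni j (suc l) j≤l) (uni j l j≤l′) ⟩
    (c * j + 1 + c) * G (suc j) l + (c * suc l + 1) * G j (suc l)
      ≡⟨ ≡.cong (λ t → t * G (suc j) l + (c * suc l + 1) * G j (suc l))
           (solve 2 (λ c j → c :* j :+ con 1 :+ c := c :* (con 1 :+ j) :+ con 1) ≡.refl c j) ⟩
    (c * suc j + 1) * G (suc j) l + (c * suc l + 1) * G j (suc l) ∎
    where open ℕₚ.≤-Reasoning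

  mixed-unimodal : ∀ {G} → Symmetric G → Unimodal G → Unimodal (mixed G)
  mixed-unimodal {G} sym uni j l j≤l with ℕₚ.m≤n⇒m<n∨m≡n j≤l
  ... | inj₂ ≡.refl = ℕₚ.≤-reflexive (mixed-symmetric sym j (suc j))
  ... | inj₁ j<l = begin
    (j + 1) * G (suc j) (suc l) + (suc l + 1) * G j (suc (suc l))
      ≡⟨ ≡.cong (λ t → (j + 1) * G (suc j) (suc l) + t * G j (suc (suc l))) (ℕₚ.+-comm 1 (l + 1)) ⟩
    (j + 1) * G (suc j) (suc l) + (l + 1 + 1) * G j (suc (suc l))
      ≤⟨ exchange (j + 1) (l + 1) 1 (uni j (suc l) (ℕₚ.m≤n⇒m≤1+n j≤l)) (uni (suc j) l j<l) ⟩
    (j + 1 + 1) * G (suc (suc j)) l + (l + 1) * G (suc j) (suc l)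
      ≡⟨ ≡.cong (λ t → t * G (suc (suc j)) l + (l + 1) * G (suc j) (suc l)) (ℕₚ.+-comm (j + 1) 1) ⟩
    (suc j + 1) * G (suc (suc j)) l + (l + 1) * G (suc j) (suc l) ∎
    where open ℕₚ.≤-Reasoning

  diagonal-unimodal : ∀ {G} → Unimodal G → Unimodal (diagonal G)
  diagonal-unimodal uni zero    l       j≤l       = z≤n
  diagonal-unimodal uni (suc j) (suc l) (s≤s j≤l) = uni j l j≤l

  typeB-unimodal : ∀ n → Unimodal (typeB n)
  typeB-unimodal zero    j l j≤l = ℕₚ.≤-refl
  typeB-unimodal (suc n)         = step-unimodal 2 (typeB-symmetric n) (typeB-unimodal n)

  partB-unimodal : ∀ n k → Unimodal (partB n k)
  partB-unimodal n zero    = mixed-unimodal (typeB-symmetric n) (typeB-unimodal n)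
  partB-unimodal n (suc k) = step-unimodal 1 (partB-symmetric n k) (partB-unimodal n k)

  partA-unimodal : ∀ n k → Unimodal (partA n k)
  partA-unimodal n zero    = typeB-unimodal n
  partA-unimodal n (suc k) j l j≤l = ℕₚ.+-mono-≤
    (step-unimodal 1 (partA-symmetric n k) (partA-unimodal n k) j l j≤l)
    (diagonal-unimodal (partB-unimodal n k) j l j≤l)

  -- With d = j + l + 1, p_j = a_j + b_{j-1} and p_{d-j} = a_j + b_j: the link is the growth of b.
  descent-outer : ∀ n k j l → j ≤ l → descent n k j (suc l) ≤ descent n k (suc l) j
  descent-outer n k j l j≤l = ℕₚ.+-mono-≤
    (ℕₚ.≤-reflexive (partA-symmetric n k j (suc l)))
    (ℕₚ.≤-trans (shiftʳ-≤ (partB-unimodal n k) j l j≤l)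
      (ℕₚ.≤-reflexive (partB-symmetric n k j l)))

  -- Here p_{d-j} = a_j + b_j and p_{j+1} = a_{j+1} + b_j: the link is the growth of a.
  descent-inner : ∀ n k j l → j ≤ l → descent n k (suc l) j ≤ descent n k (suc j) l
  descent-inner n k j l j≤l = ℕₚ.+-mono-≤
    (ℕₚ.≤-trans (ℕₚ.≤-reflexive (partA-symmetric n k (suc l) j)) (partA-unimodal n k j l j≤l))
    (ℕₚ.≤-reflexive (partB-symmetric n k l j))

  step-first : ∀ c G l → step c G 0 (suc l) ≡ G 0 l
  step-first c G l =
    solve 3 (λ c g l → (c :* con 0 :+ con 1) :* g :+ (c :* (con 1 :+ l) :+ con 1) :* con 0 := g)
      ≡.refl c (G 0 l) l

  typeB-first : ∀ n → typeB n 0 n ≡ 1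
  typeB-first zero    = ≡.refl
  typeB-first (suc n) = ≡.trans (step-first 2 (typeB n) n) (typeB-first n)

  partA-first : ∀ n k → partA n k 0 (k + n) ≡ 1
  partA-first n zero    = typeB-first n
  partA-first n (suc k) = ≡.trans (ℕₚ.+-identityʳ _)
    (≡.trans (step-first 1 (partA n k) (k + n)) (partA-first n k))

  partB-first : ∀ n k → 1 ≤ partB (suc n) k 0 (k + n)
  partB-first n zero    = ℕₚ.≤-trans (ℕₚ.≤-reflexive (≡.sym (typeB-first (suc n))))
    (ℕₚ.≤-trans (ℕₚ.m≤n*m (typeB (suc n) 0 (suc n)) (n + 1) {{ℕ.>-nonZero (ℕₚ.m≤n+m 1 n)}})
      (ℕₚ.m≤n+m _ _))
  partB-first n (suc k) = ℕₚ.≤-trans (partB-first n k)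
    (ℕₚ.≤-reflexive (≡.sym (step-first 1 (partB (suc n) k) (k + n))))

  descent-first : ∀ n k → descent n k 0 (k + n) ≡ 1
  descent-first n k = ≡.trans (ℕₚ.+-identityʳ _) (partA-first n k)

  descent-last : ∀ n k → 1 ≤ descent n k (k + n) 0
  descent-last n k = ℕₚ.≤-trans (ℕₚ.≤-reflexive (≡.sym (partA-first n k)))
    (ℕₚ.≤-trans (ℕₚ.m≤m+n _ _) (ℕₚ.≤-reflexive (≡.sym (descent-reversed n k 0 (k + n)))))

  step-last : ∀ c G d → step c G (suc d) 0 ≡ G d 0
  step-last c G d = ≡.trans (≡.sym (step-transpose c G 0 (suc d))) (step-first c (λ j l → G l j) d)

  typeB-last : ∀ n → 1 ≤ typeB n n 0
  typeB-last n = ℕₚ.≤-reflexive (≡.sym (≡.trans (typeB-symmetric n n 0) (typeB-first n)))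

  descent-first′ : ∀ n k → 1 ≤ descent (suc n) k 0 (suc (k + n))
  descent-first′ n k = ℕₚ.≤-reflexive (≡.sym (≡.trans
    (≡.cong (descent (suc n) k 0) (≡.sym (ℕₚ.+-suc k n))) (descent-first (suc n) k)))

  descent-last′ : ∀ n k → 1 ≤ descent (suc n) k (suc (k + n)) 0
  descent-last′ n k = ≡.subst (λ d → 1 ≤ descent (suc n) k d 0) (ℕₚ.+-suc k n) (descent-last (suc n) k)

  partB-last : ∀ n k → 1 ≤ partB (suc n) k (k + n) 0
  partB-last n k = ≡.subst (1 ≤_) (partB-symmetric (suc n) k 0 (k + n)) (partB-first n k)

  partA-last : ∀ n k → 1 ≤ partA (suc n) k (suc (k + n)) 0
  partA-last n k = ℕₚ.≤-reflexive (≡.sym (≡.trans (partA-symmetric (suc n) k _ 0)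
    (≡.trans (≡.cong (partA (suc n) k 0) (≡.sym (ℕₚ.+-suc k n))) (partA-first (suc n) k))))

-- Coefficient lists read off from grids

module GridPolynomials where
  open Grids

  -- Starting at any j keeps the recursion on l structural. The entries are integers because `ivt`
  -- works with integer polynomials.
  antidiagonal : Grid → ℕ → ℕ → List ℤ
  antidiagonal G j zero    = + G j 0 ∷ []
  antidiagonal G j (suc l) = + G j (suc l) ∷ antidiagonal G (suc j) l

  length-antidiagonal : ∀ G j l → length (antidiagonal G j l) ≡ suc l
  length-antidiagonal G j zero    = ≡.refl
  length-antidiagonal G j (suc l) = ≡.cong suc (length-antidiagonal G (suc j) l)

  antidiagonal-cong : ∀ {G H} → (∀ j l → G j l ≡ H j l) →
                      ∀ j l → antidiagonal G j l ≡ antidiagonal H j l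
  antidiagonal-cong G≡H j zero    = ≡.cong (λ n → + n ∷ []) (G≡H j 0)
  antidiagonal-cong G≡H j (suc l) =
    ≡.cong₂ (λ n p → + n ∷ p) (G≡H j (suc l)) (antidiagonal-cong G≡H (suc j) l)

-- The recurrences as differential operators

module GridEvaluation (R : OrderedRing) where
  open Grids
  open GridPolynomials
  open OrderedRing R
  open RingSolver R
  open Polynomials R
  open import Relation.Binary.Reasoning.Setoid setoid

  ⟪_⟫ : List ℤ → Poly
  ⟪_⟫ = map fromℤ

  fromℕ : ℕ → Carrier
  fromℕ n = fromℤ (+ n)

  fromℕ-+ : ∀ m n → fromℕ (m ℕ.+ n) ≈ fromℕ m + fromℕ n
  fromℕ-+ m n = fromℤ-+ (+ m) (+ n)

  fromℕ-* : ∀ m n → fromℕ (m ℕ.* n) ≈ fromℕ m * fromℕ n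
  fromℕ-* m n = trans (reflexive (≡.cong fromℤ (ℤₚ.pos-* m n))) (fromℤ-* (+ m) (+ n))

  fromℕ-suc : ∀ n → fromℕ (suc n) ≈ 1# + fromℕ n
  fromℕ-suc n = trans (fromℕ-+ 1 n) (+-congʳ fromℤ-1)

  fromℕ-lin : ∀ c j → fromℕ (c ℕ.* j ℕ.+ 1) ≈ fromℕ c * fromℕ j + 1#
  fromℕ-lin c j = trans (fromℕ-+ (c ℕ.* j) 1) (+-cong (fromℕ-* c j) fromℤ-1)

  grid : Grid → ℕ → ℕ → Poly
  grid G j l = ⟪ antidiagonal G j l ⟫

  poly : Grid → ℕ → Poly
  poly G d = grid G 0 d

  length-poly : ∀ G d → length (poly G d) ≡ suc d
  length-poly G d = ≡.trans (Listₚ.length-map fromℤ (antidiagonal G 0 d)) (length-antidiagonal G 0 d)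

  coeff-grid : ∀ G j l i → i ℕ.≤ l → coeff (grid G j l) i ≡ fromℕ (G (j ℕ.+ i) (l ℕ.∸ i))
  coeff-grid G j zero    zero    _ = ≡.cong (λ j → fromℕ (G j 0)) (≡.sym (ℕₚ.+-identityʳ j))
  coeff-grid G j (suc l) zero    _ = ≡.cong (λ j → fromℕ (G j (suc l))) (≡.sym (ℕₚ.+-identityʳ j))
  coeff-grid G j (suc l) (suc i) (s≤s i≤l) = ≡.trans (coeff-grid G (suc j) l i i≤l)
    (≡.cong (λ j → fromℕ (G j (l ℕ.∸ i))) (≡.sym (ℕₚ.+-suc j i)))

  step-entry : ∀ c G j l → fromℕ (step c G j l) ≈
    (fromℕ c * fromℕ j + 1#) * fromℕ (shiftˡ G j l) + (fromℕ c * fromℕ l + 1#) * fromℕ (shiftʳ G j l)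
  step-entry c G j l = trans (fromℕ-+ ((c ℕ.* j ℕ.+ 1) ℕ.* shiftˡ G j l) _)
    (+-cong (trans (fromℕ-* (c ℕ.* j ℕ.+ 1) _) (*-congʳ (fromℕ-lin c j)))
            (trans (fromℕ-* (c ℕ.* l ℕ.+ 1) _) (*-congʳ (fromℕ-lin c l))))

  -- Induction over tails needs the formula for the coefficients from x^j on. Cutting there leaves
  -- the contribution of the coefficient of x^(j-1) as a separate term, which vanishes for j = 0.
  step-ev-from : ∀ c G j l x → let C = ev (grid G j l) x ; C′ = dv (grid G j l) x in
    ev (grid (step c G) j (suc l)) x ≈
      (fromℕ c * fromℕ j + 1#) * C + fromℕ c * x * C′
      + (fromℕ c * fromℕ (suc l) + 1#) * fromℕ (shiftʳ G j (suc l))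
      + x * ((fromℕ c * fromℕ l + 1#) * C - fromℕ c * x * C′)
  step-ev-from c G j zero x = trans
    (+-cong (step-entry c G j 1) (*-congˡ (+-congʳ (trans (step-entry c G (suc j) 0)
      (+-congʳ (trans (*-congˡ fromℤ-0) (zeroʳ _)))))))
    (solve 7 (λ c j o i x g s →
      (c :* j :+ con (+ 1)) :* g :+ (c :* i :+ con (+ 1)) :* s
        :+ x :* ((con (+ 0) :+ (c :* o :+ con (+ 1)) :* g) :+ x :* con (+ 0))
      := (c :* j :+ con (+ 1)) :* (g :+ x :* con (+ 0)) :+ c :* x :* (con (+ 0) :+ x :* con (+ 0))
         :+ (c :* i :+ con (+ 1)) :* s
         :+ x :* ((c :* o :+ con (+ 1)) :* (g :+ x :* con (+ 0)) :- c :* x :* (con (+ 0) :+ x :* con (+ 0)))) refl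
      (fromℕ c) (fromℕ j) (fromℕ 0) (fromℕ 1) x (fromℕ (G j 0)) (fromℕ (shiftʳ G j 1)))
  step-ev-from c G j (suc l) x = begin
    ev (grid (step c G) j (suc (suc l))) x
      ≈⟨ +-cong (step-entry c G j (suc (suc l))) (*-congˡ (step-ev-from c G (suc j) l x)) ⟩
    (ĉ * ĵ + 1#) * g + (ĉ * l″ + 1#) * s
      + x * ((ĉ * fromℕ (suc j) + 1#) * D + ĉ * x * D′ + (ĉ * l′ + 1#) * g
             + x * ((ĉ * l̂ + 1#) * D - ĉ * x * D′))
      ≈⟨ +-congˡ (*-congˡ (+-cong (+-congʳ (+-congʳ (*-congʳ (+-congʳ (*-congˡ (fromℕ-suc j))))))
           (*-congˡ (+-congʳ (*-congʳ (+-congʳ (*-congˡ l̂≈))))))) ⟩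
    (ĉ * ĵ + 1#) * g + (ĉ * l″ + 1#) * s
      + x * ((ĉ * (1# + ĵ) + 1#) * D + ĉ * x * D′ + (ĉ * l′ + 1#) * g
             + x * ((ĉ * (l′ - 1#) + 1#) * D - ĉ * x * D′))
      ≈⟨ solve 9 (λ c j l₁ l₂ x g s d d′ →
           (c :* j :+ con (+ 1)) :* g :+ (c :* l₂ :+ con (+ 1)) :* s
             :+ x :* ((c :* (con (+ 1) :+ j) :+ con (+ 1)) :* d :+ c :* x :* d′ :+ (c :* l₁ :+ con (+ 1)) :* g
               :+ x :* ((c :* (l₁ :- con (+ 1)) :+ con (+ 1)) :* d :- c :* x :* d′))
           := (c :* j :+ con (+ 1)) :* (g :+ x :* d) :+ c :* x :* (d :+ x :* d′)
             :+ (c :* l₂ :+ con (+ 1)) :* s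
             :+ x :* ((c :* l₁ :+ con (+ 1)) :* (g :+ x :* d) :- c :* x :* (d :+ x :* d′))) refl
           ĉ ĵ l′ l″ x g s D D′ ⟩
    (ĉ * ĵ + 1#) * (g + x * D) + ĉ * x * (D + x * D′) + (ĉ * l″ + 1#) * s
      + x * ((ĉ * l′ + 1#) * (g + x * D) - ĉ * x * (D + x * D′)) ∎
    where
    ĉ ĵ l̂ l′ l″ g s D D′ : Carrier
    ĉ = fromℕ c
    ĵ = fromℕ j
    l̂ = fromℕ l
    l′ = fromℕ (suc l)
    l″ = fromℕ (suc (suc l))
    g = fromℕ (G j (suc l))
    s = fromℕ (shiftʳ G j (suc (suc l)))
    D = ev (grid G (suc j) l) x
    D′ = dv (grid G (suc j) l) x
    l̂≈ : l̂ ≈ l′ - 1#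
    l̂≈ = trans (solve 1 (λ l → l := con (+ 1) :+ l :- con (+ 1)) refl l̂) (+-congʳ (sym (fromℕ-suc l)))

  step-ev : ∀ c G d x → ev (poly (step c G) (suc d)) x ≈
    fromℕ c * (x * (1# - x)) * dv (poly G d) x + (1# + (fromℕ c * fromℕ d + 1#) * x) * ev (poly G d) x
  step-ev c G d x = trans (step-ev-from c G 0 d x) (trans
    (+-congʳ (+-cong (+-congʳ (*-congʳ (+-congʳ (*-congˡ fromℤ-0)))) (*-congˡ fromℤ-0)))
    (solve 6 (λ c d d₁ x C C′ →
      (c :* con (+ 0) :+ con (+ 1)) :* C :+ c :* x :* C′ :+ (c :* d₁ :+ con (+ 1)) :* con (+ 0)
        :+ x :* ((c :* d :+ con (+ 1)) :* C :- c :* x :* C′)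
      := c :* (x :* (con (+ 1) :- x)) :* C′ :+ (con (+ 1) :+ (c :* d :+ con (+ 1)) :* x) :* C) refl
      (fromℕ c) (fromℕ d) (fromℕ (suc d)) x (ev (poly G d) x) (dv (poly G d) x)))

  mixed-ev-from : ∀ G j l x → let C = ev (grid G j (suc l)) x ; C′ = dv (grid G j (suc l)) x in
    ev (grid (mixed G) j l) x ≈
      fromℕ j * ev (grid G (suc j) l) x + C′ + ((1# + fromℕ l) * C - x * C′)
  mixed-ev-from G j zero x = trans
    (+-congʳ (trans (fromℕ-+ ((j ℕ.+ 1) ℕ.* G (suc j) 0) _) (+-cong
      (trans (fromℕ-* (j ℕ.+ 1) _) (*-congʳ (trans (fromℕ-+ j 1) (+-congˡ fromℤ-1))))
      (trans (fromℕ-* 1 _) (*-congʳ fromℤ-1)))))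
    (trans (solve 4 (λ j x g₀ g₁ →
      (j :+ con (+ 1)) :* g₁ :+ con (+ 1) :* g₀ :+ x :* con (+ 0)
      := j :* (g₁ :+ x :* con (+ 0)) :+ (g₁ :+ x :* con (+ 0) :+ x :* (con (+ 0) :+ x :* con (+ 0)))
        :+ ((con (+ 1) :+ con (+ 0)) :* (g₀ :+ x :* (g₁ :+ x :* con (+ 0)))
            :- x :* (g₁ :+ x :* con (+ 0) :+ x :* (con (+ 0) :+ x :* con (+ 0))))) refl
      (fromℕ j) x (fromℕ (G j 1)) (fromℕ (G (suc j) 0)))
      (+-congˡ (+-congʳ (*-congʳ (+-congˡ (sym fromℤ-0))))))
  mixed-ev-from G j (suc l) x = begin
    ev (grid (mixed G) j (suc l)) x
      ≈⟨ +-cong (trans (fromℕ-+ ((j ℕ.+ 1) ℕ.* G (suc j) (suc l)) _) (+-cong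
           (trans (fromℕ-* (j ℕ.+ 1) _) (*-congʳ (trans (fromℕ-+ j 1) (+-congˡ fromℤ-1))))
           (trans (fromℕ-* (suc l ℕ.+ 1) _) (*-congʳ (trans (fromℕ-+ (suc l) 1) (+-congˡ fromℤ-1))))))
         (*-congˡ (mixed-ev-from G (suc j) l x)) ⟩
    (ĵ + 1#) * g₁ + (l′ + 1#) * g₀
      + x * (fromℕ (suc j) * T + (T + x * T′) + ((1# + l̂) * (g₁ + x * T) - x * (T + x * T′)))
      ≈⟨ +-congˡ (*-congˡ (+-cong (+-congʳ (*-congʳ (fromℕ-suc j))) (+-congʳ (*-congʳ (sym (fromℕ-suc l)))))) ⟩
    (ĵ + 1#) * g₁ + (l′ + 1#) * g₀
      + x * ((1# + ĵ) * T + (T + x * T′) + (l′ * (g₁ + x * T) - x * (T + x * T′)))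
      ≈⟨ solve 7 (λ j l x g₀ g₁ t t′ →
           (j :+ con (+ 1)) :* g₁ :+ (l :+ con (+ 1)) :* g₀
             :+ x :* ((con (+ 1) :+ j) :* t :+ (t :+ x :* t′) :+ (l :* (g₁ :+ x :* t) :- x :* (t :+ x :* t′)))
           := j :* (g₁ :+ x :* t) :+ (g₁ :+ x :* t :+ x :* (t :+ x :* t′))
             :+ ((con (+ 1) :+ l) :* (g₀ :+ x :* (g₁ :+ x :* t))
                 :- x :* (g₁ :+ x :* t :+ x :* (t :+ x :* t′)))) refl
           ĵ l′ x g₀ g₁ T T′ ⟩
    ĵ * (g₁ + x * T) + (g₁ + x * T + x * (T + x * T′))
      + ((1# + l′) * (g₀ + x * (g₁ + x * T)) - x * (g₁ + x * T + x * (T + x * T′))) ∎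
    where
    ĵ l̂ l′ g₀ g₁ T T′ : Carrier
    ĵ = fromℕ j
    l̂ = fromℕ l
    l′ = fromℕ (suc l)
    g₀ = fromℕ (G j (suc (suc l)))
    g₁ = fromℕ (G (suc j) (suc l))
    T = ev (grid G (suc (suc j)) l) x
    T′ = dv (grid G (suc (suc j)) l) x

  mixed-ev : ∀ G d x → ev (poly (mixed G) d) x ≈
    (1# - x) * dv (poly G (suc d)) x + (1# + fromℕ d) * ev (poly G (suc d)) x
  mixed-ev G d x = trans (mixed-ev-from G 0 d x) (trans (+-congʳ (+-congʳ (*-congʳ fromℤ-0)))
    (solve 5 (λ t x C C′ d → con (+ 0) :* t :+ C′ :+ (d :* C :- x :* C′)
      := (con (+ 1) :- x) :* C′ :+ d :* C) refl
      (ev (grid G 1 d) x) x (ev (poly G (suc d)) x) (dv (poly G (suc d)) x) (1# + fromℕ d)))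

  ev-⊞-shiftʳ-from : ∀ G H j l x →
    ev (grid (G ⊞ shiftʳ H) (suc j) l) x ≈ ev (grid G (suc j) l) x + ev (grid H j l) x
  ev-⊞-shiftʳ-from G H j zero x = trans (+-congʳ (fromℕ-+ (G (suc j) 0) _))
    (solve 3 (λ g h x → g :+ h :+ x :* con (+ 0) := g :+ x :* con (+ 0) :+ (h :+ x :* con (+ 0))) refl _ _ x)
  ev-⊞-shiftʳ-from G H j (suc l) x =
    trans (+-cong (fromℕ-+ (G (suc j) (suc l)) _) (*-congˡ (ev-⊞-shiftʳ-from G H (suc j) l x)))
    (solve 5 (λ g h x e f → g :+ h :+ x :* (e :+ f) := g :+ x :* e :+ (h :+ x :* f)) refl _ _ x _ _)

  ev-⊞-shiftʳ : ∀ G H d x →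
    ev (poly (G ⊞ shiftʳ H) (suc d)) x ≈ ev (poly G (suc d)) x + x * ev (poly H d) x
  ev-⊞-shiftʳ G H d x =
    trans (+-cong (reflexive (≡.cong fromℕ (ℕₚ.+-identityʳ _))) (*-congˡ (ev-⊞-shiftʳ-from G H 0 d x)))
    (solve 4 (λ g x e f → g :+ x :* (e :+ f) := g :+ x :* e :+ x :* f) refl _ x _ _)

  ev-⊞-shiftˡ : ∀ G H j l x →
    ev (grid (G ⊞ shiftˡ H) j (suc l)) x ≈ ev (grid G j (suc l)) x + ev (grid H j l) x
  ev-⊞-shiftˡ G H j zero x =
    trans (+-cong (fromℕ-+ (G j 1) _) (*-congˡ (+-congʳ (reflexive (≡.cong fromℕ (ℕₚ.+-identityʳ _))))))
    (solve 4 (λ g h x g₁ → g :+ h :+ x :* (g₁ :+ x :* con (+ 0))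
      := g :+ x :* (g₁ :+ x :* con (+ 0)) :+ (h :+ x :* con (+ 0))) refl _ _ x _)
  ev-⊞-shiftˡ G H j (suc l) x =
    trans (+-cong (fromℕ-+ (G j (suc (suc l))) _) (*-congˡ (ev-⊞-shiftˡ G H (suc j) l x)))
    (solve 5 (λ g h x e f → g :+ h :+ x :* (e :+ f) := g :+ x :* e :+ (h :+ x :* f)) refl _ _ x _ _)

-- Zeros are found for each i < d separately, whereas sequences of zeros are total functions; the
-- default fills the indices from d on.
choose : ∀ {A : Set} (P : ℕ → A → Set) d → A → (∀ i → i ℕ.< d → ∃ (P i)) →
         ∃ λ (r : ℕ → A) → ∀ i → i ℕ.< d → P i (r i)
choose {A} P d default f = (λ i → value i (i ℕ.<? d)) , λ i i<d → correct i i<d (i ℕ.<? d)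
  where
  value : ∀ i → Dec (i ℕ.< d) → A
  value i (yes i<d) = proj₁ (f i i<d)
  value i (no _)    = default
  correct : ∀ i → i ℕ.< d → (dec : Dec (i ℕ.< d)) → P i (value i dec)
  correct i i<d (yes i<d′) = proj₂ (f i i<d′)
  correct i i<d (no i≮d)   = contradiction i<d i≮d

-- Locating zeros by strict sign changes

module RootFinding (R : OrderedRing) where
  open Grids
  open GridPolynomials
  open OrderedRing R
  open RingSolver R
  open Polynomials R
  open Signs R
  open GridEvaluation R
  open import Relation.Binary.Reasoning.Setoid setoid

  coeff-scale : ∀ c p j → coeff (map (c *_) p) j ≈ c * coeff p j
  coeff-scale c []      j       = sym (zeroʳ c)
  coeff-scale c (a ∷ p) zero    = refl
  coeff-scale c (a ∷ p) (suc j) = coeff-scale c p j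

  ev-scale : ∀ c p x → ev (map (c *_) p) x ≈ c * ev p x
  ev-scale c []      x = sym (zeroʳ c)
  ev-scale c (a ∷ p) x = trans (+-congˡ (*-congˡ (ev-scale c p x)))
    (solve 4 (λ c a x e → c :* a :+ x :* (c :* e) := c :* (a :+ x :* e)) refl c a x _)

  dv-scale : ∀ c p x → dv (map (c *_) p) x ≈ c * dv p x
  dv-scale c []      x = sym (zeroʳ c)
  dv-scale c (a ∷ p) x = trans (+-cong (ev-scale c p x) (*-congˡ (dv-scale c p x)))
    (solve 4 (λ c e x d → c :* e :+ x :* (c :* d) := c :* (e :+ x :* d)) refl c _ x _)

  ev-neg : ∀ f x → ev ⟪ map ℤ.-_ f ⟫ x ≈ - ev ⟪ f ⟫ x
  ev-neg []      x = solve 0 (con (+ 0) := :- con (+ 0)) refl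
  ev-neg (a ∷ f) x = trans (+-cong (fromℤ-neg a) (*-congˡ (ev-neg f x)))
    (solve 3 (λ a x e → :- a :+ x :* (:- e) := :- (a :+ x :* e)) refl (fromℤ a) x _)

  σ-neg : ∀ i f x → Pos (σ (suc i) * ev ⟪ f ⟫ x) → Pos (σ i * ev ⟪ map ℤ.-_ f ⟫ x)
  σ-neg i f x = Pos-resp (trans (solve 2 (λ s e → :- s :* e := s :* (:- e)) refl (σ i) _)
    (*-congˡ (sym (ev-neg f x))))

  -- The zero ρ of `ivt` splits off as f = (x - ρ) g, so the strict signs of f at u and v turn ρ ≤ u
  -- and v ≤ ρ into strict inequalities. Each step in i replaces f by -f.
  bracket : ∀ i f {u v} → v < u → Pos (σ i * ev ⟪ f ⟫ u) → Pos (σ (suc i) * ev ⟪ f ⟫ v) →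
            ∃ λ ρ → v < ρ × ρ < u × ev ⟪ f ⟫ ρ ≈ 0#
  bracket zero f {u} {v} v<u fu fv
    with ρ , ρ≤u , v≤ρ , root ← ivt f v<u (Pos-resp (*-identityˡ _) fu)
           (Pos-resp (solve 1 (λ e → :- con (+ 1) :* e := :- e) refl (ev ⟪ f ⟫ v)) fv) = ρ ,
      NonNeg⇒Pos v≤ρ (Pos-resp (begin
        - 1# * ev ⟪ f ⟫ v                          ≈⟨ *-congˡ (from-root v) ⟩
        - 1# * ((v - ρ) * ev (quo ⟪ f ⟫ ρ) v)
          ≈⟨ solve 3 (λ v ρ e → :- con (+ 1) :* ((v :- ρ) :* e) := (ρ :- v) :* e) refl v ρ _ ⟩
        (ρ - v) * ev (quo ⟪ f ⟫ ρ) v               ∎) fv) ,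
      NonNeg⇒Pos ρ≤u (Pos-resp (trans (*-identityˡ _) (from-root u)) fu) ,
      root
    where
    from-root : ∀ x → ev ⟪ f ⟫ x ≈ (x - ρ) * ev (quo ⟪ f ⟫ ρ) x
    from-root x = trans (ev-division ⟪ f ⟫ ρ x) (trans (+-congʳ root) (+-identityˡ _))
  bracket (suc i) f {u} {v} v<u fu fv
    with ρ , v<ρ , ρ<u , root ← bracket i (map ℤ.-_ f) v<u (σ-neg i f u fu) (σ-neg (suc i) f v fv) =
      ρ , v<ρ , ρ<u , (begin
        ev ⟪ f ⟫ ρ         ≈⟨ solve 1 (λ e → e := :- (:- e)) refl _ ⟩
        - - ev ⟪ f ⟫ ρ     ≈⟨ -‿cong (ev-neg f ρ) ⟨
        - ev ⟪ map ℤ.-_ f ⟫ ρ  ≈⟨ -‿cong root ⟩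
        - 0#               ≈⟨ solve 0 (:- con (+ 0) := con (+ 0)) refl ⟩
        0#                 ∎)

  fromℕ-NonNeg : ∀ n → NonNeg (fromℕ n)
  fromℕ-NonNeg zero    = NonNeg-resp (trans (zeroˡ 0#) (sym fromℤ-0)) (NonNeg-sq 0#)
  fromℕ-NonNeg (suc n) = NonNeg-resp (sym (fromℕ-suc n)) (NonNeg-+ (Pos⇒NonNeg Pos-1) (fromℕ-NonNeg n))

  fromℕ-Pos : ∀ {n} → 1 ℕ.≤ n → Pos (fromℕ n)
  fromℕ-Pos {suc n} _ = Pos-resp (sym (fromℕ-suc n)) (Pos-+ Pos-1 (fromℕ-NonNeg n))

  fromℕ-mono : ∀ {m n} → m ℕ.≤ n → NonNeg (fromℕ n - fromℕ m)
  fromℕ-mono {m} {n} m≤n = NonNeg-resp (begin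
    fromℕ (n ℕ.∸ m)                      ≈⟨ solve 2 (λ x m → x := m :+ x :- m) refl _ (fromℕ m) ⟩
    fromℕ m + fromℕ (n ℕ.∸ m) - fromℕ m  ≈⟨ +-congʳ (fromℕ-+ m (n ℕ.∸ m)) ⟨
    fromℕ (m ℕ.+ (n ℕ.∸ m)) - fromℕ m    ≈⟨ +-congʳ (reflexive (≡.cong fromℕ (ℕₚ.m+[n∸m]≡n m≤n))) ⟩
    fromℕ n - fromℕ m                    ∎) (fromℕ-NonNeg (n ℕ.∸ m))

  σ-bounded : ∀ i → NonNeg (1# - σ i) × NonNeg (1# + σ i)
  σ-bounded zero =
    NonNeg-resp (solve 0 (con (+ 0) :* con (+ 0) := con (+ 1) :- con (+ 1)) refl) (NonNeg-sq 0#) ,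
    NonNeg-+ (Pos⇒NonNeg Pos-1) (Pos⇒NonNeg Pos-1)
  σ-bounded (suc i) with lo , hi ← σ-bounded i =
    NonNeg-resp (solve 1 (λ s → con (+ 1) :+ s := con (+ 1) :- (:- s)) refl (σ i)) hi , lo

  -- Horner induction from the leading coefficient down. The bound is 1 rather than 0 because a tail
  -- of absolute value at least 1, multiplied by -y ≥ g + 1, still exceeds the next coefficient g by
  -- 1.
  sign-far-left : ∀ G j l → 1 ℕ.≤ G (j ℕ.+ l) 0 → ∃ λ M → ∀ y → NonNeg (- y - fromℕ M) →
    NonNeg (σ l * ev (grid G j l) y - 1#)
  sign-far-left G j zero top = 0 , λ y _ → NonNeg-resp (begin
      fromℕ (g ℕ.∸ 1)              ≈⟨ solve 1 (λ n → n := con (+ 1) :+ n :- con (+ 1)) refl _ ⟩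
      1# + fromℕ (g ℕ.∸ 1) - 1#    ≈⟨ +-congʳ (fromℕ-suc (g ℕ.∸ 1)) ⟨
      fromℕ (suc (g ℕ.∸ 1)) - 1#   ≈⟨ +-congʳ (reflexive (≡.cong fromℕ (ℕₚ.m+[n∸m]≡n top′))) ⟩
      fromℕ g - 1#
        ≈⟨ solve 2 (λ g y → g :- con (+ 1) := con (+ 1) :* (g :+ y :* con (+ 0)) :- con (+ 1)) refl _ y ⟩
      σ 0 * ev (grid G j 0) y - 1# ∎) (fromℕ-NonNeg (g ℕ.∸ 1))
    where
    g : ℕ
    g = G j 0
    top′ : 1 ℕ.≤ g
    top′ = ≡.subst (λ j → 1 ℕ.≤ G j 0) (ℕₚ.+-identityʳ j) top
  sign-far-left G j (suc l) top
    with M , hyp ← sign-far-left G (suc j) l (≡.subst (λ j → 1 ℕ.≤ G j 0) (ℕₚ.+-suc j l) top) =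
      M ℕ.+ suc g , bound
    where
    g : ℕ
    g = G j (suc l)
    bound : ∀ y → NonNeg (- y - fromℕ (M ℕ.+ suc g)) → NonNeg (σ (suc l) * ev (grid G j (suc l)) y - 1#)
    bound y y≤ = NonNeg-resp
      (solve 5 (λ s e y M g →
        (:- y) :* (s :* e :- con (+ 1)) :+ (:- y :- (M :+ (con (+ 1) :+ g)) :+ (M :+ g :* (con (+ 1) :- s)))
        := :- s :* (g :+ y :* e) :- con (+ 1)) refl (σ l) (ev (grid G (suc j) l) y) y (fromℕ M) (fromℕ g))
      (NonNeg-+ (NonNeg-* -y≥0 (hyp y y≤M))
        (NonNeg-+ y≤′ (NonNeg-+ (fromℕ-NonNeg M) (NonNeg-* (fromℕ-NonNeg g) (proj₁ (σ-bounded l))))))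
      where
      y≤′ : NonNeg (- y - (fromℕ M + (1# + fromℕ g)))
      y≤′ = NonNeg-resp (+-congˡ (-‿cong (trans (fromℕ-+ M (suc g)) (+-congˡ (fromℕ-suc g))))) y≤
      y≤M : NonNeg (- y - fromℕ M)
      y≤M = NonNeg-resp
        (solve 3 (λ y M g → :- y :- (M :+ (con (+ 1) :+ g)) :+ (con (+ 1) :+ g) := :- y :- M) refl
          y (fromℕ M) (fromℕ g))
        (NonNeg-+ y≤′ (NonNeg-+ (Pos⇒NonNeg Pos-1) (fromℕ-NonNeg g)))
      -y≥0 : NonNeg (- y)
      -y≥0 = NonNeg-resp (solve 2 (λ y M → :- y :- M :+ M := :- y) refl y (fromℕ M))
        (NonNeg-+ y≤M (fromℕ-NonNeg M))

  far-left : ∀ G d → 1 ℕ.≤ G d 0 → ∀ u → ∃ λ z → z < u × Pos (σ d * ev (poly G d) z)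
  far-left G d top u with M , hyp ← sign-far-left G 0 d top | N , N+u ← archimedean u =
    z ,
    Pos-resp (solve 3 (λ N u M → N :+ u :+ M := u :- :- (M :+ N)) refl (fromℕ N) u (fromℕ M))
      (Pos-+ N+u (fromℕ-NonNeg M)) ,
    Pos-resp (solve 1 (λ e → con (+ 1) :+ (e :- con (+ 1)) := e) refl _) (Pos-+ Pos-1 (hyp z
      (NonNeg-resp (solve 2 (λ N M → N := :- :- (M :+ N) :- M) refl (fromℕ N) (fromℕ M)) (fromℕ-NonNeg N))))
    where
    z : Carrier
    z = - (fromℕ M + fromℕ N)

  record Zeros (f : List ℤ) (d : ℕ) (r : ℕ → Carrier) : Set where
    field
      distinct : Decreasing d r
      root     : ∀ i → i ℕ.< d → ev ⟪ f ⟫ (r i) ≈ 0#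

  Negative : ℕ → (ℕ → Carrier) → Set
  Negative d r = ∀ i → i ℕ.< d → r i < 0#

  antidiagonal-top : ∀ G d → coeff (poly G d) d ≈ fromℕ (G d 0)
  antidiagonal-top G d = reflexive (≡.trans (coeff-grid G 0 d d ℕₚ.≤-refl)
    (≡.cong (λ l → fromℕ (G d l)) (ℕₚ.n∸n≡0 d)))

  module Factored {G d r} (top : 1 ℕ.≤ G d 0) (zeros : Zeros (antidiagonal G 0 d) d r) where
    open Zeros zeros

    c : Carrier
    c = fromℕ (G d 0)

    c-Pos : Pos c
    c-Pos = fromℕ-Pos top

    factored : ∀ j → coeff (poly G d) j ≈ c * coeff (∏ r d) j
    factored j = trans (factorisation d r (poly G d) (length-poly G d) distinct root j)
      (*-congʳ (antidiagonal-top G d))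

    factored-≋ : poly G d ≋ map (c *_) (∏ r d)
    factored-≋ j = trans (factored j) (sym (coeff-scale c (∏ r d) j))

    ev-factored : ∀ x → ev (poly G d) x ≈ c * ev (∏ r d) x
    ev-factored x = trans (ev-≋ (poly G d) (map (c *_) (∏ r d)) x factored-≋) (ev-scale c (∏ r d) x)

    dv-factored : ∀ x → dv (poly G d) x ≈ c * dv (∏ r d) x
    dv-factored x = trans (dv-≋ (poly G d) (map (c *_) (∏ r d)) x factored-≋) (dv-scale c (∏ r d) x)

    scaled : ∀ i {x y} → Pos (σ i * x) → y ≈ c * x → Pos (σ i * y)
    scaled i {x} σx y≈ = Pos-resp
      (trans (solve 3 (λ c s x → c :* (s :* x) := s :* (c :* x)) refl c (σ i) x) (*-congˡ (sym y≈)))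
      (Pos-* c-Pos σx)

    sign-between : ∀ i x → i ℕ.≤ d → (∀ j → suc j ≡ i → x < r j) → (i ℕ.< d → r i < x) →
                   Pos (σ i * ev (∏ r d) x)
    sign-between i x i≤d above below = ∏-sign d i r x i≤d up down
      where
      up : ∀ j → j ℕ.< i → x < r j
      up j (s≤s {n = i′} j≤i′) with ℕₚ.m≤n⇒m<n∨m≡n j≤i′
      ... | inj₂ ≡.refl = above j ≡.refl
      ... | inj₁ j<i′ = <-trans (above i′ ≡.refl) (decreasing distinct j i′ j<i′ i≤d)
      down : ∀ j → i ℕ.≤ j → j ℕ.< d → r j < x
      down j i≤j j<d with ℕₚ.m≤n⇒m<n∨m≡n i≤j
      ... | inj₂ ≡.refl = below j<d
      ... | inj₁ i<j = <-trans (decreasing distinct i j i<j j<d) (below (ℕₚ.<-trans i<j j<d))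

    ev-sign : ∀ i x → i ℕ.≤ d → (∀ j → suc j ≡ i → x < r j) → (i ℕ.< d → r i < x) →
              Pos (σ i * ev (poly G d) x)
    ev-sign i x i≤d above below = scaled i (sign-between i x i≤d above below) (ev-factored x)

    dv-sign : ∀ i → i ℕ.< d → Pos (σ i * dv (poly G d) (r i))
    dv-sign i i<d = scaled i (∏-dv-sign d r distinct i i<d) (dv-factored (r i))

  -- ρ 0 > r 0 > ρ 1 > r 1 > ...; for e = d + 1 the last ρ has no r below it.
  record Above (e d : ℕ) (ρ r : ℕ → Carrier) : Set where
    field
      lower : ∀ i → i ℕ.< e → i ℕ.< d → r i < ρ i
      upper : ∀ i → suc i ℕ.< e → ρ (suc i) < r i

    decreasingˡ : e ℕ.≤ suc d → Decreasing e ρ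
    decreasingˡ e≤ i 1+i<e = <-trans (upper i 1+i<e)
      (lower i (ℕₚ.<⇒≤ 1+i<e) (ℕₚ.≤-pred (ℕₚ.≤-trans 1+i<e e≤)))

    above-pred : ∀ i → i ℕ.< e → ∀ j → suc j ≡ i → ρ i < r j
    above-pred .(suc j) i<e j ≡.refl = upper j i<e

-- Induction on the exponent of m + 1

module DescentInduction (R : OrderedRing) where
  open Grids
  open GridPolynomials
  open OrderedRing R
  open RingSolver R
  open Polynomials R
  open Signs R
  open GridEvaluation R
  open RootFinding R
  open import Relation.Binary.Reasoning.Setoid setoid

  -- The right end of the interval searched for the i-th new zero. The origin can serve for i = 0
  -- because the constant coefficient is positive.
  ceiling : (ℕ → Carrier) → ℕ → Carrier
  ceiling r zero    = 0#
  ceiling r (suc i) = r i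

  below-ceiling : ∀ {d r} → Decreasing d r → Negative d r → ∀ i → i ℕ.< d → r i < ceiling r i
  below-ceiling dec neg zero    i<d = neg 0 i<d
  below-ceiling dec neg (suc i) i<d = dec i i<d

  -- When e = d + 1, the last zero lies to the left of r (d - 1), where the sign
  -- is that of the leading term.
  interlace : ∀ H e d r → e ℕ.≤ suc d → 1 ℕ.≤ H 0 e → 1 ℕ.≤ H e 0 →
    Decreasing d r → Negative d r →
    (∀ i → i ℕ.< d → Pos (σ (suc i) * ev (poly H e) (r i))) →
    ∃ λ ρ → Zeros (antidiagonal H 0 e) e ρ × Negative e ρ × Above e d ρ r
  interlace H e d r e≤ first top dec neg sign = conclude (choose P e 0# find)
    where
    P : ℕ → Carrier → Set
    P i ρ = ρ < ceiling r i × (i ℕ.< d → r i < ρ) × ev (poly H e) ρ ≈ 0#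

    sign-0 : Pos (ev (poly H e) 0#)
    sign-0 = Pos-resp (trans (reflexive (≡.sym (coeff-grid H 0 e 0 z≤n))) (sym (ev-0 (poly H e))))
      (fromℕ-Pos first)

    sign-ceiling : ∀ i → i ℕ.≤ d → Pos (σ i * ev (poly H e) (ceiling r i))
    sign-ceiling zero    _   = Pos-resp (sym (*-identityˡ _)) sign-0
    sign-ceiling (suc i) i<d = sign i i<d

    inner : ∀ i → i ℕ.< d → ∃ (P i)
    inner i i<d =
      let ρ , r<ρ , ρ<y , root = bracket i (antidiagonal H 0 e)
            (below-ceiling dec neg i i<d) (sign-ceiling i (ℕₚ.<⇒≤ i<d)) (sign i i<d)
      in ρ , ρ<y , (λ _ → r<ρ) , root

    last : ∀ i → e ≡ suc i → d ≡ i → ∃ (P i)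
    last i e≡ d≡ =
      let z , z<y , sign-z = far-left H e top (ceiling r i)
          ρ , _ , ρ<y , root = bracket i (antidiagonal H 0 e) z<y
            (sign-ceiling i (ℕₚ.≤-reflexive (≡.sym d≡)))
            (≡.subst (λ j → Pos (σ j * ev (poly H e) z)) e≡ sign-z)
      in ρ , ρ<y , (λ i<d → contradiction i<d (ℕₚ.<-irrefl (≡.sym d≡))) , root

    find : ∀ i → i ℕ.< e → ∃ (P i)
    find i i<e with ℕₚ.m≤n⇒m<n∨m≡n (ℕₚ.≤-pred (ℕₚ.≤-trans i<e e≤))
    ... | inj₁ i<d = inner i i<d
    ... | inj₂ i≡d = last i (ℕₚ.≤-antisym (ℕₚ.≤-trans e≤ (ℕₚ.≤-reflexive (≡.cong suc (≡.sym i≡d)))) i<e)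
                            (≡.sym i≡d)

    conclude : (∃ λ ρ → ∀ i → i ℕ.< e → P i (ρ i)) →
               ∃ λ ρ → Zeros (antidiagonal H 0 e) e ρ × Negative e ρ × Above e d ρ r
    conclude (ρ , spec) = ρ ,
      record { distinct = Above.decreasingˡ above e≤ ; root = λ i i<e → proj₂ (proj₂ (spec i i<e)) } ,
      ρ-neg , above
      where
      above : Above e d ρ r
      above = record
        { lower = λ i i<e → proj₁ (proj₂ (spec i i<e))
        ; upper = λ i 1+i<e → proj₁ (spec (suc i) 1+i<e)
        }
      ρ-neg : Negative e ρ
      ρ-neg zero    0<e   = proj₁ (spec 0 0<e)
      ρ-neg (suc i) 1+i<e = <-trans (proj₁ (spec (suc i) 1+i<e))
        (neg i (ℕₚ.≤-pred (ℕₚ.≤-trans 1+i<e e≤)))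

  Pos-neg : ∀ {x} → x < 0# → Pos (- x)
  Pos-neg = Pos-resp (+-identityˡ _)

  Pos-1- : ∀ {x} → x < 0# → Pos (1# - x)
  Pos-1- x<0 = Pos-+ Pos-1 (Pos⇒NonNeg (Pos-neg x<0))

  step-zeros : ∀ c G d r → 1 ℕ.≤ c → 1 ℕ.≤ G 0 d → 1 ℕ.≤ G d 0 →
    Zeros (antidiagonal G 0 d) d r → Negative d r →
    ∃ λ ρ → Zeros (antidiagonal (step c G) 0 (suc d)) (suc d) ρ × Negative (suc d) ρ × Above (suc d) d ρ r
  step-zeros c G d r 1≤c first top zeros neg = interlace (step c G) (suc d) d r ℕₚ.≤-refl
      (≡.subst (1 ℕ.≤_) (≡.sym (step-first c G d)) first)
      (≡.subst (1 ℕ.≤_) (≡.sym (step-last c G d)) top)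
      (Zeros.distinct zeros) neg sign
    where
    open Factored top zeros using (dv-sign)
    sign : ∀ i → i ℕ.< d → Pos (σ (suc i) * ev (poly (step c G) (suc d)) (r i))
    sign i i<d = Pos-resp (begin
        fromℕ c * ((- r i) * (1# - r i)) * (σ i * dv (poly G d) (r i))
          ≈⟨ solve 5 (λ c r s p′ y → c :* ((:- r) :* (con (+ 1) :- r)) :* (s :* p′)
               := :- s :* (c :* (r :* (con (+ 1) :- r)) :* p′ :+ y :* con (+ 0))) refl
               (fromℕ c) (r i) (σ i) (dv (poly G d) (r i)) (1# + (fromℕ c * fromℕ d + 1#) * r i) ⟩
        - σ i * (fromℕ c * (r i * (1# - r i)) * dv (poly G d) (r i)
                 + (1# + (fromℕ c * fromℕ d + 1#) * r i) * 0#)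
          ≈⟨ *-congˡ (+-congˡ (*-congˡ (Zeros.root zeros i i<d))) ⟨
        - σ i * (fromℕ c * (r i * (1# - r i)) * dv (poly G d) (r i)
                 + (1# + (fromℕ c * fromℕ d + 1#) * r i) * ev (poly G d) (r i))
          ≈⟨ *-congˡ (step-ev c G d (r i)) ⟨
        - σ i * ev (poly (step c G) (suc d)) (r i) ∎)
      (Pos-* (Pos-* (fromℕ-Pos 1≤c) (Pos-* (Pos-neg (neg i i<d)) (Pos-1- (neg i i<d))))
        (dv-sign i i<d))

  typeB-zeros : ∀ n → ∃ λ r → Zeros (antidiagonal (typeB n) 0 n) n r × Negative n r
  typeB-zeros zero    = (λ _ → 0#) , record { distinct = λ i () ; root = λ i () } , λ i ()
  typeB-zeros (suc n) =
    let r , zeros , neg = typeB-zeros n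
        ρ , zeros′ , neg′ , _ = step-zeros 2 (typeB n) n r (s≤s z≤n)
          (ℕₚ.≤-reflexive (≡.sym (typeB-first n))) (typeB-last n) zeros neg
    in ρ , zeros′ , neg′

  ev-descent : ∀ n k d x → ev (poly (descent n k) (suc d)) x
                           ≈ ev (poly (partA n k) (suc d)) x + x * ev (poly (partB n k) d) x
  ev-descent n k d x = ev-⊞-shiftʳ (partA n k) (partB n k) d x

  ev-reversed : ∀ n k d x → ev (poly (reversed n k) (suc d)) x
                            ≈ ev (poly (partA n k) (suc d)) x + ev (poly (partB n k) d) x
  ev-reversed n k d x = trans
    (reflexive (≡.cong (λ f → ev ⟪ f ⟫ x) (antidiagonal-cong (descent-reversed n k) 0 (suc d))))
    (ev-⊞-shiftˡ (partA n k) (partB n k) 0 d x)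

  -- The induction invariant. The interlacing of p and q = ℐ p is recorded as the signs of q at the
  -- zeros of p, the form that the Wronskian lemmas take as hypothesis.
  record DescentZeros (n k : ℕ) (r : ℕ → Carrier) : Set where
    field
      zeros       : Zeros (antidiagonal (descent (suc n) k) 0 (suc (k ℕ.+ n))) (suc (k ℕ.+ n)) r
      negative    : Negative (suc (k ℕ.+ n)) r
      alternating : ∀ i → i ℕ.< suc (k ℕ.+ n) →
                    Pos (σ i * ev (poly (reversed (suc n) k) (suc (k ℕ.+ n))) (r i))

  module _ (n : ℕ) where

    -- With B of type B and B₁ = (1 - x) B′ + (n + 1) B one has p = B + x B₁ and q = B + B₁. At
    -- zeros of B, p equals x (1 - x) B′, which locates the zeros of p; at a zero ρ of p, (1 - ρ) B
    -- = - ρ q, so q has the sign of B there.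
    base-zeros : ∃ (DescentZeros n 0)
    base-zeros = from-typeB (typeB-zeros (suc n))
      where
      from-typeB : (∃ λ r → Zeros (antidiagonal (typeB (suc n)) 0 (suc n)) (suc n) r × Negative (suc n) r) →
                   ∃ (DescentZeros n 0)
      from-typeB (r , zeros , neg) = result (interlace (descent (suc n) 0) (suc n) (suc n) r (ℕₚ.n≤1+n _)
          (ℕₚ.≤-reflexive (≡.sym (descent-first (suc n) 0))) (descent-last (suc n) 0)
          (Zeros.distinct zeros) neg sign)
        where
        B B₁ : Carrier → Carrier
        B  = ev (poly (typeB (suc n)) (suc n))
        B₁ = ev (poly (mixed (typeB (suc n))) n)
        open Factored (typeB-last (suc n)) zeros using (dv-sign; ev-sign)
        sign : ∀ i → i ℕ.< suc n → Pos (σ (suc i) * ev (poly (descent (suc n) 0) (suc n)) (r i))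
        sign i i<d = Pos-resp (begin
            (- r i) * (1# - r i) * (σ i * B′)
              ≈⟨ solve 4 (λ r s p′ y → (:- r) :* (con (+ 1) :- r) :* (s :* p′)
                   := :- s :* (con (+ 0) :+ r :* ((con (+ 1) :- r) :* p′ :+ y :* con (+ 0)))) refl
                   (r i) (σ i) B′ (1# + fromℕ n) ⟩
            - σ i * (0# + r i * ((1# - r i) * B′ + (1# + fromℕ n) * 0#))
              ≈⟨ *-congˡ (+-cong (Zeros.root zeros i i<d) (*-congˡ (+-congˡ (*-congˡ (Zeros.root zeros i i<d))))) ⟨
            - σ i * (B (r i) + r i * ((1# - r i) * B′ + (1# + fromℕ n) * B (r i)))
              ≈⟨ *-congˡ (+-congˡ (*-congˡ (mixed-ev (typeB (suc n)) n (r i)))) ⟨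
            - σ i * (B (r i) + r i * B₁ (r i))
              ≈⟨ *-congˡ (ev-descent (suc n) 0 n (r i)) ⟨
            - σ i * ev (poly (descent (suc n) 0) (suc n)) (r i) ∎)
          (Pos-* (Pos-* (Pos-neg (neg i i<d)) (Pos-1- (neg i i<d))) (dv-sign i i<d))
          where
          B′ : Carrier
          B′ = dv (poly (typeB (suc n)) (suc n)) (r i)
        result : (∃ λ ρ → Zeros (antidiagonal (descent (suc n) 0) 0 (suc n)) (suc n) ρ
                   × Negative (suc n) ρ × Above (suc n) (suc n) ρ r) → ∃ (DescentZeros n 0)
        result (ρ , zeros′ , neg′ , above) = ρ , record
          { zeros = zeros′
          ; negative = neg′
          ; alternating = λ i i<d → Pos-cancel (Pos-neg (neg′ i i<d)) (Pos-resp (begin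
              (1# - ρ i) * (σ i * B (ρ i))
                ≈⟨ solve 4 (λ r s b b₁ → (con (+ 1) :- r) :* (s :* b)
                     := (:- r) :* (s :* (b :+ b₁)) :+ s :* (b :+ r :* b₁)) refl (ρ i) (σ i) (B (ρ i)) (B₁ (ρ i)) ⟩
              (- ρ i) * (σ i * (B (ρ i) + B₁ (ρ i))) + σ i * (B (ρ i) + ρ i * B₁ (ρ i))
                ≈⟨ +-cong (*-congˡ (*-congˡ (ev-reversed (suc n) 0 n (ρ i)))) (*-congˡ (ev-descent (suc n) 0 n (ρ i))) ⟨
              (- ρ i) * (σ i * ev (poly (reversed (suc n) 0) (suc n)) (ρ i))
                + σ i * ev (poly (descent (suc n) 0) (suc n)) (ρ i)
                ≈⟨ +-congˡ (*-congˡ (Zeros.root zeros′ i i<d)) ⟩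
              (- ρ i) * (σ i * ev (poly (reversed (suc n) 0) (suc n)) (ρ i)) + σ i * 0#
                ≈⟨ solve 2 (λ x s → x :+ s :* con (+ 0) := x) refl _ (σ i) ⟩
              (- ρ i) * (σ i * ev (poly (reversed (suc n) 0) (suc n)) (ρ i)) ∎)
            (Pos-* (Pos-1- (neg′ i i<d)) (ev-sign i (ρ i) (ℕₚ.<⇒≤ i<d)
              (Above.above-pred above i i<d) (Above.lower above i i<d))))
          }

    -- For p with zeros r and q = ℐ p, at a zero ρ of T p
    -- p T q = p T q - q T p = - x (1 - x) (q p′ - q′ p), T being the step.
    step-DescentZeros : ∀ k → ∃ (DescentZeros n k) → ∃ (DescentZeros n (suc k))
    step-DescentZeros k (r , hyp) = result (step-zeros 1 P d r (s≤s z≤n)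
        (descent-first′ n k) (descent-last′ n k) zeros negative)
      where
      open DescentZeros hyp
      d : ℕ
      d = suc (k ℕ.+ n)
      P Q : Grid
      P = descent (suc n) k
      Q = reversed (suc n) k
      open Factored (descent-last′ n k) zeros using (c; c-Pos; ev-sign; sign-between; ev-factored; dv-factored)
      result : (∃ λ ρ → Zeros (antidiagonal (step 1 P) 0 (suc d)) (suc d) ρ
                 × Negative (suc d) ρ × Above (suc d) d ρ r) → ∃ (DescentZeros n (suc k))
      result (ρ , zeros′ , neg′ , above) = ρ , record
        { zeros = ≡.subst (λ f → Zeros f (suc d) ρ)
            (≡.sym (antidiagonal-cong (descent-step (suc n) k) 0 (suc d))) zeros′
        ; negative = neg′
        ; alternating = λ i i<d → Pos-resp
            (*-congˡ (reflexive (≡.cong (λ f → ev ⟪ f ⟫ (ρ i))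
              (≡.sym (antidiagonal-cong (reversed-step (suc n) k) 0 (suc d))))))
            (same-sign i
              (ev-sign i (ρ i) (ℕₚ.≤-pred i<d) (Above.above-pred above i i<d) (Above.lower above i i<d))
              (product-sign i i<d))
        }
        where
        -- T acts on p and q in the same degree, so the terms y p q cancel. The rest is strictly
        -- positive: ρ < 0, and the known sign of p(ρ) makes `wronskian-Pos` applicable.
        product-sign : ∀ i → i ℕ.< suc d → Pos (ev (poly P d) (ρ i) * ev (poly (step 1 Q) (suc d)) (ρ i))
        product-sign i i<d = Pos-resp (begin
          fromℕ 1 * ((- x) * (1# - x)) * (c * wronskian (poly Q d) (∏ r d) x)
            ≈⟨ solve 8 (λ l x c q q′ π π′ y →
                 l :* ((:- x) :* (con (+ 1) :- x)) :* (c :* (q :* π′ :- q′ :* π))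
                 := (c :* π) :* (l :* (x :* (con (+ 1) :- x)) :* q′ :+ y :* q)
                    :- q :* (l :* (x :* (con (+ 1) :- x)) :* (c :* π′) :+ y :* (c :* π))) refl
                 (fromℕ 1) x c q q′ (ev (∏ r d) x) (dv (∏ r d) x) y ⟩
          (c * ev (∏ r d) x) * (fromℕ 1 * (x * (1# - x)) * q′ + y * q)
            - q * (fromℕ 1 * (x * (1# - x)) * (c * dv (∏ r d) x) + y * (c * ev (∏ r d) x))
            ≈⟨ +-cong (*-congʳ (ev-factored x))
                 (-‿cong (*-congˡ (+-cong (*-congˡ (dv-factored x)) (*-congˡ (ev-factored x))))) ⟨
          ev (poly P d) x * (fromℕ 1 * (x * (1# - x)) * q′ + y * q)
            - q * (fromℕ 1 * (x * (1# - x)) * dv (poly P d) x + y * ev (poly P d) x)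
            ≈⟨ +-cong (*-congˡ (step-ev 1 Q d x)) (-‿cong (*-congˡ (step-ev 1 P d x))) ⟨
          ev (poly P d) x * ev (poly (step 1 Q) (suc d)) x - q * ev (poly (step 1 P) (suc d)) x
            ≈⟨ +-congˡ (-‿cong (*-congˡ (Zeros.root zeros′ i i<d))) ⟩
          ev (poly P d) x * ev (poly (step 1 Q) (suc d)) x - q * 0#
            ≈⟨ solve 2 (λ z q → z :- q :* con (+ 0) := z) refl _ q ⟩
          ev (poly P d) x * ev (poly (step 1 Q) (suc d)) x ∎)
          (Pos-* (Pos-* (fromℕ-Pos (s≤s z≤n)) (Pos-* (Pos-neg (neg′ i i<d)) (Pos-1- (neg′ i i<d))))
            (Pos-* c-Pos (wronskian-Pos (k ℕ.+ n) r (poly Q d)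
              (ℕₚ.≤-reflexive (length-poly Q d)) (Zeros.distinct zeros) alternating i x
              (sign-between i x (ℕₚ.≤-pred i<d) (Above.above-pred above i i<d) (Above.lower above i i<d)))))
          where
          x q q′ y : Carrier
          x = ρ i
          q = ev (poly Q d) x
          q′ = dv (poly Q d) x
          y = 1# + (fromℕ 1 * fromℕ d + 1#) * x

    descent-zeros : ∀ k → ∃ (DescentZeros n k)
    descent-zeros zero    = base-zeros
    descent-zeros (suc k) = step-DescentZeros k (descent-zeros k)

-- Zeros of the reversal and of the two components

module Decomposition (R : OrderedRing) where
  open Grids
  open GridPolynomials
  open OrderedRing R
  open RingSolver R
  open Polynomials R
  open Signs R
  open GridEvaluation R
  open RootFinding R
  open DescentInduction R
  open import Relation.Binary.Reasoning.Setoid setoid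

  -- x 0 > y 0 > x 1 > y 1 > …
  record Interlaced (d e : ℕ) (x y : ℕ → Carrier) : Set where
    field
      descend : ∀ i → i ℕ.< e → y i < x i
      rise    : ∀ i → i ℕ.< e → suc i ℕ.< d → x (suc i) < y i

  module _ (n k : ℕ) (r : ℕ → Carrier) (hyp : DescentZeros n k r) where
    open DescentZeros hyp

    d : ℕ
    d = suc (k ℕ.+ n)

    p q a b : Carrier → Carrier
    p = ev (poly (descent (suc n) k) d)
    q = ev (poly (reversed (suc n) k) d)
    a = ev (poly (partA (suc n) k) d)
    b = ev (poly (partB (suc n) k) (k ℕ.+ n))

    p-split : ∀ x → p x ≈ a x + x * b x
    p-split = ev-descent (suc n) k (k ℕ.+ n)

    q-split : ∀ x → q x ≈ a x + b x
    q-split = ev-reversed (suc n) k (k ℕ.+ n)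

    a-from-pq : ∀ x → (1# - x) * a x ≈ p x - x * q x
    a-from-pq x = trans
      (solve 3 (λ x a b → (con (+ 1) :- x) :* a := a :+ x :* b :- x :* (a :+ b)) refl x (a x) (b x))
      (sym (+-cong (p-split x) (-‿cong (*-congˡ (q-split x)))))

    b-from-pq : ∀ x → (1# - x) * b x ≈ q x - p x
    b-from-pq x = trans
      (solve 3 (λ x a b → (con (+ 1) :- x) :* b := a :+ b :- (a :+ x :* b)) refl x (a x) (b x))
      (sym (+-cong (q-split x) (-‿cong (p-split x))))

    QZero : ℕ → Carrier → Set
    QZero i s = s < r i × (suc i ℕ.< d → r (suc i) < s) × q s ≈ 0#

    -- The alternation of q gives one zero in each gap between zeros of p. The last one lies to the
    -- left of them all, where the leading coefficient p(0) > 0 of q decides the sign.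
    reversed-zero : ∀ i → i ℕ.< d → ∃ (QZero i)
    reversed-zero i i<d with ℕₚ.m≤n⇒m<n∨m≡n i<d
    ... | inj₁ 1+i<d =
      let s , r<s , s<r , root = bracket i (antidiagonal (reversed (suc n) k) 0 d)
            (Zeros.distinct zeros i 1+i<d) (alternating i i<d) (alternating (suc i) 1+i<d)
      in s , s<r , (λ _ → r<s) , root
    ... | inj₂ 1+i≡d =
      let z , z<r , sign-z = far-left (reversed (suc n) k) d (descent-first′ n k) (r i)
          s , _ , s<r , root = bracket i (antidiagonal (reversed (suc n) k) 0 d) z<r (alternating i i<d)
            (≡.subst (λ j → Pos (σ j * q z)) (≡.sym 1+i≡d) sign-z)
      in s , s<r , (λ 1+i<d → contradiction 1+i<d (ℕₚ.<-irrefl 1+i≡d)) , root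

    module _ (s : ℕ → Carrier) (s-spec : ∀ i → i ℕ.< d → QZero i (s i)) where

      s-neg : ∀ i → i ℕ.< d → s i < 0#
      s-neg i i<d = <-trans (proj₁ (s-spec i i<d)) (negative i i<d)

      rs : Interlaced d d r s
      rs = record
        { descend = λ i i<d → proj₁ (s-spec i i<d)
        ; rise    = λ i i<d → proj₁ (proj₂ (s-spec i i<d))
        }

      s-zeros : Zeros (antidiagonal (reversed (suc n) k) 0 d) d s
      s-zeros = record
        { distinct = λ i 1+i<d → <-trans (proj₁ (s-spec (suc i) 1+i<d))
            (proj₁ (proj₂ (s-spec i (ℕₚ.<⇒≤ 1+i<d))) 1+i<d)
        ; root = λ i i<d → proj₂ (proj₂ (s-spec i i<d))
        }

      p-sign : ∀ i → i ℕ.< d → Pos (σ (suc i) * p (s i))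
      p-sign i i<d = Factored.ev-sign (descent-last′ n k) zeros (suc i) (s i) i<d
        (λ { .i ≡.refl → proj₁ (s-spec i i<d) }) (proj₁ (proj₂ (s-spec i i<d)))

      a-sign-r : ∀ i → i ℕ.< d → Pos (σ i * a (r i))
      a-sign-r i i<d = Pos-cancel (Pos-1- (negative i i<d)) (Pos-resp (begin
        (- r i) * (σ i * q (r i))
          ≈⟨ solve 3 (λ r s q → (:- r) :* (s :* q) := s :* (con (+ 0) :- r :* q)) refl (r i) (σ i) (q (r i)) ⟩
        σ i * (0# - r i * q (r i))
          ≈⟨ *-congˡ (+-congʳ (Zeros.root zeros i i<d)) ⟨
        σ i * (p (r i) - r i * q (r i))
          ≈⟨ *-congˡ (a-from-pq (r i)) ⟨
        σ i * ((1# - r i) * a (r i))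
          ≈⟨ solve 3 (λ y s q → s :* (y :* q) := y :* (s :* q)) refl (1# - r i) (σ i) (a (r i)) ⟩
        (1# - r i) * (σ i * a (r i)) ∎)
        (Pos-* (Pos-neg (negative i i<d)) (alternating i i<d)))

      b-sign-r : ∀ i → i ℕ.< d → Pos (σ i * b (r i))
      b-sign-r i i<d = Pos-cancel (Pos-1- (negative i i<d)) (Pos-resp (begin
        σ i * q (r i)
          ≈⟨ solve 2 (λ s q → s :* q := s :* (q :- con (+ 0))) refl (σ i) (q (r i)) ⟩
        σ i * (q (r i) - 0#)
          ≈⟨ *-congˡ (+-congˡ (-‿cong (Zeros.root zeros i i<d))) ⟨
        σ i * (q (r i) - p (r i))
          ≈⟨ *-congˡ (b-from-pq (r i)) ⟨
        σ i * ((1# - r i) * b (r i))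
          ≈⟨ solve 3 (λ y s q → s :* (y :* q) := y :* (s :* q)) refl (1# - r i) (σ i) (b (r i)) ⟩
        (1# - r i) * (σ i * b (r i)) ∎)
        (alternating i i<d))

      a-sign-s : ∀ i → i ℕ.< d → Pos (σ (suc i) * a (s i))
      a-sign-s i i<d = Pos-cancel (Pos-1- (s-neg i i<d)) (Pos-resp (begin
        σ (suc i) * p (s i)
          ≈⟨ solve 3 (λ s p x → s :* p := s :* (p :- x :* con (+ 0))) refl (σ (suc i)) (p (s i)) (s i) ⟩
        σ (suc i) * (p (s i) - s i * 0#)
          ≈⟨ *-congˡ (+-congˡ (-‿cong (*-congˡ (Zeros.root s-zeros i i<d)))) ⟨
        σ (suc i) * (p (s i) - s i * q (s i))
          ≈⟨ *-congˡ (a-from-pq (s i)) ⟨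
        σ (suc i) * ((1# - s i) * a (s i))
          ≈⟨ solve 3 (λ y s q → s :* (y :* q) := y :* (s :* q)) refl (1# - s i) (σ (suc i)) (a (s i)) ⟩
        (1# - s i) * (σ (suc i) * a (s i)) ∎)
        (p-sign i i<d))

      b-sign-s : ∀ i → i ℕ.< d → Pos (σ i * b (s i))
      b-sign-s i i<d = Pos-cancel (Pos-1- (s-neg i i<d)) (Pos-resp (begin
        - σ i * p (s i)
          ≈⟨ solve 2 (λ s p → :- s :* p := s :* (con (+ 0) :- p)) refl (σ i) (p (s i)) ⟩
        σ i * (0# - p (s i))
          ≈⟨ *-congˡ (+-congʳ (Zeros.root s-zeros i i<d)) ⟨
        σ i * (q (s i) - p (s i))
          ≈⟨ *-congˡ (b-from-pq (s i)) ⟨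
        σ i * ((1# - s i) * b (s i))
          ≈⟨ solve 3 (λ y s q → s :* (y :* q) := y :* (s :* q)) refl (1# - s i) (σ i) (b (s i)) ⟩
        (1# - s i) * (σ i * b (s i)) ∎)
        (p-sign i i<d))

      -- a changes sign between s i and r i, and b between r (i + 1) and s i. These intervals
      -- alternate along the line, so locating the zeros in them already interlaces α and β.
      AZero BZero : ℕ → Carrier → Set
      AZero i α = s i < α × α < r i × a α ≈ 0#
      BZero i β = r (suc i) < β × β < s i × b β ≈ 0#

      a-zero : ∀ i → i ℕ.< d → ∃ (AZero i)
      a-zero i i<d = bracket i (antidiagonal (partA (suc n) k) 0 d)
        (proj₁ (s-spec i i<d)) (a-sign-r i i<d) (a-sign-s i i<d)

      b-zero : ∀ i → i ℕ.< k ℕ.+ n → ∃ (BZero i)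
      b-zero i i<d = bracket i (antidiagonal (partB (suc n) k) 0 (k ℕ.+ n))
        (proj₁ (proj₂ (s-spec i (ℕₚ.m≤n⇒m≤1+n i<d))) (s≤s i<d))
        (b-sign-s i (ℕₚ.m≤n⇒m≤1+n i<d)) (b-sign-r (suc i) (s≤s i<d))

      ABZeros : Set
      ABZeros = ∃ λ α → ∃ λ β →
        Zeros (antidiagonal (partA (suc n) k) 0 d) d α ×
        Zeros (antidiagonal (partB (suc n) k) 0 (k ℕ.+ n)) (k ℕ.+ n) β ×
        Interlaced d (k ℕ.+ n) α β

      ab-zeros : (∃ λ α → ∀ i → i ℕ.< d → AZero i (α i)) →
                 (∃ λ β → ∀ i → i ℕ.< k ℕ.+ n → BZero i (β i)) → ABZeros
      ab-zeros (α , α-spec) (β , β-spec) = α , β ,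
        record
          { distinct = λ i 1+i<d → <-trans (proj₁ (proj₂ (α-spec (suc i) 1+i<d)))
              (<-trans (proj₁ (proj₂ (s-spec i (ℕₚ.<⇒≤ 1+i<d))) 1+i<d)
                       (proj₁ (α-spec i (ℕₚ.<⇒≤ 1+i<d))))
          ; root = λ i i<d → proj₂ (proj₂ (α-spec i i<d))
          } ,
        record
          { distinct = λ i 1+i<d → <-trans (proj₁ (proj₂ (β-spec (suc i) 1+i<d)))
              (<-trans (proj₁ (s-spec (suc i) (ℕₚ.m≤n⇒m≤1+n 1+i<d)))
                       (proj₁ (β-spec i (ℕₚ.<⇒≤ 1+i<d))))
          ; root = λ i i<d → proj₂ (proj₂ (β-spec i i<d))
          } ,
        record
          { descend = λ i i<d → <-trans (proj₁ (proj₂ (β-spec i i<d)))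
              (proj₁ (α-spec i (ℕₚ.m≤n⇒m≤1+n i<d)))
          ; rise = λ i i<d 1+i<d → <-trans (proj₁ (proj₂ (α-spec (suc i) 1+i<d)))
              (proj₁ (β-spec i i<d))
          }

  record InterlacedZeros (n k : ℕ) : Set where
    field
      {r s α β} : ℕ → Carrier
      zeros-p : Zeros (antidiagonal (descent (suc n) k) 0 (suc (k ℕ.+ n))) (suc (k ℕ.+ n)) r
      zeros-q : Zeros (antidiagonal (reversed (suc n) k) 0 (suc (k ℕ.+ n))) (suc (k ℕ.+ n)) s
      zeros-a : Zeros (antidiagonal (partA (suc n) k) 0 (suc (k ℕ.+ n))) (suc (k ℕ.+ n)) α
      zeros-b : Zeros (antidiagonal (partB (suc n) k) 0 (k ℕ.+ n)) (k ℕ.+ n) β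
      order-pq : Interlaced (suc (k ℕ.+ n)) (suc (k ℕ.+ n)) r s
      order-ab : Interlaced (suc (k ℕ.+ n)) (k ℕ.+ n) α β

  interlaced-zeros : ∀ n k → InterlacedZeros n k
  interlaced-zeros n k = from-r (descent-zeros n k)
    where
    from-r : ∃ (DescentZeros n k) → InterlacedZeros n k
    from-r (r , hyp) = from-s (choose (QZero n k r hyp) (suc (k ℕ.+ n)) 0# (reversed-zero n k r hyp))
      where
      from-s : (∃ λ s → ∀ i → i ℕ.< suc (k ℕ.+ n) → QZero n k r hyp i (s i)) → InterlacedZeros n k
      from-s (s , s-spec) = from-αβ (ab-zeros n k r hyp s s-spec
          (choose (AZero n k r hyp s s-spec) (suc (k ℕ.+ n)) 0# (a-zero n k r hyp s s-spec))
          (choose (BZero n k r hyp s s-spec) (k ℕ.+ n) 0# (b-zero n k r hyp s s-spec)))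
        where
        from-αβ : ABZeros n k r hyp s s-spec → InterlacedZeros n k
        from-αβ (α , β , α-zeros , β-zeros , αβ) = record
          { zeros-p = DescentZeros.zeros hyp
          ; zeros-q = s-zeros n k r hyp s s-spec
          ; zeros-a = α-zeros
          ; zeros-b = β-zeros
          ; order-pq = rs n k r hyp s s-spec
          ; order-ab = αβ
          }

-- Uniqueness of the decomposition

module Uniqueness (R : OrderedRing) where
  open Grids
  open OrderedRing R
  open RingSolver R
  open GridEvaluation R
  open import Relation.Binary.Reasoning.Setoid setoid

  cancelʳ : ∀ {x y z w} → x + y ≈ z + w → y ≈ w → x ≈ z
  cancelʳ {x} {y} {z} {w} eq y≈w = begin
    x          ≈⟨ solve 2 (λ x y → x := x :+ y :- y) refl x y ⟩
    x + y - y  ≈⟨ +-cong eq (-‿cong y≈w) ⟩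
    z + w - w  ≈⟨ solve 2 (λ z w → z :+ w :- w := z) refl z w ⟩
    z          ∎

  cancelˡ : ∀ {x y z w} → x + y ≈ z + w → x ≈ z → y ≈ w
  cancelˡ {x} {y} {z} {w} eq = cancelʳ (trans (+-comm y x) (trans eq (+-comm z w)))

  module _ (n k d : ℕ) (p a b : ℕ → Carrier)
      (p-zero : p 0 ≈ a 0) (p-suc : ∀ j → p (suc j) ≈ a (suc j) + b j)
      (a-sym : ∀ j l → j ℕ.+ l ≡ suc d → a l ≈ a j)
      (b-sym : ∀ j l → j ℕ.+ l ≡ d → b l ≈ b j)
      (p-descent : ∀ j l → j ℕ.+ l ≡ suc d → p j ≈ fromℕ (descent n k j l)) where

    -- Coefficients are determined from the outside inwards, in degree D = d + 1: p_j = a_j +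
    -- b_{j-1} yields a_j from b_{j-1}, and by symmetry p_{D-j} = a_j + b_j then yields b_j from
    -- a_j.
    a-unique : ∀ j l → j ℕ.+ l ≡ suc d → a j ≈ fromℕ (partA n k j l)
    b-unique : ∀ j l → j ℕ.+ l ≡ d → b j ≈ fromℕ (partB n k j l)
    a-unique zero    l j+l = trans (sym p-zero) (trans (p-descent 0 l j+l)
      (reflexive (≡.cong fromℕ (ℕₚ.+-identityʳ (partA n k 0 l)))))
    a-unique (suc j) l j+l = cancelʳ
      (trans (sym (p-suc j)) (trans (p-descent (suc j) l j+l) (fromℕ-+ (partA n k (suc j) l) _)))
      (b-unique j l (ℕₚ.suc-injective j+l))
    b-unique j l j+l = cancelˡ
      (begin
        a j + b j
          ≈⟨ +-cong (a-sym j (suc l) j+1+l) (b-sym j l j+l) ⟨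
        a (suc l) + b l
          ≈⟨ p-suc l ⟨
        p (suc l)
          ≈⟨ p-descent (suc l) j (≡.trans (ℕₚ.+-comm (suc l) j) j+1+l) ⟩
        fromℕ (descent n k (suc l) j)
          ≈⟨ fromℕ-+ (partA n k (suc l) j) _ ⟩
        fromℕ (partA n k (suc l) j) + fromℕ (partB n k l j)
          ≈⟨ +-cong (reflexive (≡.cong fromℕ (partA-symmetric n k (suc l) j)))
                    (reflexive (≡.cong fromℕ (partB-symmetric n k l j))) ⟩
        fromℕ (partA n k j (suc l)) + fromℕ (partB n k j l) ∎)
      (a-unique j (suc l) j+1+l)
      where
      j+1+l : j ℕ.+ suc l ≡ suc d
      j+1+l = ≡.trans (ℕₚ.+-suc j l) (≡.cong suc j+l)

-- Transfer from grids to arbitrary coefficient functions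

module Representation (R : OrderedRing) where
  open Grids
  open GridPolynomials
  open OrderedRing R
  open RingSolver R
  open Polynomials R
  open GridEvaluation R
  open RootFinding R

  -- About a coefficient function rather than a list, since a polynomial of the statement may carry
  -- trailing zeros and is fixed only up to equality of reals.
  record Represents (x : ℕ → Carrier) (G : Grid) (d : ℕ) : Set where
    field
      within : ∀ j l → j ℕ.+ l ≡ d → x j ≈ fromℕ (G j l)
      beyond : ∀ j → d ℕ.< j → x j ≈ 0#

  -- C r d j stands for the coefficient of x ^ j in ∏ (x - r i), i < d, however
  -- products of coefficient lists are implemented.
  record IsProduct (C : (ℕ → Carrier) → ℕ → ℕ → Carrier) : Set where
    field
      none      : ∀ r j → C r 0 j ≈ coeff (1# ∷ []) j
      more-zero : ∀ r d → C r (suc d) 0 ≈ - r 0 * C (r ∘ suc) d 0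
      more-suc  : ∀ r d j → C r (suc d) (suc j) ≈ - r 0 * C (r ∘ suc) d (suc j) + C (r ∘ suc) d j

    coeff-product : ∀ r d j → C r d j ≈ coeff (∏ r d) j
    coeff-product r zero    j       = none r j
    coeff-product r (suc d) zero    = trans (more-zero r d) (trans (*-congˡ (coeff-product (r ∘ suc) d 0))
      (trans (solve 2 (λ r c → :- r :* c := con (+ 0) :- r :* c) refl (r 0) _)
        (sym (coeff-linear-0 (r 0) 0# (∏ (r ∘ suc) d)))))
    coeff-product r (suc d) (suc j) = trans (more-suc r d j)
      (trans (+-cong (*-congˡ (coeff-product (r ∘ suc) d (suc j))) (coeff-product (r ∘ suc) d j))
      (trans (solve 3 (λ r c c′ → :- r :* c :+ c′ := c′ :- r :* c) refl (r 0) _ _)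
        (sym (coeff-linear-suc (r 0) 0# (∏ (r ∘ suc) d) j))))

  module _ {x G d} (rep : Represents x G d) where
    open Represents rep

    coeff-poly : ∀ j → x j ≈ coeff (poly G d) j
    coeff-poly j with j ℕ.≤? d
    ... | yes j≤d = trans (within j (d ∸ j) (ℕₚ.m+[n∸m]≡n j≤d)) (sym (reflexive (coeff-grid G 0 d j j≤d)))
    ... | no j≰d  = trans (beyond j (ℕₚ.≰⇒> j≰d)) (sym (coeff-beyond (poly G d)
      (≡.subst (ℕ._≤ j) (≡.sym (length-poly G d)) (ℕₚ.≰⇒> j≰d))))

    factored-coefficients : ∀ {C} → IsProduct C → 1 ℕ.≤ G d 0 → ∀ {r} → Zeros (antidiagonal G 0 d) d r →
      ∃ λ c → Pos c × ∀ j → x j ≈ c * C r d j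
    factored-coefficients product top {r} zeros = F.c , F.c-Pos , λ j →
      trans (coeff-poly j) (trans (F.factored j) (*-congˡ (sym (IsProduct.coeff-product product r d j))))
      where module F = Factored top zeros

    top-Pos : 1 ℕ.≤ G d 0 → Pos (x d)
    top-Pos top = Pos-resp (sym (within d 0 (ℕₚ.+-identityʳ d))) (fromℕ-Pos top)

    coefficient-mono : ∀ i j i′ j′ → i ℕ.+ i′ ≡ d → j ℕ.+ j′ ≡ d → G i i′ ℕ.≤ G j j′ → NonNeg (x j - x i)
    coefficient-mono i j i′ j′ i+ j+ G≤ = NonNeg-resp
      (+-cong (sym (within j j′ j+)) (-‿cong (sym (within i i′ i+)))) (fromℕ-mono G≤)

    first-NonNeg : NonNeg (x 0 - 0#)
    first-NonNeg = NonNeg-resp (trans (sym (within 0 d ≡.refl))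
      (solve 1 (λ x → x := x :- con (+ 0)) refl (x 0))) (fromℕ-NonNeg (G 0 d))

    private
      module Nat = Data.Nat.Solver.+-*-Solver
      module Index (i : ℕ) (2i+1≤d : 2 ℕ.* i ℕ.+ 1 ℕ.≤ d) where
        l : ℕ
        l = d ∸ suc i
        i+1+i≤d : i ℕ.+ suc i ℕ.≤ d
        i+1+i≤d = ℕₚ.≤-trans (ℕₚ.≤-reflexive (Nat.solve 1 (λ i → i Nat.:+ (Nat.con 1 Nat.:+ i)
          Nat.:= Nat.con 2 Nat.:* i Nat.:+ Nat.con 1) ≡.refl i)) 2i+1≤d
        i<d : i ℕ.< d
        i<d = ℕₚ.≤-trans (ℕₚ.m≤n+m (suc i) i) i+1+i≤d
        i+l : i ℕ.+ suc l ≡ d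
        i+l = ≡.trans (ℕₚ.+-suc i l) (ℕₚ.m+[n∸m]≡n i<d)
        d∸i : d ∸ i ≡ suc l
        d∸i = ≡.trans (≡.cong (_∸ i) (≡.sym i+l)) (ℕₚ.m+n∸m≡n i (suc l))
        i≤l : i ℕ.≤ l
        i≤l = ℕₚ.≤-pred (ℕₚ.+-cancelˡ-≤ i (suc i) (suc l) (ℕₚ.≤-trans i+1+i≤d (ℕₚ.≤-reflexive (≡.sym i+l))))
        d∸i+i : (d ∸ i) ℕ.+ i ≡ d
        d∸i+i = ℕₚ.m∸n+n≡m (ℕₚ.<⇒≤ i<d)

    outer-links : (∀ j l → j ℕ.≤ l → G j (suc l) ℕ.≤ G (suc l) j) →
      ∀ i → 2 ℕ.* i ℕ.+ 1 ℕ.≤ d → NonNeg (x (d ∸ i) - x i)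
    outer-links outer i h = coefficient-mono i (d ∸ i) (suc l) i i+l d∸i+i
      (≡.subst (λ t → G i (suc l) ℕ.≤ G t i) (≡.sym d∸i) (outer i l i≤l))
      where open Index i h

    inner-links : (∀ j l → j ℕ.≤ l → G (suc l) j ℕ.≤ G (suc j) l) →
      ∀ i → 2 ℕ.* i ℕ.+ 2 ℕ.≤ d → NonNeg (x (suc i) - x (d ∸ i))
    inner-links inner i 2i+2≤d = coefficient-mono (d ∸ i) (suc i) i l d∸i+i
      (≡.trans (≡.sym (ℕₚ.+-suc i l)) i+l)
      (≡.subst (λ t → G t i ℕ.≤ G (suc i) l) (≡.sym d∸i) (inner i l i≤l))
      where open Index i (ℕₚ.≤-trans (ℕₚ.+-monoʳ-≤ (2 ℕ.* i) (s≤s z≤n)) 2i+2≤d)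

  top-product-Pos : ∀ {x G d y H e} → Represents x G d → 1 ℕ.≤ G d 0 → Represents y H e → 1 ℕ.≤ H e 0 →
    Pos (x d * y e)
  top-product-Pos rep top rep′ top′ = Pos-* (top-Pos rep top) (top-Pos rep′ top′)

-- Rational inequalities and powers of one half

module RationalFacts where
  open import Data.Rational using (_+_; _*_; -_; _-_; _≤_; _<_; _/_)
  open Data.Rational.Solver.+-*-Solver using (solve; _:=_; _:+_; _:*_; _:-_; :-_; con)

  gap : ∀ {p q} → p ≤ q → 0ℚ ≤ q - p
  gap {p} {q} p≤q = ≡.subst (_≤ q - p) (ℚₚ.+-inverseʳ p) (ℚₚ.+-monoˡ-≤ (- p) p≤q)

  -- The pattern for linear estimates: q - p is written as a sum of nonnegative gaps, and the ring
  -- solver checks the identity.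
  from-gap : ∀ {p q s} → 0ℚ ≤ s → s ≡ q - p → p ≤ q
  from-gap {p} {q} 0≤s ≡.refl = ≡.subst₂ _≤_ (ℚₚ.+-identityˡ p)
    (solve 2 (λ p q → q :- p :+ p := q) ≡.refl p q) (ℚₚ.+-monoˡ-≤ p 0≤s)

  0≤+ : ∀ {p q} → 0ℚ ≤ p → 0ℚ ≤ q → 0ℚ ≤ p + q
  0≤+ 0≤p 0≤q = ℚₚ.+-mono-≤ 0≤p 0≤q

  0≤* : ∀ {p q} → 0ℚ ≤ p → 0ℚ ≤ q → 0ℚ ≤ p * q
  0≤* {p} {q} 0≤p 0≤q = ℚₚ.nonNegative⁻¹ (p * q)
    {{ℚₚ.nonNeg*nonNeg⇒nonNeg p {{ℚ.nonNegative 0≤p}} q {{ℚ.nonNegative 0≤q}}}}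

  0<* : ∀ {p q} → 0ℚ < p → 0ℚ < q → 0ℚ < p * q
  0<* {p} {q} 0<p 0<q = ℚₚ.positive⁻¹ (p * q)
    {{ℚₚ.pos*pos⇒pos p {{ℚ.positive 0<p}} q {{ℚ.positive 0<q}}}}

  0<½ : 0ℚ < ½
  0<½ = ℚₚ.positive⁻¹ ½

  0<1 : 0ℚ < 1ℚ
  0<1 = ℚₚ.positive⁻¹ 1ℚ

  half-pos : ∀ {ε} → 0ℚ < ε → 0ℚ < ½ * ε
  half-pos = 0<* 0<½

  half-sum : ∀ ε → ½ * ε + ½ * ε ≡ ε
  half-sum ε = solve 1 (λ e → con ½ :* e :+ con ½ :* e := e) ≡.refl ε

  *-mono : ∀ {a a′ b b′} → 0ℚ ≤ b → 0ℚ ≤ a′ → a ≤ a′ → b ≤ b′ → a * b ≤ a′ * b′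
  *-mono {a} {a′} {b} {b′} 0≤b 0≤a′ a≤ b≤ = ℚₚ.≤-trans
    (ℚₚ.*-monoʳ-≤-nonNeg b {{ℚ.nonNegative 0≤b}} a≤)
    (ℚₚ.*-monoˡ-≤-nonNeg a′ {{ℚ.nonNegative 0≤a′}} b≤)

  cancel-≤ : ∀ {c p q} → 0ℚ < c → p * c ≤ q * c → p ≤ q
  cancel-≤ {c} 0<c = ℚₚ.*-cancelʳ-≤-pos c {{ℚ.positive 0<c}}

  ≤∣∣ : ∀ p → p ≤ ∣ p ∣
  ≤∣∣ p with ℚₚ.≤-total 0ℚ p
  ... | inj₁ 0≤p = ℚₚ.≤-reflexive (≡.sym (ℚₚ.0≤p⇒∣p∣≡p 0≤p))
  ... | inj₂ p≤0 = ℚₚ.≤-trans p≤0 (ℚₚ.0≤∣p∣ p)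

  -≤∣∣ : ∀ p → - p ≤ ∣ p ∣
  -≤∣∣ p = ≡.subst (- p ≤_) (ℚₚ.∣-p∣≡∣p∣ p) (≤∣∣ (- p))

  ∣∣≤ : ∀ {p ε} → p ≤ ε → - p ≤ ε → ∣ p ∣ ≤ ε
  ∣∣≤ {p} p≤ -p≤ with ℚₚ.∣p∣≡p∨∣p∣≡-p p
  ... | inj₁ eq = ≡.subst (_≤ _) (≡.sym eq) p≤
  ... | inj₂ eq = ≡.subst (_≤ _) (≡.sym eq) -p≤

  ∣*∣≤ : ∀ {p q δ B} → ∣ p ∣ ≤ δ → ∣ q ∣ ≤ B → ∣ p * q ∣ ≤ δ * B
  ∣*∣≤ {p} {q} p≤ q≤ = ≡.subst (_≤ _) (≡.sym (ℚₚ.∣p*q∣≡∣p∣*∣q∣ p q))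
    (*-mono (ℚₚ.0≤∣p∣ q) (ℚₚ.≤-trans (ℚₚ.0≤∣p∣ p) p≤) p≤ q≤)

  divide : ∀ B ε → 0ℚ < B → 0ℚ < ε → ∃ λ δ → 0ℚ < δ × δ * B ≡ ε
  divide B ε 0<B 0<ε = ε * ℚ.1/ B ,
    0<* 0<ε (ℚₚ.positive⁻¹ (ℚ.1/ B) {{ℚₚ.1/pos⇒pos B {{B>0}}}}) ,
    ≡.trans (ℚₚ.*-assoc ε (ℚ.1/ B) B)
      (≡.trans (≡.cong (ε *_) (ℚₚ.*-inverseˡ B)) (ℚₚ.*-identityʳ ε))
    where
    B>0 : ℚ.Positive B
    B>0 = ℚ.positive 0<B
    instance
      B≢0 : ℚ.NonZero B
      B≢0 = ℚₚ.pos⇒nonZero B {{B>0}}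

  toℚᵘ-/1 : ∀ i → toℚᵘ (i / 1) ℚᵘ.≃ mkℚᵘ i 0
  toℚᵘ-/1 i = ℚₚ.toℚᵘ-fromℚᵘ (mkℚᵘ i 0)

  /1-+ : ∀ i j → (i ℤ.+ j) / 1 ≡ i / 1 + j / 1
  /1-+ i j = ℚₚ.toℚᵘ-injective (begin
    toℚᵘ ((i ℤ.+ j) / 1)             ≈⟨ toℚᵘ-/1 (i ℤ.+ j) ⟩
    mkℚᵘ (i ℤ.+ j) 0                 ≡⟨ ≡.cong (λ k → mkℚᵘ k 0) (≡.sym (≡.cong₂ ℤ._+_ (ℤₚ.*-identityʳ i) (ℤₚ.*-identityʳ j))) ⟩
    mkℚᵘ i 0 ℚᵘ.+ mkℚᵘ j 0           ≈⟨ ℚᵘₚ.+-cong (toℚᵘ-/1 i) (toℚᵘ-/1 j) ⟨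
    toℚᵘ (i / 1) ℚᵘ.+ toℚᵘ (j / 1)   ≈⟨ ℚₚ.toℚᵘ-homo-+ (i / 1) (j / 1) ⟨
    toℚᵘ (i / 1 + j / 1)             ∎)
    where open ℚᵘₚ.≃-Reasoning

  /1-* : ∀ i j → (i ℤ.* j) / 1 ≡ (i / 1) * (j / 1)
  /1-* i j = ℚₚ.toℚᵘ-injective (begin
    toℚᵘ ((i ℤ.* j) / 1)             ≈⟨ toℚᵘ-/1 (i ℤ.* j) ⟩
    mkℚᵘ i 0 ℚᵘ.* mkℚᵘ j 0           ≈⟨ ℚᵘₚ.*-cong (toℚᵘ-/1 i) (toℚᵘ-/1 j) ⟨
    toℚᵘ (i / 1) ℚᵘ.* toℚᵘ (j / 1)   ≈⟨ ℚₚ.toℚᵘ-homo-* (i / 1) (j / 1) ⟨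
    toℚᵘ ((i / 1) * (j / 1))         ∎)
    where open ℚᵘₚ.≃-Reasoning

  /1-neg : ∀ i → (ℤ.- i) / 1 ≡ - (i / 1)
  /1-neg i = ℚₚ.toℚᵘ-injective (begin
    toℚᵘ ((ℤ.- i) / 1)     ≈⟨ toℚᵘ-/1 (ℤ.- i) ⟩
    ℚᵘ.- mkℚᵘ i 0          ≈⟨ ℚᵘₚ.-‿cong (toℚᵘ-/1 i) ⟨
    ℚᵘ.- toℚᵘ (i / 1)      ≈⟨ ℚₚ.toℚᵘ-homo‿- (i / 1) ⟨
    toℚᵘ (- (i / 1))       ∎)
    where open ℚᵘₚ.≃-Reasoning

  -- The absolute value of the numerator is a bound, since the denominator is at least 1.
  ≤-natural : ∀ q → ∃ λ n → q ≤ + n / 1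
  ≤-natural q = ℤ.∣ ℚ.↥ q ∣ , ℚₚ.toℚᵘ-cancel-≤
    (ℚᵘₚ.≤-respʳ-≃ (ℚᵘₚ.≃-sym (toℚᵘ-/1 (+ ℤ.∣ ℚ.↥ q ∣))) (ℚᵘ.*≤* (begin
      ℚᵘ.↥ toℚᵘ q ℤ.* + 1                  ≡⟨ ℤₚ.*-identityʳ _ ⟩
      ℚᵘ.↥ toℚᵘ q                          ≡⟨ ℚₚ.↥ᵘ-toℚᵘ q ⟩
      ℚ.↥ q                                ≤⟨ i≤∣i∣ (ℚ.↥ q) ⟩
      + ℤ.∣ ℚ.↥ q ∣                        ≤⟨ ℤ.+≤+ (ℕₚ.m≤m*n ℤ.∣ ℚ.↥ q ∣ (ℚᵘ.↧ₙ toℚᵘ q)) ⟩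
      + (ℤ.∣ ℚ.↥ q ∣ ℕ.* ℚᵘ.↧ₙ toℚᵘ q)     ≡⟨ ℤₚ.pos-* ℤ.∣ ℚ.↥ q ∣ (ℚᵘ.↧ₙ toℚᵘ q) ⟩
      + ℤ.∣ ℚ.↥ q ∣ ℤ.* ℚᵘ.↧ toℚᵘ q        ∎)))
    where
    open ℤₚ.≤-Reasoning
    i≤∣i∣ : ∀ i → i ℤ.≤ + ℤ.∣ i ∣
    i≤∣i∣ (+ n)    = ℤₚ.≤-refl
    i≤∣i∣ -[1+ n ] = ℤ.-≤+

  pow½ : ℕ → ℚ
  pow½ zero    = 1ℚ
  pow½ (suc n) = ½ * pow½ n

  pow½-pos : ∀ n → 0ℚ < pow½ n
  pow½-pos zero    = 0<1
  pow½-pos (suc n) = half-pos (pow½-pos n)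

  pow½-suc-≤ : ∀ n → pow½ (suc n) ≤ pow½ n
  pow½-suc-≤ n = from-gap (ℚₚ.<⇒≤ (half-pos (pow½-pos n)))
    (solve 1 (λ p → con ½ :* p := p :- con ½ :* p) ≡.refl (pow½ n))

  pow½-≤1 : ∀ n → pow½ n ≤ 1ℚ
  pow½-≤1 zero    = ℚₚ.≤-refl
  pow½-≤1 (suc n) = ℚₚ.≤-trans (pow½-suc-≤ n) (pow½-≤1 n)

  pow½-antitone : ∀ {m n} → m ℕ.≤ n → pow½ n ≤ pow½ m
  pow½-antitone m≤n = go (ℕₚ.≤⇒≤′ m≤n)
    where
    go : ∀ {m n} → m ℕ.≤′ n → pow½ n ≤ pow½ m
    go ℕ.≤′-refl           = ℚₚ.≤-refl
    go (ℕ.≤′-step {n} m≤n) = ℚₚ.≤-trans (pow½-suc-≤ n) (go m≤n)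

  -- This is n ≤ 2^n, from which `halving` gets a rate of convergence.
  pow½-*-natural : ∀ n → pow½ n * (+ n / 1) ≤ 1ℚ
  pow½-*-natural zero    = ℚₚ.<⇒≤ 0<1
  pow½-*-natural (suc n) = from-gap
    (0≤* (ℚₚ.<⇒≤ 0<½) (0≤+ (gap (pow½-*-natural n)) (gap (pow½-≤1 n))))
    (≡.trans (solve 2 (λ p n → con ½ :* (con 1ℚ :- p :* n :+ (con 1ℚ :- p))
        := con 1ℚ :- con ½ :* p :* (con 1ℚ :+ n)) ≡.refl (pow½ n) (+ n / 1))
      (≡.cong (λ t → 1ℚ - ½ * pow½ n * t) (≡.sym (/1-+ (+ 1) (+ n)))))

  -- For N ≥ w / ε, w / 2^N ≤ ε N / 2^N ≤ ε.
  halving : ∀ w ε → 0ℚ < w → 0ℚ < ε → ∃ λ N → pow½ N * w ≤ ε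
  halving w ε 0<w 0<ε with δ , 0<δ , ≡.refl ← divide ε w 0<ε 0<w with N , δ≤N ← ≤-natural δ = N , (begin
    pow½ N * (δ * ε)          ≤⟨ ℚₚ.*-monoˡ-≤-nonNeg (pow½ N) {{ℚ.nonNegative (ℚₚ.<⇒≤ (pow½-pos N))}}
                                   (ℚₚ.*-monoʳ-≤-nonNeg ε {{ℚ.nonNegative (ℚₚ.<⇒≤ 0<ε)}} δ≤N) ⟩
    pow½ N * ((+ N / 1) * ε)  ≡⟨ ℚₚ.*-assoc (pow½ N) _ ε ⟨
    pow½ N * (+ N / 1) * ε    ≤⟨ ℚₚ.*-monoʳ-≤-nonNeg ε {{ℚ.nonNegative (ℚₚ.<⇒≤ 0<ε)}} (pow½-*-natural N) ⟩
    1ℚ * ε                    ≡⟨ ℚₚ.*-identityˡ ε ⟩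
    ε                         ∎)
    where open ℚₚ.≤-Reasoning

-- Cauchy sequences as an ordered ring

module RealOrder where
  open import Data.Rational using (_+_; _*_; -_; _-_; _≤_; _<_; _/_)
  open Data.Rational.Solver.+-*-Solver using (solve; _:=_; _:+_; _:*_; _:-_; :-_; con)
  open RationalFacts
  open ℚₚ.≤-Reasoning

  Eventually : (ℕ → Set) → Set
  Eventually P = ∃ λ N → ∀ n → N ℕ.≤ n → P n

  always : ∀ {P : ℕ → Set} → (∀ n → P n) → Eventually P
  always p = 0 , λ n _ → p n

  map₁ : ∀ {P Q : ℕ → Set} → (∀ n → P n → Q n) → Eventually P → Eventually Q
  map₁ f (N , p) = N , λ n N≤n → f n (p n N≤n)

  map₂ : ∀ {P Q R : ℕ → Set} → (∀ n → P n → Q n → R n) →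
         Eventually P → Eventually Q → Eventually R
  map₂ f (M , p) (N , q) = M ℕ.⊔ N , λ n M⊔N≤n →
    f n (p n (ℕₚ.m⊔n≤o⇒m≤o M N M⊔N≤n)) (q n (ℕₚ.m⊔n≤o⇒n≤o M N M⊔N≤n))

  map₃ : ∀ {P Q R S : ℕ → Set} → (∀ n → P n → Q n → R n → S n) →
         Eventually P → Eventually Q → Eventually R → Eventually S
  map₃ f p q r = map₂ (λ n g → g) (map₂ f p q) r

  instantiate : ∀ {P : ℕ → Set} → Eventually P → ∃ P
  instantiate (N , p) = N , p N ℕₚ.≤-refl

  bounded : ∀ x → ∃ λ B → 0ℚ < B × Eventually (λ n → ∣ seq x n ∣ ≤ B)
  bounded x with N , h ← cauchy x 1ℚ 0<1 = 1ℚ + ∣ seq x N ∣ ,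
    ℚₚ.<-≤-trans 0<1 (from-gap (ℚₚ.0≤∣p∣ (seq x N)) (solve 1 (λ c → c := con 1ℚ :+ c :- con 1ℚ) ≡.refl _)) ,
    N , λ n N≤n → begin
      ∣ seq x n ∣                        ≡⟨ ≡.cong ∣_∣ (solve 2 (λ a c → a := a :- c :+ c) ≡.refl (seq x n) (seq x N)) ⟩
      ∣ seq x n - seq x N + seq x N ∣    ≤⟨ ℚₚ.∣p+q∣≤∣p∣+∣q∣ (seq x n - seq x N) (seq x N) ⟩
      ∣ seq x n - seq x N ∣ + ∣ seq x N ∣  ≤⟨ ℚₚ.+-monoˡ-≤ ∣ seq x N ∣ (h n N N≤n ℕₚ.≤-refl) ⟩
      1ℚ + ∣ seq x N ∣                   ∎

  -- Wrapping ≈ in a record lets unification recover x and y from x ≃ y.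
  infix 4 _≃_
  record _≃_ (x y : ℝ) : Set where
    constructor mk
    field
      ≃⇒≈ : x D.≈ y
  open _≃_ public

  pointwise : ∀ {x y} → (∀ n → seq x n ≡ seq y n) → x ≃ y
  pointwise {x} {y} eq .≃⇒≈ ε 0<ε = always λ n → begin
    ∣ seq x n - seq y n ∣   ≡⟨ ≡.cong (λ t → ∣ t - seq y n ∣) (eq n) ⟩
    ∣ seq y n - seq y n ∣   ≡⟨ ≡.cong ∣_∣ (ℚₚ.+-inverseʳ (seq y n)) ⟩
    0ℚ                      <⟨ 0<ε ⟩
    ε                       ∎

  ≃-refl : ∀ {x} → x ≃ x
  ≃-refl = pointwise λ n → ≡.refl

  ≃-sym : ∀ {x y} → x ≃ y → y ≃ x
  ≃-sym {x} {y} x≃y .≃⇒≈ ε 0<ε = map₁ (λ n → ≡.subst (_≤ ε)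
    (≡.trans (≡.sym (ℚₚ.∣-p∣≡∣p∣ _))
      (≡.cong ∣_∣ (solve 2 (λ a b → :- (a :- b) := b :- a) ≡.refl (seq x n) (seq y n)))))
    (≃⇒≈ x≃y ε 0<ε)

  ≃-trans : ∀ {x y z} → x ≃ y → y ≃ z → x ≃ z
  ≃-trans {x} {y} {z} x≃y y≃z .≃⇒≈ ε 0<ε = map₂
    (λ n p q → begin
      ∣ seq x n - seq z n ∣
        ≡⟨ ≡.cong ∣_∣ (solve 3 (λ a b c → a :- c := (a :- b) :+ (b :- c)) ≡.refl (seq x n) (seq y n) (seq z n)) ⟩
      ∣ (seq x n - seq y n) + (seq y n - seq z n) ∣
        ≤⟨ ℚₚ.∣p+q∣≤∣p∣+∣q∣ (seq x n - seq y n) _ ⟩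
      ∣ seq x n - seq y n ∣ + ∣ seq y n - seq z n ∣ ≤⟨ ℚₚ.+-mono-≤ p q ⟩
      ½ * ε + ½ * ε                                 ≡⟨ half-sum ε ⟩
      ε                                             ∎)
    (≃⇒≈ x≃y (½ * ε) (half-pos 0<ε)) (≃⇒≈ y≃z (½ * ε) (half-pos 0<ε))

  +-cong : ∀ {x x′ y y′} → x ≃ x′ → y ≃ y′ → x D.+ y ≃ x′ D.+ y′
  +-cong {x} {x′} {y} {y′} x≃ y≃ .≃⇒≈ ε 0<ε = map₂
    (λ n p q → begin
      ∣ (seq x n + seq y n) - (seq x′ n + seq y′ n) ∣
        ≡⟨ ≡.cong ∣_∣ (solve 4 (λ a b c d → (a :+ b) :- (c :+ d) := (a :- c) :+ (b :- d)) ≡.refl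
             (seq x n) (seq y n) (seq x′ n) (seq y′ n)) ⟩
      ∣ (seq x n - seq x′ n) + (seq y n - seq y′ n) ∣ ≤⟨ ℚₚ.∣p+q∣≤∣p∣+∣q∣ (seq x n - seq x′ n) _ ⟩
      ∣ seq x n - seq x′ n ∣ + ∣ seq y n - seq y′ n ∣ ≤⟨ ℚₚ.+-mono-≤ p q ⟩
      ½ * ε + ½ * ε                                   ≡⟨ half-sum ε ⟩
      ε                                               ∎)
    (≃⇒≈ x≃ (½ * ε) (half-pos 0<ε)) (≃⇒≈ y≃ (½ * ε) (half-pos 0<ε))

  neg-cong : ∀ {x y} → x ≃ y → D.- x ≃ D.- y
  neg-cong {x} {y} x≃y .≃⇒≈ ε 0<ε = map₁ (λ n → ≡.subst (_≤ ε)
    (≡.trans (≡.sym (ℚₚ.∣-p∣≡∣p∣ _))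
      (≡.cong ∣_∣ (solve 2 (λ a b → :- (a :- b) := :- a :- :- b) ≡.refl (seq x n) (seq y n)))))
    (≃⇒≈ x≃y ε 0<ε)

  *-congʳ : ∀ {x x′} y → x ≃ x′ → x D.* y ≃ x′ D.* y
  *-congʳ {x} {x′} y x≃ .≃⇒≈ ε 0<ε = scaled (bounded y)
    where
    scaled : (∃ λ B → 0ℚ < B × Eventually (λ n → ∣ seq y n ∣ ≤ B)) →
             Eventually (λ n → ∣ seq x n * seq y n - seq x′ n * seq y n ∣ ≤ ε)
    scaled (B , 0<B , y≤B) = let δ , 0<δ , δB≡ε = divide B ε 0<B 0<ε in map₂
      (λ n p q → ≡.subst₂ _≤_
        (≡.cong ∣_∣ (solve 3 (λ a b c → (a :- b) :* c := a :* c :- b :* c) ≡.refl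
          (seq x n) (seq x′ n) (seq y n)))
        δB≡ε (∣*∣≤ p q))
      (≃⇒≈ x≃ δ 0<δ) y≤B

  *-comm : ∀ x y → x D.* y ≃ y D.* x
  *-comm x y = pointwise λ n → ℚₚ.*-comm (seq x n) (seq y n)

  *-cong : ∀ {x x′ y y′} → x ≃ x′ → y ≃ y′ → x D.* y ≃ x′ D.* y′
  *-cong {x} {x′} {y} {y′} x≃ y≃ = ≃-trans (*-congʳ y x≃)
    (≃-trans (*-comm x′ y) (≃-trans (*-congʳ x′ y≃) (*-comm y′ x′)))

  commutativeRing : CommutativeRing 0ℓ 0ℓ
  commutativeRing = record
    { Carrier = ℝ
    ; _≈_ = _≃_
    ; _+_ = D._+_
    ; _*_ = D._*_
    ; -_  = D.-_
    ; 0#  = D.0ℝ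
    ; 1#  = D.1ℝ
    ; isCommutativeRing = record
      { isRing = record
        { +-isAbelianGroup = record
          { isGroup = record
            { isMonoid = record
              { isSemigroup = record
                { isMagma = record
                  { isEquivalence = record { refl = ≃-refl ; sym = ≃-sym ; trans = ≃-trans }
                  ; ∙-cong = +-cong
                  }
                ; assoc = λ x y z → pointwise λ n → ℚₚ.+-assoc (seq x n) (seq y n) (seq z n)
                }
              ; identity = (λ x → pointwise λ n → ℚₚ.+-identityˡ (seq x n)) ,
                           (λ x → pointwise λ n → ℚₚ.+-identityʳ (seq x n))
              }
            ; inverse = (λ x → pointwise λ n → ℚₚ.+-inverseˡ (seq x n)) ,
                        (λ x → pointwise λ n → ℚₚ.+-inverseʳ (seq x n))
            ; ⁻¹-cong = neg-cong
            }
          ; comm = λ x y → pointwise λ n → ℚₚ.+-comm (seq x n) (seq y n)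
          }
        ; *-cong = *-cong
        ; *-assoc = λ x y z → pointwise λ n → ℚₚ.*-assoc (seq x n) (seq y n) (seq z n)
        ; *-identity = (λ x → pointwise λ n → ℚₚ.*-identityˡ (seq x n)) ,
                       (λ x → pointwise λ n → ℚₚ.*-identityʳ (seq x n))
        ; distrib = (λ x y z → pointwise λ n → ℚₚ.*-distribˡ-+ (seq x n) (seq y n) (seq z n)) ,
                    (λ x y z → pointwise λ n → ℚₚ.*-distribʳ-+ (seq x n) (seq y n) (seq z n))
        }
      ; *-comm = *-comm
      }
    }

  record Pos (x : ℝ) : Set where
    constructor pos
    field
      {margin}   : ℚ
      margin-pos : 0ℚ < margin
      above      : Eventually (λ n → margin ≤ seq x n)

  record NonNeg (x : ℝ) : Set where
    constructor nonNeg
    field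
      bound : ∀ ε → 0ℚ < ε → Eventually (λ n → - ε ≤ seq x n)

  Pos-resp : ∀ {x y} → x ≃ y → Pos x → Pos y
  Pos-resp {x} {y} x≃y (pos {ε} 0<ε ε≤x) = pos (half-pos 0<ε) (map₂
    (λ n ε≤x ∣x-y∣≤ → from-gap (0≤+ (gap ε≤x) (0≤+ (gap (≤∣∣ (seq x n - seq y n))) (gap ∣x-y∣≤)))
      (solve 4 (λ e a b m → (a :- e) :+ ((m :- (a :- b)) :+ (con ½ :* e :- m)) := b :- con ½ :* e) ≡.refl
        ε (seq x n) (seq y n) ∣ seq x n - seq y n ∣))
    ε≤x (≃⇒≈ x≃y (½ * ε) (half-pos 0<ε)))

  NonNeg-resp : ∀ {x y} → x ≃ y → NonNeg x → NonNeg y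
  NonNeg-resp {x} {y} x≃y (nonNeg b) = nonNeg λ ε 0<ε → map₂
    (λ n -ε≤x ∣x-y∣≤ → from-gap (0≤+ (gap -ε≤x) (0≤+ (gap (≤∣∣ (seq x n - seq y n))) (gap ∣x-y∣≤)))
      (solve 4 (λ e a b m → (a :- :- (con ½ :* e)) :+ ((m :- (a :- b)) :+ (con ½ :* e :- m)) := b :- :- e) ≡.refl
        ε (seq x n) (seq y n) ∣ seq x n - seq y n ∣))
    (b (½ * ε) (half-pos 0<ε)) (≃⇒≈ x≃y (½ * ε) (half-pos 0<ε))

  neg≤0 : ∀ {ε} → 0ℚ < ε → - ε ≤ 0ℚ
  neg≤0 {ε} 0<ε = from-gap (ℚₚ.<⇒≤ 0<ε) (solve 1 (λ e → e := con 0ℚ :- :- e) ≡.refl ε)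

  Pos-1 : Pos D.1ℝ
  Pos-1 = pos 0<1 (always λ n → ℚₚ.≤-refl)

  Pos⇒NonNeg : ∀ {x} → Pos x → NonNeg x
  Pos⇒NonNeg (pos 0<δ δ≤x) = nonNeg λ ε 0<ε →
    map₁ (λ n δ≤x → ℚₚ.≤-trans (neg≤0 0<ε) (ℚₚ.≤-trans (ℚₚ.<⇒≤ 0<δ) δ≤x)) δ≤x

  Pos-+ : ∀ {x y} → Pos x → NonNeg y → Pos (x D.+ y)
  Pos-+ {x} {y} (pos {ε} 0<ε ε≤x) (nonNeg b) = pos (half-pos 0<ε) (map₂
    (λ n ε≤x ≤y → from-gap (0≤+ (gap ε≤x) (gap ≤y))
      (solve 3 (λ e a b → (a :- e) :+ (b :- :- (con ½ :* e)) := (a :+ b) :- con ½ :* e) ≡.refl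
        ε (seq x n) (seq y n)))
    ε≤x (b (½ * ε) (half-pos 0<ε)))

  Pos-* : ∀ {x y} → Pos x → Pos y → Pos (x D.* y)
  Pos-* (pos {ε} 0<ε ε≤x) (pos {δ} 0<δ δ≤y) = pos (0<* 0<ε 0<δ) (map₂
    (λ n ε≤x δ≤y → *-mono (ℚₚ.<⇒≤ 0<δ) (ℚₚ.≤-trans (ℚₚ.<⇒≤ 0<ε) ε≤x) ε≤x δ≤y) ε≤x δ≤y)

  NonNeg-+ : ∀ {x y} → NonNeg x → NonNeg y → NonNeg (x D.+ y)
  NonNeg-+ {x} {y} (nonNeg b) (nonNeg b′) = nonNeg λ ε 0<ε → map₂
    (λ n ≤x ≤y → from-gap (0≤+ (gap ≤x) (gap ≤y))
      (solve 3 (λ e a b → (a :- :- (con ½ :* e)) :+ (b :- :- (con ½ :* e)) := (a :+ b) :- :- e) ≡.refl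
        ε (seq x n) (seq y n)))
    (b (½ * ε) (half-pos 0<ε)) (b′ (½ * ε) (half-pos 0<ε))

  -- A factor that is not positive has absolute value at most η, so the product is at least -ηC or
  -- -ηB, and both exceed -η(B + C).
  product-bound : ∀ {p q η B C} → 0ℚ < η → 0ℚ < B → 0ℚ < C → - η ≤ p → - η ≤ q → ∣ p ∣ ≤ B → ∣ q ∣ ≤ C →
                  - (η * (B + C)) ≤ p * q
  product-bound {p} {q} {η} {B} {C} 0<η 0<B 0<C -η≤p -η≤q p≤B q≤C = go (ℚₚ.≤-total 0ℚ p) (ℚₚ.≤-total 0ℚ q)
    where
    0≤η : 0ℚ ≤ η
    0≤η = ℚₚ.<⇒≤ 0<η
    small : ∀ {p} → - η ≤ p → p ≤ 0ℚ → ∣ p ∣ ≤ η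
    small {p} -η≤p p≤0 = ∣∣≤ (ℚₚ.≤-trans p≤0 0≤η)
      (from-gap (gap -η≤p) (solve 2 (λ p e → p :- :- e := e :- :- p) ≡.refl p η))
    go : 0ℚ ≤ p ⊎ p ≤ 0ℚ → 0ℚ ≤ q ⊎ q ≤ 0ℚ → - (η * (B + C)) ≤ p * q
    go (inj₁ 0≤p) (inj₁ 0≤q) = ℚₚ.≤-trans (neg≤0 (0<* 0<η (ℚₚ.+-mono-< 0<B 0<C))) (0≤* 0≤p 0≤q)
    go (inj₂ p≤0) _ = from-gap
      (0≤+ (0≤+ (gap (∣*∣≤ (small -η≤p p≤0) q≤C)) (gap (-≤∣∣ (p * q)))) (0≤* 0≤η (ℚₚ.<⇒≤ 0<B)))
      (solve 5 (λ e B C z m → (e :* C :- m) :+ (m :- :- z) :+ e :* B := z :- :- (e :* (B :+ C))) ≡.refl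
        η B C (p * q) ∣ p * q ∣)
    go (inj₁ _) (inj₂ q≤0) = from-gap
      (0≤+ (0≤+ (gap (∣*∣≤ p≤B (small -η≤q q≤0))) (gap (-≤∣∣ (p * q)))) (0≤* 0≤η (ℚₚ.<⇒≤ 0<C)))
      (solve 5 (λ e B C z m → (B :* e :- m) :+ (m :- :- z) :+ e :* C := z :- :- (e :* (B :+ C))) ≡.refl
        η B C (p * q) ∣ p * q ∣)

  NonNeg-* : ∀ {x y} → NonNeg x → NonNeg y → NonNeg (x D.* y)
  NonNeg-* {x} {y} (nonNeg b) (nonNeg b′) = nonNeg λ ε 0<ε → proof ε 0<ε (bounded x) (bounded y)
    where
    proof : ∀ ε → 0ℚ < ε → (∃ λ B → 0ℚ < B × Eventually (λ n → ∣ seq x n ∣ ≤ B)) →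
            (∃ λ C → 0ℚ < C × Eventually (λ n → ∣ seq y n ∣ ≤ C)) →
            Eventually (λ n → - ε ≤ seq x n * seq y n)
    proof ε 0<ε (B , 0<B , x≤B) (C , 0<C , y≤C) =
      let η , 0<η , η≡ = divide (B + C) ε (ℚₚ.+-mono-< 0<B 0<C) 0<ε in
      map₂ (λ n (≤x , x≤) (≤y , y≤) → ≡.subst (λ t → - t ≤ seq x n * seq y n) η≡
             (product-bound 0<η 0<B 0<C ≤x ≤y x≤ y≤))
        (map₂ (λ n → _,_) (b η 0<η) x≤B) (map₂ (λ n → _,_) (b′ η 0<η) y≤C)

  0≤sq : ∀ p → 0ℚ ≤ p * p
  0≤sq p with ℚₚ.≤-total 0ℚ p
  ... | inj₁ 0≤p = 0≤* 0≤p 0≤p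
  ... | inj₂ p≤0 = ≡.subst (0ℚ ≤_) (solve 1 (λ p → (con 0ℚ :- p) :* (con 0ℚ :- p) := p :* p) ≡.refl p)
                     (0≤* (gap p≤0) (gap p≤0))

  NonNeg-sq : ∀ x → NonNeg (x D.* x)
  NonNeg-sq x = nonNeg λ ε 0<ε → always λ n → ℚₚ.≤-trans (neg≤0 0<ε) (0≤sq (seq x n))

  Pos-cancel : ∀ {x y} → Pos x → Pos (x D.* y) → Pos y
  Pos-cancel {x} {y} (pos {ε} 0<ε ε≤x) (pos {δ} 0<δ δ≤xy) = from-bound (bounded x)
    where
    proof : ∀ {η B} → 0ℚ < B → η * B ≡ δ → ∀ p q → ε ≤ p → ∣ p ∣ ≤ B → δ ≤ p * q → η ≤ q
    proof {η} {B} 0<B ηB≡ p q ε≤p p≤B ≤pq with ℚₚ.≤-total 0ℚ q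
    ... | inj₁ 0≤q = cancel-≤ 0<B (ℚₚ.≤-trans (ℚₚ.≤-trans (ℚₚ.≤-reflexive ηB≡) ≤pq) (≡.subst (p * q ≤_) (ℚₚ.*-comm B q)
            (ℚₚ.*-monoʳ-≤-nonNeg q {{ℚ.nonNegative 0≤q}} (ℚₚ.≤-trans (≤∣∣ p) p≤B))))
    ... | inj₂ q≤0 = contradiction (ℚₚ.≤-trans ≤pq pq≤0) (λ ηB≤0 → ℚₚ.<-irrefl ≡.refl (ℚₚ.<-≤-trans 0<δ ηB≤0))
      where
      pq≤0 : p * q ≤ 0ℚ
      pq≤0 = from-gap (0≤* (ℚₚ.≤-trans (ℚₚ.<⇒≤ 0<ε) ε≤p) (gap q≤0))
        (solve 2 (λ p q → p :* (con 0ℚ :- q) := con 0ℚ :- p :* q) ≡.refl p q)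
    from-bound : (∃ λ B → 0ℚ < B × Eventually (λ n → ∣ seq x n ∣ ≤ B)) → Pos y
    from-bound (B , 0<B , x≤B) =
      let η , 0<η , ηB≡ = divide B δ 0<B 0<δ in
      pos 0<η (map₃ (λ n → proof 0<B ηB≡ (seq x n) (seq y n)) ε≤x x≤B δ≤xy)

  NonNeg-cancel : ∀ {x y} → Pos x → NonNeg (x D.* y) → NonNeg y
  NonNeg-cancel {x} {y} (pos {ε} 0<ε ε≤x) (nonNeg b) = nonNeg λ η 0<η →
    map₂ (λ n → proof η 0<η (seq x n) (seq y n)) ε≤x (b (ε * η) (0<* 0<ε 0<η))
    where
    proof : ∀ η → 0ℚ < η → ∀ p q → ε ≤ p → - (ε * η) ≤ p * q → - η ≤ q
    proof η 0<η p q ε≤p ≤pq with ℚₚ.≤-total 0ℚ q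
    ... | inj₁ 0≤q = ℚₚ.≤-trans (neg≤0 0<η) 0≤q
    ... | inj₂ q≤0 = cancel-≤ 0<ε (from-gap (0≤+ (gap ≤pq) (0≤* (gap ε≤p) (gap q≤0)))
      (solve 4 (λ e h p q → (p :* q :- :- (e :* h)) :+ (p :- e) :* (con 0ℚ :- q) := q :* e :- :- h :* e) ≡.refl
        ε η p q))

  -- Let |y| ≤ B, xy ≥ δ and ηB = δ/2. Eventually x ≥ -η; a term x ≤ 0 would give xy ≤ ηB < δ, so x
  -- ≥ 0, and then xB ≥ xy ≥ δ makes η a margin.
  NonNeg⇒Pos : ∀ {x y} → NonNeg x → Pos (x D.* y) → Pos x
  NonNeg⇒Pos {x} {y} (nonNeg b) (pos {δ} 0<δ δ≤xy) = from-bound (bounded y)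
    where
    proof : ∀ {η B} → 0ℚ < η → 0ℚ < B → η * B ≡ ½ * δ →
            ∀ p q → - η ≤ p → ∣ q ∣ ≤ B → δ ≤ p * q → η ≤ p
    proof {η} {B} 0<η 0<B ηB≡ p q -η≤p q≤B ≤pq with ℚₚ.≤-total 0ℚ p
    ... | inj₁ 0≤p = cancel-≤ 0<B (≡.subst (_≤ p * B) (≡.sym ηB≡)
      (from-gap (0≤+ (gap ≤pq) (0≤+ (0≤* 0≤p (gap (ℚₚ.≤-trans (≤∣∣ q) q≤B))) (ℚₚ.<⇒≤ (half-pos 0<δ))))
        (solve 4 (λ p q B d → (p :* q :- d) :+ (p :* (B :- q) :+ con ½ :* d) := p :* B :- con ½ :* d) ≡.refl
          p q B δ)))
    ... | inj₂ p≤0 = contradiction δ≤½δ (λ h → ℚₚ.<-irrefl ≡.refl (ℚₚ.<-≤-trans (half-pos 0<δ)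
        (from-gap (gap h) (solve 1 (λ d → con ½ :* d :- d := con 0ℚ :- con ½ :* d) ≡.refl δ))))
      where
      ∣p∣≤η : ∣ p ∣ ≤ η
      ∣p∣≤η = ∣∣≤ (ℚₚ.≤-trans p≤0 (ℚₚ.<⇒≤ 0<η))
        (from-gap (gap -η≤p) (solve 2 (λ p e → p :- :- e := e :- :- p) ≡.refl p η))
      δ≤½δ : δ ≤ ½ * δ
      δ≤½δ = begin
        δ              ≤⟨ ≤pq ⟩
        p * q          ≤⟨ ≤∣∣ (p * q) ⟩
        ∣ p * q ∣      ≤⟨ ∣*∣≤ ∣p∣≤η q≤B ⟩
        η * B          ≡⟨ ηB≡ ⟩
        ½ * δ          ∎
    from-bound : (∃ λ B → 0ℚ < B × Eventually (λ n → ∣ seq y n ∣ ≤ B)) → Pos x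
    from-bound (B , 0<B , y≤B) =
      let η , 0<η , ηB≡ = divide B (½ * δ) 0<B (half-pos 0<δ) in
      pos 0<η (map₃ (λ n → proof 0<η 0<B ηB≡ (seq x n) (seq y n)) (b η 0<η) y≤B δ≤xy)

  cancel-0 : ∀ {x y} → Pos x → x D.* y ≃ D.0ℝ → y ≃ D.0ℝ
  cancel-0 {x} {y} (pos {ε} 0<ε ε≤x) xy≃0 .≃⇒≈ η 0<η =
    map₂ (λ n → proof (seq x n) (seq y n)) ε≤x (≃⇒≈ xy≃0 (η * ε) (0<* 0<η 0<ε))
    where
    proof : ∀ p q → ε ≤ p → ∣ p * q - 0ℚ ∣ ≤ η * ε → ∣ q - 0ℚ ∣ ≤ η
    proof p q ε≤p pq≤ = cancel-≤ 0<ε (begin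
      ∣ q - 0ℚ ∣ * ε      ≡⟨ ≡.cong (λ t → ∣ t ∣ * ε) (ℚₚ.+-identityʳ q) ⟩
      ∣ q ∣ * ε           ≡⟨ ℚₚ.*-comm ∣ q ∣ ε ⟩
      ε * ∣ q ∣           ≤⟨ ℚₚ.*-monoʳ-≤-nonNeg ∣ q ∣ {{ℚₚ.∣-∣-nonNeg q}} (ℚₚ.≤-trans ε≤p (≤∣∣ p)) ⟩
      ∣ p ∣ * ∣ q ∣       ≡⟨ ℚₚ.∣p*q∣≡∣p∣*∣q∣ p q ⟨
      ∣ p * q ∣           ≡⟨ ≡.cong ∣_∣ (ℚₚ.+-identityʳ (p * q)) ⟨
      ∣ p * q - 0ℚ ∣      ≤⟨ pq≤ ⟩
      η * ε               ∎)

  fromℤ : ℤ → ℝ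
  fromℤ i = fromℚ (i / 1)

  archimedean : ∀ x → ∃ λ n → Pos (fromℤ (+ n) D.+ x)
  archimedean x =
    let B , 0<B , x≤B = bounded x
        n , B+1≤n     = ≤-natural (B + 1ℚ)
    in n , pos 0<1 (map₁ (λ m x≤B → from-gap
      (0≤+ (gap B+1≤n) (0≤+ (gap (-≤∣∣ (seq x m))) (gap x≤B)))
      (solve 4 (λ n B x a → (n :- (B :+ con 1ℚ)) :+ ((a :- :- x) :+ (B :- a)) := (n :+ x) :- con 1ℚ) ≡.refl
        (+ n / 1) B (seq x m) ∣ seq x m ∣)) x≤B)

  antisymmetric : ∀ {x} → NonNeg x → NonNeg (D.- x) → x ≃ D.0ℝ
  antisymmetric {x} (nonNeg b) (nonNeg b′) .≃⇒≈ ε 0<ε = map₂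
    (λ n -ε≤x -ε≤-x → ≡.subst (λ t → ∣ t ∣ ≤ ε) (≡.sym (ℚₚ.+-identityʳ (seq x n)))
      (∣∣≤ (from-gap (gap -ε≤-x) (solve 2 (λ x e → (:- x) :- :- e := e :- x) ≡.refl (seq x n) ε))
           (from-gap (gap -ε≤x) (solve 2 (λ x e → x :- :- e := e :- :- x) ≡.refl (seq x n) ε))))
    (b ε 0<ε) (b′ ε 0<ε)

-- Intermediate value theorem for integer polynomials

module RealIVT where
  open import Data.Rational using (_+_; _*_; -_; _-_; _≤_; _<_; _/_)
  open Data.Rational.Solver.+-*-Solver using (solve; _:=_; _:+_; _:*_; _:-_; :-_; con)
  open RationalFacts
  open RealOrder
  open Evaluation commutativeRing
  open ℚₚ.≤-Reasoning

  -- The j-th term of below x is a rational lower bound of x, within 2 / 2 ^ j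
  -- of x.
  module Below (x : ℝ) where

    index : ℕ → ℕ
    index j = proj₁ (cauchy x (pow½ j) (pow½-pos j))

    term : ℕ → ℚ
    term j = seq x (index j) - pow½ j

    close : ∀ j m → index j ℕ.≤ m → ∣ seq x m - seq x (index j) ∣ ≤ pow½ j
    close j m j≤m = proj₂ (cauchy x (pow½ j) (pow½-pos j)) m (index j) j≤m ℕₚ.≤-refl

    lower : ∀ j m → index j ℕ.≤ m → term j ≤ seq x m
    lower j m j≤m = from-gap (0≤+ (gap (close j m j≤m)) (gap (-≤∣∣ (seq x m - seq x (index j)))))
      (solve 4 (λ p m a b → (p :- m) :+ (m :- :- (a :- b)) := a :- (b :- p)) ≡.refl
        (pow½ j) ∣ seq x m - seq x (index j) ∣ (seq x m) (seq x (index j)))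

    upper : ∀ j m → index j ℕ.≤ m → seq x m ≤ term j + pow½ j * (1ℚ + 1ℚ)
    upper j m j≤m = from-gap (0≤+ (gap (close j m j≤m)) (gap (≤∣∣ (seq x m - seq x (index j)))))
      (solve 4 (λ p m a b → (p :- m) :+ (m :- (a :- b)) := (b :- p) :+ p :* (con 1ℚ :+ con 1ℚ) :- a) ≡.refl
        (pow½ j) ∣ seq x m - seq x (index j) ∣ (seq x m) (seq x (index j)))

    0<2 : 0ℚ < 1ℚ + 1ℚ
    0<2 = ℚₚ.+-mono-< 0<1 0<1

    pow½-≤ : ∀ {J j ε} → pow½ J * (1ℚ + 1ℚ) ≤ ε → J ℕ.≤ j → pow½ j * (1ℚ + 1ℚ) ≤ ε
    pow½-≤ J≤ε J≤j = ℚₚ.≤-trans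
      (ℚₚ.*-monoʳ-≤-nonNeg (1ℚ + 1ℚ) (pow½-antitone J≤j)) J≤ε

    term-gap : ∀ ε J → pow½ J * (1ℚ + 1ℚ) ≤ ε → ∀ i j → J ℕ.≤ i → J ℕ.≤ j → term i - term j ≤ ε
    term-gap ε J J≤ε i j J≤i J≤j = from-gap
      (0≤+ (gap (lower i m (ℕₚ.m≤m⊔n (index i) (index j))))
        (0≤+ (gap (upper j m (ℕₚ.m≤n⊔m (index i) (index j)))) (gap (pow½-≤ J≤ε J≤j))))
      (solve 5 (λ t u s p e → (s :- t) :+ ((u :+ p :- s) :+ (e :- p)) := e :- (t :- u)) ≡.refl
        (term i) (term j) (seq x m) (pow½ j * (1ℚ + 1ℚ)) ε)
      where
      m : ℕ
      m = index i ℕ.⊔ index j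

    term-cauchy : IsCauchy term
    term-cauchy ε 0<ε =
      let J , J≤ε = halving (1ℚ + 1ℚ) ε 0<2 0<ε in
      J , λ i j J≤i J≤j → ∣∣≤ (term-gap ε J J≤ε i j J≤i J≤j)
        (≡.subst (_≤ ε) (solve 2 (λ a b → b :- a := :- (a :- b)) ≡.refl (term i) (term j))
          (term-gap ε J J≤ε j i J≤j J≤i))

    below : ℝ
    below = mkℝ term term-cauchy

    below-≃ : below ≃ x
    below-≃ .≃⇒≈ ε 0<ε =
      let N , h   = cauchy x (½ * ε) (half-pos 0<ε)
          J , J≤ε = halving (1ℚ + 1ℚ) (½ * ε) 0<2 (half-pos 0<ε)
      in N ℕ.⊔ J , λ n N⊔J≤n →
        let m   = n ℕ.⊔ index n
            N≤n = ℕₚ.m⊔n≤o⇒m≤o N J N⊔J≤n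
            J≤n = ℕₚ.m⊔n≤o⇒n≤o N J N⊔J≤n
            n≤m = ℕₚ.m≤m⊔n n (index n)
            lo  = lower n m (ℕₚ.m≤n⊔m n (index n))
            up  = upper n m (ℕₚ.m≤n⊔m n (index n))
            d   = h m n (ℕₚ.≤-trans N≤n n≤m) N≤n
        in ∣∣≤
          (from-gap (0≤+ (0≤+ (gap lo) (0≤+ (gap d) (gap (≤∣∣ (seq x m - seq x n))))) (ℚₚ.<⇒≤ (half-pos 0<ε)))
            (solve 5 (λ t a b d e → (a :- t) :+ ((con ½ :* e :- d) :+ (d :- (a :- b))) :+ con ½ :* e
                := e :- (t :- b)) ≡.refl (term n) (seq x m) (seq x n) ∣ seq x m - seq x n ∣ ε))
          (from-gap (0≤+ (0≤+ (gap up) (gap (pow½-≤ J≤ε J≤n))) (0≤+ (gap d) (gap (-≤∣∣ (seq x m - seq x n)))))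
            (solve 6 (λ t a b d e p → ((t :+ p :- a) :+ (con ½ :* e :- p)) :+ ((con ½ :* e :- d) :+ (d :- :- (a :- b)))
                := e :- :- (t :- b)) ≡.refl (term n) (seq x m) (seq x n) ∣ seq x m - seq x n ∣ ε
                (pow½ n * (1ℚ + 1ℚ))))

    below-≤ : ∀ j → NonNeg (x D.+ D.- fromℚ (term j))
    below-≤ j = nonNeg λ ε 0<ε → index j , λ m j≤m →
      ℚₚ.≤-trans (neg≤0 0<ε) (gap (lower j m j≤m))

  -- The n-th term of f(x) is the value of f at the n-th term of x, which reduces signs of f to
  -- rational ones.
  evalℚ : List ℤ → ℚ → ℚ
  evalℚ []      t = 0ℚ
  evalℚ (a ∷ f) t = a / 1 + t * evalℚ f t

  seq-ev : ∀ f x n → seq (ev (map fromℤ f) x) n ≡ evalℚ f (seq x n)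
  seq-ev []      x n = ≡.refl
  seq-ev (a ∷ f) x n = ≡.cong (λ t → a / 1 + seq x n * t) (seq-ev f x n)

  module Bisection (f : List ℤ) (l₀ h₀ : ℚ) (l₀<h₀ : l₀ < h₀)
      (f-l₀ : evalℚ f l₀ ≤ 0ℚ) (f-h₀ : 0ℚ ≤ evalℚ f h₀) where

    record Interval (w : ℚ) : Set where
      constructor interval
      field
        lo hi : ℚ
        width : hi - lo ≡ w
        f-lo  : evalℚ f lo ≤ 0ℚ
        f-hi  : 0ℚ ≤ evalℚ f hi
    open Interval

    mid : ∀ {w} → Interval w → ℚ
    mid I = ½ * (lo I + hi I)

    -- The outcome of the sign test is an argument, so that the monotonicity of the endpoints can be
    -- proved by cases on it.
    halve : ∀ {w} (I : Interval w) → evalℚ f (mid I) ≤ 0ℚ ⊎ 0ℚ ≤ evalℚ f (mid I) → Interval (½ * w)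
    halve I (inj₁ ≤0) = interval (mid I) (hi I)
      (≡.trans (solve 2 (λ l h → h :- con ½ :* (l :+ h) := con ½ :* (h :- l)) ≡.refl (lo I) (hi I))
        (≡.cong (½ *_) (width I))) ≤0 (f-hi I)
    halve I (inj₂ 0≤) = interval (lo I) (mid I)
      (≡.trans (solve 2 (λ l h → con ½ :* (l :+ h) :- l := con ½ :* (h :- l)) ≡.refl (lo I) (hi I))
        (≡.cong (½ *_) (width I))) (f-lo I) 0≤

    decide : ∀ {w} (I : Interval w) → evalℚ f (mid I) ≤ 0ℚ ⊎ 0ℚ ≤ evalℚ f (mid I)
    decide I = ℚₚ.≤-total (evalℚ f (mid I)) 0ℚ

    w₀ : ℚ
    w₀ = h₀ - l₀

    0<w₀ : 0ℚ < w₀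
    0<w₀ = ≡.subst (_< w₀) (ℚₚ.+-inverseʳ l₀) (ℚₚ.+-monoˡ-< (- l₀) l₀<h₀)

    widthₙ : ℕ → ℚ
    widthₙ zero    = w₀
    widthₙ (suc n) = ½ * widthₙ n

    widthₙ-≡ : ∀ n → widthₙ n ≡ pow½ n * w₀
    widthₙ-≡ zero    = ≡.sym (ℚₚ.*-identityˡ w₀)
    widthₙ-≡ (suc n) = ≡.trans (≡.cong (½ *_) (widthₙ-≡ n)) (≡.sym (ℚₚ.*-assoc ½ (pow½ n) w₀))

    widthₙ-≥0 : ∀ n → 0ℚ ≤ widthₙ n
    widthₙ-≥0 zero    = ℚₚ.<⇒≤ 0<w₀
    widthₙ-≥0 (suc n) = 0≤* (ℚₚ.<⇒≤ 0<½) (widthₙ-≥0 n)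

    state : ∀ n → Interval (widthₙ n)
    state zero    = interval l₀ h₀ ≡.refl f-l₀ f-h₀
    state (suc n) = halve (state n) (decide (state n))

    L H : ℕ → ℚ
    L n = lo (state n)
    H n = hi (state n)

    halve-lo : ∀ {w} (I : Interval w) → 0ℚ ≤ w → ∀ c → lo I ≤ lo (halve I c)
    halve-lo {w} I 0≤w (inj₁ _) = from-gap (0≤* (ℚₚ.<⇒≤ 0<½) 0≤w)
      (≡.trans (≡.cong (½ *_) (≡.sym (width I)))
        (solve 2 (λ l h → con ½ :* (h :- l) := con ½ :* (l :+ h) :- l) ≡.refl (lo I) (hi I)))
    halve-lo I 0≤w (inj₂ _) = ℚₚ.≤-refl

    halve-hi : ∀ {w} (I : Interval w) → 0ℚ ≤ w → ∀ c → hi (halve I c) ≤ hi I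
    halve-hi I 0≤w (inj₁ _) = ℚₚ.≤-refl
    halve-hi I 0≤w (inj₂ _) = from-gap (0≤* (ℚₚ.<⇒≤ 0<½) 0≤w)
      (≡.trans (≡.cong (½ *_) (≡.sym (width I)))
        (solve 2 (λ l h → con ½ :* (h :- l) := h :- con ½ :* (l :+ h)) ≡.refl (lo I) (hi I)))

    L-mono : ∀ {m n} → m ℕ.≤′ n → L m ≤ L n
    L-mono ℕ.≤′-refl           = ℚₚ.≤-refl
    L-mono (ℕ.≤′-step {n} m≤n) = ℚₚ.≤-trans (L-mono m≤n) (halve-lo (state n) (widthₙ-≥0 n) (decide (state n)))

    H-mono : ∀ {m n} → m ℕ.≤′ n → H n ≤ H m
    H-mono ℕ.≤′-refl           = ℚₚ.≤-refl
    H-mono (ℕ.≤′-step {n} m≤n) = ℚₚ.≤-trans (halve-hi (state n) (widthₙ-≥0 n) (decide (state n))) (H-mono m≤n)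

    L≤H : ∀ n → L n ≤ H n
    L≤H n = from-gap (widthₙ-≥0 n) (≡.sym (width (state n)))

    L-gap : ∀ ε N → pow½ N * w₀ ≤ ε → ∀ m n → N ℕ.≤ m → N ℕ.≤ n → L m - L n ≤ ε
    L-gap ε N N≤ε m n N≤m N≤n = from-gap
      (0≤+ (gap (L≤H m)) (0≤+ (gap (H-mono (ℕₚ.≤⇒≤′ N≤m))) (0≤+ (gap (L-mono (ℕₚ.≤⇒≤′ N≤n))) (gap H-L≤ε))))
      (solve 6 (λ lm ln lN hm hN e → (hm :- lm) :+ ((hN :- hm) :+ ((ln :- lN) :+ (e :- (hN :- lN))))
        := e :- (lm :- ln)) ≡.refl (L m) (L n) (L N) (H m) (H N) ε)
      where
      H-L≤ε : H N - L N ≤ ε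
      H-L≤ε = ℚₚ.≤-trans (ℚₚ.≤-reflexive (≡.trans (width (state N)) (widthₙ-≡ N))) N≤ε

    L-cauchy : IsCauchy L
    L-cauchy ε 0<ε =
      let N , N≤ε = halving w₀ ε 0<w₀ 0<ε in
      N , λ m n N≤m N≤n → ∣∣≤ (L-gap ε N N≤ε m n N≤m N≤n)
        (≡.subst (_≤ ε) (solve 2 (λ a b → b :- a := :- (a :- b)) ≡.refl (L m) (L n))
          (L-gap ε N N≤ε n m N≤n N≤m))

    ρ : ℝ
    ρ = mkℝ L L-cauchy

    H-L-null : ∀ ε → 0ℚ < ε → Eventually (λ n → ∣ H n - L n ∣ ≤ ε)
    H-L-null ε 0<ε =
      let N , N≤ε = halving w₀ ε 0<w₀ 0<ε in
      N , λ n N≤n → ℚₚ.≤-trans (ℚₚ.≤-reflexive (ℚₚ.0≤p⇒∣p∣≡p (gap (L≤H n))))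
        (≡.subst (_≤ ε) (≡.sym (≡.trans (width (state n)) (widthₙ-≡ n)))
          (ℚₚ.≤-trans (ℚₚ.*-monoʳ-≤-nonNeg w₀ {{ℚ.nonNegative (ℚₚ.<⇒≤ 0<w₀)}} (pow½-antitone N≤n)) N≤ε))

    H-cauchy : IsCauchy H
    H-cauchy ε 0<ε =
      let N , h = L-cauchy (½ * ε) (half-pos 0<ε)
          M , g = H-L-null (½ * (½ * ε)) (half-pos (half-pos 0<ε))
      in N ℕ.⊔ M , λ m n m≥ n≥ → begin
        ∣ H m - H n ∣
          ≡⟨ ≡.cong ∣_∣ (solve 4 (λ hm hn lm ln → hm :- hn := (lm :- ln) :+ ((hm :- lm) :- (hn :- ln))) ≡.refl
               (H m) (H n) (L m) (L n)) ⟩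
        ∣ (L m - L n) + ((H m - L m) - (H n - L n)) ∣
          ≤⟨ ℚₚ.∣p+q∣≤∣p∣+∣q∣ (L m - L n) _ ⟩
        ∣ L m - L n ∣ + ∣ (H m - L m) - (H n - L n) ∣
          ≤⟨ ℚₚ.+-mono-≤ (h m n (ℕₚ.m⊔n≤o⇒m≤o N M m≥) (ℕₚ.m⊔n≤o⇒m≤o N M n≥))
               (ℚₚ.≤-trans (ℚₚ.∣p-q∣≤∣p∣+∣q∣ (H m - L m) (H n - L n))
                 (ℚₚ.+-mono-≤ (g m (ℕₚ.m⊔n≤o⇒n≤o N M m≥)) (g n (ℕₚ.m⊔n≤o⇒n≤o N M n≥)))) ⟩
        ½ * ε + (½ * (½ * ε) + ½ * (½ * ε))
          ≡⟨ solve 1 (λ e → con ½ :* e :+ (con ½ :* (con ½ :* e) :+ con ½ :* (con ½ :* e)) := e) ≡.refl ε ⟩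
        ε ∎

    -- The same real as ρ, represented by the right endpoints. The left sequence shows f ρ ≤ 0 and
    -- the right one 0 ≤ f ρ.
    ρ⁺ : ℝ
    ρ⁺ = mkℝ H H-cauchy

    ρ⁺≃ρ : ρ⁺ ≃ ρ
    ρ⁺≃ρ .≃⇒≈ = H-L-null

    f-ρ≤0 : NonNeg (D.- ev (map fromℤ f) ρ)
    f-ρ≤0 = nonNeg λ ε 0<ε → always λ n → ℚₚ.≤-trans (neg≤0 0<ε)
      (≡.subst (λ t → 0ℚ ≤ - t) (≡.sym (seq-ev f ρ n)) (ℚₚ.neg-antimono-≤ (f-lo (state n))))

    0≤f-ρ : NonNeg (ev (map fromℤ f) ρ)
    0≤f-ρ = NonNeg-resp (ev-cong (map fromℤ f) ρ⁺≃ρ) (nonNeg λ ε 0<ε → always λ n → ℚₚ.≤-trans (neg≤0 0<ε)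
      (≡.subst (0ℚ ≤_) (≡.sym (seq-ev f ρ⁺ n)) (f-hi (state n))))

    f-ρ : ev (map fromℤ f) ρ ≃ D.0ℝ
    f-ρ = antisymmetric 0≤f-ρ f-ρ≤0

    l₀≤ρ : NonNeg (ρ D.+ D.- fromℚ l₀)
    l₀≤ρ = nonNeg λ ε 0<ε → always λ n →
      ℚₚ.≤-trans (neg≤0 0<ε) (gap (L-mono (ℕₚ.≤⇒≤′ {0} {n} z≤n)))

    ρ≤h₀ : NonNeg (fromℚ h₀ D.+ D.- ρ)
    ρ≤h₀ = nonNeg λ ε 0<ε → always λ n →
      ℚₚ.≤-trans (neg≤0 0<ε) (gap (ℚₚ.≤-trans (L≤H n) (H-mono (ℕₚ.≤⇒≤′ {0} {n} z≤n))))

  rational-ivt : ∀ f l h → l < h → evalℚ f l ≤ 0ℚ → 0ℚ ≤ evalℚ f h →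
    ∃ λ ρ → NonNeg (fromℚ h D.+ D.- ρ) × NonNeg (ρ D.+ D.- fromℚ l) × ev (map fromℤ f) ρ ≃ D.0ℝ
  rational-ivt f l h l<h f-l f-h = ρ , ρ≤h₀ , l₀≤ρ , f-ρ
    where open Bisection f l h l<h f-l f-h

  NonNeg-trans : ∀ x y z → NonNeg (x D.+ D.- y) → NonNeg (y D.+ D.- z) → NonNeg (x D.+ D.- z)
  NonNeg-trans x y z y≤x z≤y = NonNeg-resp
    {(x D.+ D.- y) D.+ (y D.+ D.- z)} {x D.+ D.- z}
    (pointwise λ n → solve 3 (λ x y z → (x :- y) :+ (y :- z) := x :- z) ≡.refl (seq x n) (seq y n) (seq z n))
    (NonNeg-+ {x D.+ D.- y} {y D.+ D.- z} y≤x z≤y)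

  -- At one common index all three strict inequalities hold for the terms themselves; these terms
  -- are the rational endpoints of the bisection.
  separated : ∀ f x y → Pos (x D.+ D.- y) → Pos (ev (map fromℤ f) x) → Pos (D.- ev (map fromℤ f) y) →
    ∃ λ n → seq y n < seq x n × evalℚ f (seq y n) ≤ 0ℚ × 0ℚ ≤ evalℚ f (seq x n)
  separated f x y (pos {α} 0<α y<x) (pos {β} 0<β 0<fx) (pos {γ} 0<γ fy<0) = instantiate (map₃
    (λ n p q r →
      ≡.subst₂ _<_ (ℚₚ.+-identityˡ (seq y n))
        (solve 2 (λ h l → h :- l :+ l := h) ≡.refl (seq x n) (seq y n))
        (ℚₚ.+-monoˡ-< (seq y n) (ℚₚ.<-≤-trans 0<α p)) ,
      from-gap (ℚₚ.≤-trans (ℚₚ.<⇒≤ 0<γ) r)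
        (≡.trans (≡.cong -_ (seq-ev f y n)) (≡.sym (ℚₚ.+-identityˡ (- evalℚ f (seq y n))))) ,
      ≡.subst (0ℚ ≤_) (seq-ev f x n) (ℚₚ.≤-trans (ℚₚ.<⇒≤ 0<β) q))
    y<x 0<fx fy<0)

  -- For the zero to lie between v and u, the rational endpoints must lie there too, but terms of a
  -- Cauchy sequence may be on either side of the limit. Hence u is represented by lower bounds, and
  -- v by upper bounds, the negatives of lower bounds of -v.
  ivt : ∀ (f : List ℤ) {u v} → Pos (u D.+ D.- v) →
        Pos (ev (map fromℤ f) u) → Pos (D.- ev (map fromℤ f) v) →
        ∃ λ ρ → NonNeg (u D.+ D.- ρ) × NonNeg (ρ D.+ D.- v) × ev (map fromℤ f) ρ ≃ D.0ℝ
  ivt f {u} {v} v<u 0<fu fv<0 = between (separated f u⁻ v⁺ v⁺<u⁻ 0<f⁻ f⁺<0)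
    where
    module U = Below u
    module V = Below (D.- v)
    u⁻ v⁺ : ℝ
    u⁻ = U.below
    v⁺ = D.- V.below
    v⁺≃v : v⁺ ≃ v
    v⁺≃v = ≃-trans {v⁺} {D.- (D.- v)} {v} (neg-cong {V.below} {D.- v} V.below-≃)
      (pointwise λ n → solve 1 (λ v → :- (:- v) := v) ≡.refl (seq v n))
    v⁺<u⁻ : Pos (u⁻ D.+ D.- v⁺)
    v⁺<u⁻ = Pos-resp {u D.+ D.- v} {u⁻ D.+ D.- v⁺}
      (+-cong {u} {u⁻} {D.- v} {D.- v⁺} (≃-sym U.below-≃) (neg-cong {v} {v⁺} (≃-sym v⁺≃v))) v<u
    0<f⁻ : Pos (ev (map fromℤ f) u⁻)
    0<f⁻ = Pos-resp (ev-cong (map fromℤ f) (≃-sym U.below-≃)) 0<fu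
    f⁺<0 : Pos (D.- ev (map fromℤ f) v⁺)
    f⁺<0 = Pos-resp {D.- ev (map fromℤ f) v} {D.- ev (map fromℤ f) v⁺}
      (neg-cong {ev (map fromℤ f) v} {ev (map fromℤ f) v⁺} (ev-cong (map fromℤ f) (≃-sym v⁺≃v))) fv<0
    v≤v⁺ : ∀ n → NonNeg (fromℚ (seq v⁺ n) D.+ D.- v)
    v≤v⁺ n = NonNeg-resp {D.- v D.+ D.- fromℚ (V.term n)} {fromℚ (seq v⁺ n) D.+ D.- v}
      (pointwise λ m → ℚₚ.+-comm (- seq v m) (- V.term n)) (V.below-≤ n)
    between : (∃ λ n → seq v⁺ n < seq u⁻ n × evalℚ f (seq v⁺ n) ≤ 0ℚ × 0ℚ ≤ evalℚ f (seq u⁻ n)) →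
              ∃ λ ρ → NonNeg (u D.+ D.- ρ) × NonNeg (ρ D.+ D.- v) × ev (map fromℤ f) ρ ≃ D.0ℝ
    between (n , l<h , f-l , f-h) =
      let ρ , ρ≤h , l≤ρ , f-ρ = rational-ivt f (seq v⁺ n) (seq u⁻ n) l<h f-l f-h in
      ρ , NonNeg-trans u (fromℚ (seq u⁻ n)) ρ (U.below-≤ n) ρ≤h ,
          NonNeg-trans ρ (fromℚ (seq v⁺ n)) v l≤ρ (v≤v⁺ n) , f-ρ

  orderedRing : OrderedRing
  orderedRing = record
    { commutativeRing = commutativeRing
    ; fromℤ = fromℤ
    ; fromℤ-+ = λ i j → pointwise λ n → /1-+ i j
    ; fromℤ-* = λ i j → pointwise λ n → /1-* i j
    ; fromℤ-neg = λ i → pointwise λ n → /1-neg i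
    ; fromℤ-1 = ≃-refl
    ; Pos = Pos
    ; NonNeg = NonNeg
    ; Pos-resp = λ {x} {y} → Pos-resp {x} {y}
    ; NonNeg-resp = λ {x} {y} → NonNeg-resp {x} {y}
    ; Pos-1 = Pos-1
    ; Pos⇒NonNeg = λ {x} → Pos⇒NonNeg {x}
    ; Pos-+ = λ {x} {y} → Pos-+ {x} {y}
    ; Pos-* = λ {x} {y} → Pos-* {x} {y}
    ; NonNeg-+ = λ {x} {y} → NonNeg-+ {x} {y}
    ; NonNeg-* = λ {x} {y} → NonNeg-* {x} {y}
    ; NonNeg-sq = NonNeg-sq
    ; Pos-cancel = λ {x} {y} → Pos-cancel {x} {y}
    ; NonNeg-cancel = λ {x} {y} → NonNeg-cancel {x} {y}
    ; NonNeg⇒Pos = λ {x} {y} → NonNeg⇒Pos {x} {y}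
    ; cancel-0 = λ {x} {y} → cancel-0 {x} {y}
    ; archimedean = archimedean
    ; ivt = λ f {u} {v} → ivt f {u} {v}
    }

-- Numerators of the generating series

module GeneratingSeries where
  open import Data.Integer using (_+_; _*_; -_; _-_)
  open Data.Integer.Solver.+-*-Solver using (solve; _:=_; _:+_; _:*_; _:-_; :-_; con)
  open Grids using (step; shiftˡ; shiftʳ; typeB; descent)
  open ≡.≡-Reasoning

  -- The coefficients of (1 - x) ^ e.
  binomial : ℕ → ℕ → ℤ
  binomial zero    zero    = + 1
  binomial zero    (suc j) = + 0
  binomial (suc e) zero    = binomial e 0
  binomial (suc e) (suc j) = binomial e (suc j) - binomial e j

  -- The derivative of (1 - x)^(e+1) is -(e + 1) (1 - x)^e, coefficient by coefficient.
  absorption : ∀ e j → (+ 1 + + j) * binomial (suc e) (suc j) ≡ - ((+ 1 + + e) * binomial e j)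
  absorption zero    zero    = ≡.refl
  absorption zero    (suc j) = ℤₚ.*-zeroʳ (+ 1 + + suc j)
  absorption (suc e) zero    = begin
    (+ 1 + + 0) * (binomial (suc e) 1 - b)
      ≡⟨ solve 2 (λ x b → (con (+ 1) :+ con (+ 0)) :* (x :- b) := (con (+ 1) :+ con (+ 0)) :* x :- b) ≡.refl
           (binomial (suc e) 1) b ⟩
    (+ 1 + + 0) * binomial (suc e) 1 - b
      ≡⟨ ≡.cong (_- b) (absorption e 0) ⟩
    - ((+ 1 + + e) * b) - b
      ≡⟨ solve 2 (λ e b → :- ((con (+ 1) :+ e) :* b) :- b := :- ((con (+ 1) :+ (con (+ 1) :+ e)) :* b)) ≡.refl (+ e) b ⟩
    - ((+ 1 + + suc e) * b) ∎
    where
    b : ℤ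
    b = binomial e 0
  absorption (suc e) (suc j) = begin
    (+ 1 + + suc j) * (binomial (suc e) (suc (suc j)) - b)
      ≡⟨ solve 3 (λ x b j → (con (+ 1) :+ (con (+ 1) :+ j)) :* (x :- b)
           := (con (+ 1) :+ (con (+ 1) :+ j)) :* x :- (con (+ 1) :+ j) :* b :- b) ≡.refl
           (binomial (suc e) (suc (suc j))) b (+ j) ⟩
    (+ 1 + + suc j) * binomial (suc e) (suc (suc j)) - (+ 1 + + j) * b - b
      ≡⟨ ≡.cong₂ (λ s t → s - t - b) (absorption e (suc j)) (absorption e j) ⟩
    - ((+ 1 + + e) * binomial e (suc j)) - - ((+ 1 + + e) * binomial e j) - b
      ≡⟨ solve 3 (λ e x y → :- ((con (+ 1) :+ e) :* x) :- :- ((con (+ 1) :+ e) :* y) :- (x :- y)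
           := :- ((con (+ 1) :+ (con (+ 1) :+ e)) :* (x :- y))) ≡.refl (+ e) (binomial e (suc j)) (binomial e j) ⟩
    - ((+ 1 + + suc e) * b) ∎
    where
    b : ℤ
    b = binomial (suc e) (suc j)

  -- numerator f e m is the coefficient of x ^ m in f (1 - x) ^ e, and
  -- numerator⁻ f e m that of x ^ (m - 1).
  numerator numerator⁻ : (ℕ → ℤ) → ℕ → ℕ → ℤ
  numerator f e zero    = f 0 * binomial e 0
  numerator f e (suc m) = f 0 * binomial e (suc m) + numerator (f ∘ suc) e m
  numerator⁻ f e zero    = + 0
  numerator⁻ f e (suc m) = numerator f e m

  numerator-head : ∀ f e m → numerator f e m ≡ f 0 * binomial e m + numerator⁻ (f ∘ suc) e m
  numerator-head f e zero    = ≡.sym (ℤₚ.+-identityʳ _)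
  numerator-head f e (suc m) = ≡.refl

  numerator-cong : ∀ {f g} e m → (∀ i → f i ≡ g i) → numerator f e m ≡ numerator g e m
  numerator-cong e zero    f≡g = ≡.cong (_* binomial e 0) (f≡g 0)
  numerator-cong e (suc m) f≡g =
    ≡.cong₂ _+_ (≡.cong (_* binomial e (suc m)) (f≡g 0)) (numerator-cong e m (f≡g ∘ suc))

  -- For F = N / (1 - x)^e, applying c x d/dx + β yields the numerator c x (1 - x) N′ + (c e x + β
  -- (1 - x)) N over (1 - x)^(e+1). A general β is needed because dropping the first term of f turns
  -- it into c + β.
  numerator-step : ∀ c β f e m → numerator (λ i → (c * + i + β) * f i) (suc e) m ≡
    (c * + m + β) * numerator f e m + (c * (+ 1 + + e) - c * + m - β) * numerator⁻ f e m
  numerator-step c β f e zero =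
    solve 5 (λ c β f b e → (c :* con (+ 0) :+ β) :* f :* b
      := (c :* con (+ 0) :+ β) :* (f :* b) :+ (c :* (con (+ 1) :+ e) :- c :* con (+ 0) :- β) :* con (+ 0)) ≡.refl
      c β (f 0) (binomial e 0) (+ e)
  numerator-step c β f e (suc m) = begin
    (c * + 0 + β) * f 0 * (B₁ - B₀) + numerator (λ i → (c * + suc i + β) * f (suc i)) (suc e) m
      ≡⟨ ≡.cong (λ t → (c * + 0 + β) * f 0 * (B₁ - B₀) + t) (≡.trans
           (numerator-cong (suc e) m (λ i → ≡.cong (_* f (suc i))
             (solve 3 (λ c i β → c :* (con (+ 1) :+ i) :+ β := c :* i :+ (c :+ β)) ≡.refl c (+ i) β)))
           (numerator-step c (c + β) (f ∘ suc) e m)) ⟩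
    (c * + 0 + β) * f 0 * (B₁ - B₀) +
      ((c * + m + (c + β)) * N + (c * (+ 1 + + e) - c * + m - (c + β)) * N⁻)
      -- The last summand isolates the combination that is zero by `absorption`.
      ≡⟨ solve 9 (λ c β f B₁ B₀ m e N N⁻ →
           (c :* con (+ 0) :+ β) :* f :* (B₁ :- B₀) :+
             ((c :* m :+ (c :+ β)) :* N :+ (c :* (con (+ 1) :+ e) :- c :* m :- (c :+ β)) :* N⁻)
           := (c :* (con (+ 1) :+ m) :+ β) :* (f :* B₁ :+ N)
              :+ (c :* (con (+ 1) :+ e) :- c :* (con (+ 1) :+ m) :- β) :* (f :* B₀ :+ N⁻)
              :- f :* c :* ((con (+ 1) :+ m) :* (B₁ :- B₀) :- :- ((con (+ 1) :+ e) :* B₀))) ≡.refl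
           c β (f 0) B₁ B₀ (+ m) (+ e) N N⁻ ⟩
    (c * + suc m + β) * (f 0 * B₁ + N) + (c * (+ 1 + + e) - c * + suc m - β) * (f 0 * B₀ + N⁻)
      - f 0 * c * ((+ 1 + + m) * (B₁ - B₀) - - ((+ 1 + + e) * B₀))
      ≡⟨ ≡.cong (λ t → (c * + suc m + β) * (f 0 * B₁ + N) + (c * (+ 1 + + e) - c * + suc m - β) * (f 0 * B₀ + N⁻)
           - f 0 * c * t) (≡.trans (≡.cong (_- - ((+ 1 + + e) * B₀)) (absorption e m)) (ℤₚ.+-inverseʳ (- ((+ 1 + + e) * B₀)))) ⟩
    (c * + suc m + β) * (f 0 * B₁ + N) + (c * (+ 1 + + e) - c * + suc m - β) * (f 0 * B₀ + N⁻) - f 0 * c * + 0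
      ≡⟨ solve 2 (λ x y → x :- y :* con (+ 0) := x) ≡.refl _ (f 0 * c) ⟩
    (c * + suc m + β) * (f 0 * B₁ + N) + (c * (+ 1 + + e) - c * + suc m - β) * (f 0 * B₀ + N⁻)
      ≡⟨ ≡.cong (λ t → (c * + suc m + β) * (f 0 * B₁ + N) + (c * (+ 1 + + e) - c * + suc m - β) * t)
           (numerator-head f e m) ⟨
    (c * + suc m + β) * (f 0 * B₁ + N) + (c * (+ 1 + + e) - c * + suc m - β) * numerator f e m ∎
    where
    B₀ B₁ N N⁻ : ℤ
    B₀ = binomial e m
    B₁ = binomial e (suc m)
    N = numerator (f ∘ suc) e m
    N⁻ = numerator⁻ (f ∘ suc) e m

  record Numerator (f : ℕ → ℕ) (e d : ℕ) (G : Grid) : Set where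
    field
      within : ∀ j l → j ℕ.+ l ≡ d → numerator (λ i → + f i) e j ≡ + G j l
      beyond : ∀ j → d ℕ.< j → numerator (λ i → + f i) e j ≡ + 0
  open Numerator

  numerator-times : ∀ c {f g : ℕ → ℕ} {e : ℕ} → (∀ i → g i ≡ (c ℕ.* i ℕ.+ 1) ℕ.* f i) → ∀ j →
    numerator (λ i → + g i) (suc e) j ≡
      (+ c * + j + + 1) * numerator (λ i → + f i) e j
      + (+ c * (+ 1 + + e) - + c * + j - + 1) * numerator⁻ (λ i → + f i) e j
  numerator-times c {f} {g} {e} g≡ j = ≡.trans
    (numerator-cong (suc e) j (λ i → ≡.trans (≡.cong +_ (g≡ i))
      (≡.trans (ℤₚ.pos-* (c ℕ.* i ℕ.+ 1) (f i)) (≡.cong (λ t → (t + + 1) * + f i) (ℤₚ.pos-* c i)))))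
    (numerator-step (+ c) (+ 1) (λ i → + f i) e j)

  numerator⁻-within : ∀ {f e d G} → Numerator f e d G → ∀ j l → j ℕ.+ l ≡ suc d →
                      numerator⁻ (λ i → + f i) e j ≡ + shiftʳ G j l
  numerator⁻-within num zero    l _   = ≡.refl
  numerator⁻-within num (suc j) l j+l = within num j l (ℕₚ.suc-injective j+l)

  numerator⁻-beyond : ∀ {f e d G} → Numerator f e d G → ∀ j → suc d ℕ.< j →
                      numerator⁻ (λ i → + f i) e j ≡ + 0
  numerator⁻-beyond num (suc j) (s≤s d<j) = beyond num j d<j

  numerator-within-suc : ∀ {f e d G} → Numerator f e d G → ∀ j l → j ℕ.+ l ≡ suc d →
                         numerator (λ i → + f i) e j ≡ + shiftˡ G j l
  numerator-within-suc num j zero    j≡ = beyond num j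
    (ℕₚ.≤-reflexive (≡.trans (≡.sym j≡) (ℕₚ.+-identityʳ j)))
  numerator-within-suc num j (suc l) j+l = within num j l
    (ℕₚ.suc-injective (≡.trans (≡.sym (ℕₚ.+-suc j l)) j+l))

  pos-lin : ∀ c l → + c * + l + + 1 ≡ + (c ℕ.* l ℕ.+ 1)
  pos-lin c l = ≡.cong (λ t → t + + 1) (≡.sym (ℤₚ.pos-* c l))

  -- The first hypothesis amounts to c e = c d + 2. It turns the weight c (e + 1) - c j - 1 into c l
  -- + 1 with l = d + 1 - j, the mirror image of c j + 1. It holds for c = 2 with e = d + 1 and for
  -- c = 1 with e = d + 2.
  Numerator-step : ∀ c {f g e d G} → c ℕ.* suc e ≡ c ℕ.* suc d ℕ.+ 2 →
    (∀ i → g i ≡ (c ℕ.* i ℕ.+ 1) ℕ.* f i) →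
    Numerator f e d G → Numerator g (suc e) (suc d) (step c G)
  Numerator-step c {f} {g} {e} {d} {G} e-d g≡ num = record
    { within = λ j l j+l → begin
        numerator (λ i → + g i) (suc e) j
          ≡⟨ numerator-times c {f} {g} {e} g≡ j ⟩
        (+ c * + j + + 1) * numerator (λ i → + f i) e j
          + (+ c * (+ 1 + + e) - + c * + j - + 1) * numerator⁻ (λ i → + f i) e j
          ≡⟨ ≡.cong₂ _+_ (≡.cong₂ _*_ (pos-lin c j) (numerator-within-suc num j l j+l))
               (≡.cong₂ _*_ (right-factor j l j+l) (numerator⁻-within num j l j+l)) ⟩
        + (c ℕ.* j ℕ.+ 1) * + shiftˡ G j l + + (c ℕ.* l ℕ.+ 1) * + shiftʳ G j l
          ≡⟨ ≡.cong₂ _+_ (ℤₚ.pos-* (c ℕ.* j ℕ.+ 1) (shiftˡ G j l)) (ℤₚ.pos-* (c ℕ.* l ℕ.+ 1) (shiftʳ G j l)) ⟨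
        + step c G j l ∎
    ; beyond = λ j d<j → ≡.trans (numerator-times c {f} {g} {e} g≡ j) (≡.trans
        (≡.cong₂ (λ s t → (+ c * + j + + 1) * s + (+ c * (+ 1 + + e) - + c * + j - + 1) * t)
          (beyond num j (ℕₚ.<⇒≤ d<j)) (numerator⁻-beyond num j d<j))
        (≡.cong₂ _+_ (ℤₚ.*-zeroʳ (+ c * + j + + 1)) (ℤₚ.*-zeroʳ (+ c * (+ 1 + + e) - + c * + j - + 1))))
    }
    where
    right-factor : ∀ j l → j ℕ.+ l ≡ suc d → + c * (+ 1 + + e) - + c * + j - + 1 ≡ + (c ℕ.* l ℕ.+ 1)
    right-factor j l j+l = begin
      + c * + suc e - + c * + j - + 1
        ≡⟨ ≡.cong (λ t → t - + c * + j - + 1) (≡.trans (≡.sym (ℤₚ.pos-* c (suc e)))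
             (≡.trans (≡.cong +_ e-d) (≡.cong (λ t → t + + 2) (≡.trans (≡.cong (λ t → + (c ℕ.* t)) (≡.sym j+l)) (ℤₚ.pos-* c (j ℕ.+ l)))))) ⟩
      + c * (+ j + + l) + + 2 - + c * + j - + 1
        ≡⟨ solve 3 (λ c j l → c :* (j :+ l) :+ con (+ 2) :- c :* j :- con (+ 1) := c :* l :+ con (+ 1)) ≡.refl
             (+ c) (+ j) (+ l) ⟩
      + c * + l + + 1
        ≡⟨ pos-lin c l ⟩
      + (c ℕ.* l ℕ.+ 1) ∎

  constant-numerator : ∀ m → numerator (λ _ → + 1) 1 (suc m) ≡ + 0
  constant-numerator zero    = ≡.refl
  constant-numerator (suc m) = ≡.trans (ℤₚ.+-identityˡ _) (constant-numerator m)

  term : ℕ → ℕ → ℕ → ℕ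
  term n k m = (m ℕ.+ 1) ℕ.^ k ℕ.* (2 ℕ.* m ℕ.+ 1) ℕ.^ n

  typeB-numerator : ∀ n → Numerator (term n 0) (suc n) n (typeB n)
  typeB-numerator zero = record
    { within = λ { zero zero _ → ≡.refl }
    ; beyond = λ { (suc j) _ → constant-numerator j }
    }
  typeB-numerator (suc n) = Numerator-step 2 {term n 0} {term (suc n) 0}
    (Data.Nat.Solver.+-*-Solver.solve 1 (λ n → con′ 2 :*′ (con′ 2 :+′ n) :=′ con′ 2 :*′ (con′ 1 :+′ n) :+′ con′ 2) ≡.refl n)
    (λ i → Data.Nat.Solver.+-*-Solver.solve 2 (λ x y → con′ 1 :*′ (x :*′ y) :=′ x :*′ (con′ 1 :*′ y)) ≡.refl
      (2 ℕ.* i ℕ.+ 1) ((2 ℕ.* i ℕ.+ 1) ℕ.^ n))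
    (typeB-numerator n)
    where
    open Data.Nat.Solver.+-*-Solver using () renaming (con to con′; _:*_ to _:*′_; _:+_ to _:+′_; _:=_ to _:=′_)

  term-suc : ∀ n k i → term n (suc k) i ≡ (1 ℕ.* i ℕ.+ 1) ℕ.* term n k i
  term-suc n k i = ≡.trans (ℕₚ.*-assoc (i ℕ.+ 1) ((i ℕ.+ 1) ℕ.^ k) ((2 ℕ.* i ℕ.+ 1) ℕ.^ n))
    (≡.cong (λ t → (t ℕ.+ 1) ℕ.* term n k i) (≡.sym (ℕₚ.*-identityˡ i)))

  -- Here e = n + 1 and the degree is n, so c = 1 violates c e = c d + 2. The weights are j + 1 and
  -- n + 1 - j, and the degree stays n instead of rising; from now on e = d + 2 holds.
  first-factor : ∀ n → Numerator (term n 1) (suc (suc n)) n (descent n 0)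
  first-factor n = record
    { within = λ j l j+l → ≡.trans (expand j) (inside j l j+l)
    ; beyond = λ j n<j → ≡.trans (expand j) (outside j n<j)
    }
    where
    num : Numerator (term n 0) (suc n) n (typeB n)
    num = typeB-numerator n
    N N⁻ : ℕ → ℤ
    N  = numerator (λ i → + term n 0 i) (suc n)
    N⁻ = numerator⁻ (λ i → + term n 0 i) (suc n)
    expand : ∀ j → numerator (λ i → + term n 1 i) (suc (suc n)) j ≡
      (+ 1 * + j + + 1) * N j + (+ 1 * (+ 1 + + suc n) - + 1 * + j - + 1) * N⁻ j
    expand = numerator-times 1 {term n 0} {term n 1} {suc n} (term-suc n 0)
    inside : ∀ j l → j ℕ.+ l ≡ n →
      (+ 1 * + j + + 1) * N j + (+ 1 * (+ 1 + + suc n) - + 1 * + j - + 1) * N⁻ j ≡ + descent n 0 j l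
    inside zero l ≡.refl = begin
      (+ 1 * + 0 + + 1) * N 0 + (+ 1 * (+ 1 + + suc n) - + 1 * + 0 - + 1) * + 0
        ≡⟨ solve 2 (λ x y → (con (+ 1) :* con (+ 0) :+ con (+ 1)) :* x :+ y :* con (+ 0) := x :+ con (+ 0)) ≡.refl
             (N 0) (+ 1 * (+ 1 + + suc n) - + 1 * + 0 - + 1) ⟩
      N 0 + + 0         ≡⟨ ≡.cong (λ t → t + + 0) (within num 0 l ≡.refl) ⟩
      + descent n 0 0 l ∎
    inside (suc j) l ≡.refl = begin
      (+ 1 * + suc j + + 1) * N (suc j) + (+ 1 * (+ 1 + + suc n) - + 1 * + suc j - + 1) * N j
        ≡⟨ ≡.cong₂ (λ s t → (+ 1 * + suc j + + 1) * s + (+ 1 * (+ 1 + + suc n) - + 1 * + suc j - + 1) * t)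
             (within num (suc j) l ≡.refl) (within num j (suc l) (ℕₚ.+-suc j l)) ⟩
      (+ 1 * + suc j + + 1) * + b + (+ 1 * (+ 1 + + suc n) - + 1 * + suc j - + 1) * + b′
        ≡⟨ solve 4 (λ j l b b′ → (con (+ 1) :* (con (+ 1) :+ j) :+ con (+ 1)) :* b
               :+ (con (+ 1) :* (con (+ 1) :+ (con (+ 1) :+ (con (+ 1) :+ (j :+ l)))) :- con (+ 1) :* (con (+ 1) :+ j) :- con (+ 1)) :* b′
             := b :+ ((j :+ con (+ 1)) :* b :+ (l :+ con (+ 1)) :* b′)) ≡.refl (+ j) (+ l) (+ b) (+ b′) ⟩
      + b + ((+ j + + 1) * + b + (+ l + + 1) * + b′)
        ≡⟨ ≡.cong (λ t → + b + t) (≡.cong₂ _+_ (ℤₚ.pos-* (j ℕ.+ 1) b) (ℤₚ.pos-* (l ℕ.+ 1) b′)) ⟨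
      + descent n 0 (suc j) l ∎
      where
      b b′ : ℕ
      b  = typeB n (suc j) l
      b′ = typeB n j (suc l)
    outside : ∀ j → n ℕ.< j →
      (+ 1 * + j + + 1) * N j + (+ 1 * (+ 1 + + suc n) - + 1 * + j - + 1) * N⁻ j ≡ + 0
    outside (suc j) (s≤s n≤j) with ℕₚ.m≤n⇒m<n∨m≡n n≤j
    ... | inj₁ n<j = ≡.trans
      (≡.cong₂ (λ s t → (+ 1 * + suc j + + 1) * s + (+ 1 * (+ 1 + + suc n) - + 1 * + suc j - + 1) * t)
        (beyond num (suc j) (s≤s n≤j)) (beyond num j n<j))
      (solve 2 (λ x y → x :* con (+ 0) :+ y :* con (+ 0) := con (+ 0)) ≡.refl
        (+ 1 * + suc j + + 1) (+ 1 * (+ 1 + + suc n) - + 1 * + suc j - + 1))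
    -- At j = n + 1 the leading coefficient of the old numerator still occurs, but with weight n + 1
    -- - j = 0.
    ... | inj₂ ≡.refl = ≡.trans
      (≡.cong (λ s → (+ 1 * + suc j + + 1) * s + (+ 1 * (+ 1 + + suc n) - + 1 * + suc j - + 1) * N j)
        (beyond num (suc j) (s≤s n≤j)))
      (solve 2 (λ j x → (con (+ 1) :* (con (+ 1) :+ j) :+ con (+ 1)) :* con (+ 0)
          :+ (con (+ 1) :* (con (+ 1) :+ (con (+ 1) :+ j)) :- con (+ 1) :* (con (+ 1) :+ j) :- con (+ 1)) :* x := con (+ 0)) ≡.refl
        (+ j) (N j))

  descent-numerator : ∀ n k → Numerator (term n (suc k)) (suc (suc (k ℕ.+ n))) (k ℕ.+ n) (descent n k)
  descent-numerator n zero    = first-factor n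
  descent-numerator n (suc k) = record
    { within = λ j l j+l → ≡.trans (within num j l j+l) (≡.cong +_ (≡.sym (descent-step n k j l)))
    ; beyond = beyond num
    }
    where
    open Grids using (descent-step)
    num : Numerator (term n (suc (suc k))) (suc (suc (suc (k ℕ.+ n)))) (suc (k ℕ.+ n)) (step 1 (descent n k))
    num = Numerator-step 1 {term n (suc k)} {term n (suc (suc k))}
      (Data.Nat.Solver.+-*-Solver.solve 1 (λ d → con′ 1 :*′ (con′ 3 :+′ d) :=′ con′ 1 :*′ (con′ 1 :+′ d) :+′ con′ 2) ≡.refl (k ℕ.+ n))
      (term-suc n (suc k)) (descent-numerator n k)
      where
      open Data.Nat.Solver.+-*-Solver using () renaming (con to con′; _:*_ to _:*′_; _:+_ to _:+′_; _:=_ to _:=′_)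

-- Coefficients of the real polynomials of the statement

module RealCoefficients where
  open import Data.Rational using (_+_; _*_; -_; _/_)
  open Data.Rational.Solver.+-*-Solver using (solve; _:=_; _:+_; _:*_; _:-_; :-_; con)
  open RationalFacts
  open RealOrder
  open GeneratingSeries
  open Grids
  open RealIVT using (orderedRing)
  open Representation orderedRing using (Represents)
  open ≡.≡-Reasoning

  -- Stated for each term of the Cauchy sequences, where the ring laws are equalities of rationals
  -- and no error estimates arise.
  coeff-⊕ : ∀ p q j n → seq (D.coeff (p D.⊕ q) j) n ≡ seq (D.coeff p j) n + seq (D.coeff q j) n
  coeff-⊕ []      q       j       n = ≡.sym (ℚₚ.+-identityˡ _)
  coeff-⊕ (a ∷ p) []      j       n = ≡.sym (ℚₚ.+-identityʳ _)
  coeff-⊕ (a ∷ p) (b ∷ q) zero    n = ≡.refl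
  coeff-⊕ (a ∷ p) (b ∷ q) (suc j) n = coeff-⊕ p q j n

  coeff-· : ∀ c p j n → seq (D.coeff (c D.· p) j) n ≡ seq c n * seq (D.coeff p j) n
  coeff-· c []      j       n = ≡.sym (ℚₚ.*-zeroʳ (seq c n))
  coeff-· c (a ∷ p) zero    n = ≡.refl
  coeff-· c (a ∷ p) (suc j) n = coeff-· c p j n

  coeff-two-zero : ∀ a b q n →
    seq (D.coeff ((a ∷ b ∷ []) D.⊛ q) 0) n ≡ seq a n * seq (D.coeff q 0) n
  coeff-two-zero a b q n = ≡.trans (coeff-⊕ (a D.· q) _ 0 n)
    (≡.trans (ℚₚ.+-identityʳ _) (coeff-· a q 0 n))

  coeff-two-suc : ∀ a b q j n → seq (D.coeff ((a ∷ b ∷ []) D.⊛ q) (suc j)) n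
                  ≡ seq a n * seq (D.coeff q (suc j)) n + seq b n * seq (D.coeff q j) n
  coeff-two-suc a b q j n = ≡.trans (coeff-⊕ (a D.· q) _ (suc j) n)
    (≡.cong₂ _+_ (coeff-· a q (suc j) n)
      (≡.trans (coeff-⊕ (b D.· q) (D.0ℝ ∷ []) j n)
        (≡.trans (≡.cong₂ _+_ (coeff-· b q j n) (zeros j)) (ℚₚ.+-identityʳ _))))
    where
    zeros : ∀ j → seq (D.coeff (D.0ℝ ∷ []) j) n ≡ 0ℚ
    zeros zero    = ≡.refl
    zeros (suc j) = ≡.refl

  coeff-1-X^ : ∀ e j n → seq (D.coeff (D.1-X D.⊛^ e) j) n ≡ binomial e j / 1
  coeff-1-X^ zero    zero    n = ≡.refl
  coeff-1-X^ zero    (suc j) n = ≡.refl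
  coeff-1-X^ (suc e) zero    n = ≡.trans (coeff-two-zero D.1ℝ (D.- D.1ℝ) (D.1-X D.⊛^ e) n)
    (≡.trans (ℚₚ.*-identityˡ _) (coeff-1-X^ e 0 n))
  coeff-1-X^ (suc e) (suc j) n = begin
    seq (D.coeff (D.1-X D.⊛^ suc e) (suc j)) n
      ≡⟨ coeff-two-suc D.1ℝ (D.- D.1ℝ) (D.1-X D.⊛^ e) j n ⟩
    1ℚ * seq (D.coeff (D.1-X D.⊛^ e) (suc j)) n + (- 1ℚ) * seq (D.coeff (D.1-X D.⊛^ e) j) n
      ≡⟨ ≡.cong₂ (λ s t → 1ℚ * s + (- 1ℚ) * t) (coeff-1-X^ e (suc j) n) (coeff-1-X^ e j n) ⟩
    1ℚ * (binomial e (suc j) / 1) + (- 1ℚ) * (binomial e j / 1)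
      ≡⟨ solve 2 (λ x y → con 1ℚ :* x :+ con (- 1ℚ) :* y := x :+ :- y) ≡.refl
           (binomial e (suc j) / 1) (binomial e j / 1) ⟩
    binomial e (suc j) / 1 + - (binomial e j / 1)
      ≡⟨ ≡.cong (λ t → binomial e (suc j) / 1 + t) (/1-neg (binomial e j)) ⟨
    binomial e (suc j) / 1 + (ℤ.- binomial e j) / 1
      ≡⟨ /1-+ (binomial e (suc j)) (ℤ.- binomial e j) ⟨
    binomial (suc e) (suc j) / 1 ∎

  convolution : ∀ (f : ℕ → ℕ) (C : ℕ → ℝ) e n → (∀ j → seq (C j) n ≡ binomial e j / 1) →
    ∀ m → seq (D.∑≤ m (λ i → D.fromℕ (f i) D.* C (m ∸ i))) n ≡ numerator (λ i → + f i) e m / 1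
  convolution f C e n C≡ zero = ≡.trans (ℚₚ.+-identityʳ _)
    (≡.trans (≡.cong ((+ f 0 / 1) *_) (C≡ 0)) (≡.sym (/1-* (+ f 0) (binomial e 0))))
  convolution f C e n C≡ (suc m) = ≡.trans
    (≡.cong₂ _+_ (≡.trans (≡.cong ((+ f 0 / 1) *_) (C≡ (suc m))) (≡.sym (/1-* (+ f 0) (binomial e (suc m)))))
      (convolution (f ∘ suc) C e n C≡ m))
    (≡.sym (/1-+ (+ f 0 ℤ.* binomial e (suc m)) (numerator (λ i → + f (suc i)) e m)))

  represents : ∀ {n k G d} p → D.IsDescentPolynomial n (k ℕ.+ n) p →
    Numerator (term n k) (suc (k ℕ.+ n)) d G → Represents (D.coeff p) G d
  represents {n} {k} {G} {d} p desc num = record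
    { within = λ j l j+l → ≃-trans (coeff-p j) (reflexive (Numerator.within num j l j+l))
    ; beyond = λ j d<j → ≃-trans (coeff-p j) (reflexive (Numerator.beyond num j d<j))
    }
    where
    reflexive : ∀ {i j} → i ≡ j → fromℤ i ≃ fromℤ j
    reflexive ≡.refl = ≃-refl
    exponent : (k ℕ.+ n) ℕ.∸ n ≡ k
    exponent = ℕₚ.m+n∸n≡m k n
    coeff-p : ∀ j → D.coeff p j ≃ fromℤ (numerator (λ i → + term n k i) (suc (k ℕ.+ n)) j)
    coeff-p j = ≃-trans (≃-sym {y = D.coeff p j} quotient)
      (pointwise λ i → ≡.trans
        (convolution (term n ((k ℕ.+ n) ℕ.∸ n)) (D.coeff (D.1-X D.⊛^ (k ℕ.+ n ℕ.+ 1))) (k ℕ.+ n ℕ.+ 1) i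
          (λ j → coeff-1-X^ (k ℕ.+ n ℕ.+ 1) j i) j)
        (≡.cong₂ (λ (e k : ℕ) → numerator (λ i → + term n k i) e j / 1) (ℕₚ.+-comm (k ℕ.+ n) 1) exponent))
      where
      quotient : (D.descentSeries n (k ℕ.+ n) D.⊗ D.coeff (D.1-X D.⊛^ (k ℕ.+ n ℕ.+ 1))) j ≃ D.coeff p j
      quotient = mk (desc j)

-- Zeros, interlacing and signs in the form of the statement

module RealZeros where
  open import Data.Rational using (_+_; _*_; -_; _≤_)
  open Data.Rational.Solver.+-*-Solver using (solve; _:=_; _:+_; _:-_; :-_)
  open RationalFacts
  open RealOrder using (≃⇒≈; pointwise; ≃-refl; ≃-trans; pos; nonNeg; map₁)
  open RealIVT using (orderedRing)
  open RealCoefficients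
  open GridPolynomials using (antidiagonal)
  open Representation orderedRing
  open Decomposition orderedRing using (Interlaced)
  open RootFinding orderedRing using (Zeros)
  module O = OrderedRing orderedRing

  Pos⇒0< : ∀ x → O.Pos x → D.0ℝ D.< x
  Pos⇒0< x (pos {ε} 0<ε (N , ε≤x)) =
    ε , 0<ε , N , λ n N≤n → ≡.subst (_≤ seq x n) (≡.sym (ℚₚ.+-identityˡ ε)) (ε≤x n N≤n)

  NonNeg⇒≤ : ∀ x y → O.NonNeg (y O.- x) → x D.≤ y
  NonNeg⇒≤ x y (nonNeg b) ε 0<ε = map₁
    (λ n -ε≤ → from-gap (gap -ε≤)
      (solve 3 (λ x y e → (y :- x) :- :- e := (y :+ e) :- x) ≡.refl (seq x n) (seq y n) ε))
    (b ε 0<ε)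

  <⇒≤ : ∀ x y → O.Pos (y O.- x) → x D.≤ y
  <⇒≤ x y x<y = NonNeg⇒≤ x y (O.Pos⇒NonNeg x<y)

  product : List ℝ → D.Poly
  product = foldr (λ r q → (D.X- r) D.⊛ q) (D.1ℝ ∷ [])

  product-coefficients : (ℕ → ℝ) → ℕ → ℕ → ℝ
  product-coefficients r d = D.coeff (product (applyUpTo r d))

  isProduct : IsProduct product-coefficients
  isProduct = record
    { none      = λ { r zero → pointwise λ n → ≡.refl ; r (suc j) → pointwise λ n → ≡.refl }
    ; more-zero = λ r d → pointwise (coeff-two-zero (D.- r 0) D.1ℝ (product (applyUpTo (r ∘ suc) d)))
    ; more-suc  = λ r d j → pointwise λ n →
        ≡.trans (coeff-two-suc (D.- r 0) D.1ℝ (product (applyUpTo (r ∘ suc) d)) j n)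
          (≡.cong (λ t → (- seq (r 0) n) * seq (product-coefficients (r ∘ suc) d (suc j)) n + t)
            (ℚₚ.*-identityˡ (seq (product-coefficients (r ∘ suc) d j) n)))
    }

  real-zeros : ∀ p {G d r} → Represents (D.coeff p) G d → 1 ℕ.≤ G d 0 → Zeros (antidiagonal G 0 d) d r →
               D.Zeros p (applyUpTo r d)
  real-zeros p {G} {d} {r} rep top zeros =
    Linkedₚ.applyUpTo⁺₁ r d (λ {i} i<d → <⇒≤ (r (suc i)) (r i) (Zeros.distinct zeros i i<d)) ,
    scaled (factored-coefficients rep isProduct top zeros)
    where
    scaled : (∃ λ c → O.Pos c × ∀ j → D.coeff p j O.≈ c O.* product-coefficients r d j) →
             ∃ λ c → c D.# D.0ℝ × p D.≋ c D.· product (applyUpTo r d)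
    scaled (c , c-Pos , p≈) = c , inj₂ (Pos⇒0< c c-Pos) , λ j →
      ≃⇒≈ {D.coeff p j} {D.coeff (c D.· product (applyUpTo r d)) j} (≃-trans (p≈ j)
      (pointwise λ n → ≡.sym (coeff-· c (product (applyUpTo r d)) j n)))

  chain-equal : ∀ d r s → Interlaced d d r s → Linked D._≥_ (D.alternate (applyUpTo r d) (applyUpTo s d))
  chain-equal zero          r s int = []
  chain-equal (suc zero)    r s int = <⇒≤ (s 0) (r 0) (Interlaced.descend int 0 (s≤s z≤n)) ∷ [-]
  chain-equal (suc (suc d)) r s int =
    <⇒≤ (s 0) (r 0) (Interlaced.descend int 0 (s≤s z≤n)) ∷
    <⇒≤ (r 1) (s 0) (Interlaced.rise int 0 (s≤s z≤n) (s≤s (s≤s z≤n))) ∷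
    chain-equal (suc d) (r ∘ suc) (s ∘ suc) record
      { descend = λ i i<d → Interlaced.descend int (suc i) (s≤s i<d)
      ; rise    = λ i i<d 1+i<d → Interlaced.rise int (suc i) (s≤s i<d) (s≤s 1+i<d)
      }

  chain-shorter : ∀ e r s → Interlaced (suc e) e r s →
                  Linked D._≥_ (D.alternate (applyUpTo r (suc e)) (applyUpTo s e))
  chain-shorter zero    r s int = [-]
  chain-shorter (suc e) r s int =
    <⇒≤ (s 0) (r 0) (Interlaced.descend int 0 (s≤s z≤n)) ∷
    <⇒≤ (r 1) (s 0) (Interlaced.rise int 0 (s≤s z≤n) (s≤s (s≤s z≤n))) ∷
    chain-shorter e (r ∘ suc) (s ∘ suc) record
      { descend = λ i i<d → Interlaced.descend int (suc i) (s≤s i<d)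
      ; rise    = λ i i<d 1+i<d → Interlaced.rise int (suc i) (s≤s i<d) (s≤s 1+i<d)
      }

  has-degree : ∀ p {G d} → Represents (D.coeff p) G d → 1 ℕ.≤ G d 0 → D.HasDegree d p
  has-degree p {d = d} rep top =
    inj₂ (Pos⇒0< (D.coeff p d) (top-Pos rep top)) , λ j d<j → ≃⇒≈ (Represents.beyond rep j d<j)

  same-sign : ∀ f g {G d H e} → Represents (D.coeff f) G d → 1 ℕ.≤ G d 0 →
              Represents (D.coeff g) H e → 1 ℕ.≤ H e 0 → D.SameSign f g
  same-sign f g {G} {d} {H} {e} rep top rep′ top′ =
    D.coeff f d , D.coeff g e ,
    (d , has-degree f rep top , ≃⇒≈ (≃-refl {D.coeff f d})) ,
    (e , has-degree g rep′ top′ , ≃⇒≈ (≃-refl {D.coeff g e})) ,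
    Pos⇒0< (D.coeff f d D.* D.coeff g e) (top-product-Pos rep top rep′ top′)

  alternatingly-increasing : ∀ p {G d} → Represents (D.coeff p) G d → 1 ℕ.≤ G d 0 →
    (∀ j l → j ℕ.≤ l → G j (suc l) ℕ.≤ G (suc l) j) → (∀ j l → j ℕ.≤ l → G (suc l) j ℕ.≤ G (suc j) l) →
    D.AlternatinglyIncreasing p
  alternatingly-increasing p {G} {d} rep top outer inner =
    d , has-degree p rep top ,
    NonNeg⇒≤ D.0ℝ (D.coeff p 0) (first-NonNeg rep) ,
    (λ i h → NonNeg⇒≤ (D.coeff p i) (D.coeff p (d ∸ i)) (outer-links rep outer i h)) ,
    (λ i h → NonNeg⇒≤ (D.coeff p (d ∸ i)) (D.coeff p (suc i)) (inner-links rep inner i h))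

-- The two cases k = 0 and k ≥ 1

module Descents where
  open RealOrder using (_≃_; mk; pointwise; ≃-refl; ≃-trans; ≃-sym; Pos; pos; Pos-resp)
  open RealIVT using (orderedRing)
  open RealCoefficients
  open RealZeros
  open GeneratingSeries using (typeB-numerator; descent-numerator)
  open Grids
  open Representation orderedRing
  open Uniqueness orderedRing
  open Decomposition orderedRing using (InterlacedZeros; interlaced-zeros)

  Conclusion : ℕ → D.Poly → Set
  Conclusion d p =
    ((deg-p : D.DegreeAtMost d p) → D.ℐ d p deg-p D.≪ p) ×
    D.AlternatinglyIncreasing p ×
    (∀ a b → D.IsℐDecomposition d p a b → b D.≪ a)

  coeff-applyUpTo : ∀ (f : ℕ → ℝ) n j → j ℕ.< n → D.coeff (applyUpTo f n) j ≡ f j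
  coeff-applyUpTo f (suc n) zero    _         = ≡.refl
  coeff-applyUpTo f (suc n) (suc j) (s≤s j<n) = coeff-applyUpTo (f ∘ suc) n j j<n

  coeff-applyUpTo-beyond : ∀ (f : ℕ → ℝ) n j → n ℕ.≤ j → D.coeff (applyUpTo f n) j ≡ D.0ℝ
  coeff-applyUpTo-beyond f zero    j       _         = ≡.refl
  coeff-applyUpTo-beyond f (suc n) (suc j) (s≤s n≤j) = coeff-applyUpTo-beyond (f ∘ suc) n j n≤j

  coeff-ℐ : ∀ d p deg-p j l → j ℕ.+ l ≡ d → D.coeff (D.ℐ d p deg-p) j ≡ D.coeff p l
  coeff-ℐ d p deg-p j l j+l≡d = ≡.trans
    (coeff-applyUpTo (λ j → D.coeff p (d ∸ j)) (suc d) j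
      (s≤s (ℕₚ.≤-trans (ℕₚ.m≤m+n j l) (ℕₚ.≤-reflexive j+l≡d))))
    (≡.cong (D.coeff p) (≡.trans (≡.cong (_∸ j) (≡.sym j+l≡d)) (ℕₚ.m+n∸m≡n j l)))

  ≡⇒≃ : ∀ {x y} → x ≡ y → x ≃ y
  ≡⇒≃ ≡.refl = ≃-refl

  vanishing-top : ∀ p {G d} → Represents (D.coeff p) G (suc d) → 1 ℕ.≤ G (suc d) 0 → ¬ D.DegreeAtMost d p
  vanishing-top p {G} {d} rep top deg = ¬Pos-0
    (Pos-resp {D.coeff p (suc d)} {D.0ℝ} (mk (deg (suc d) ℕₚ.≤-refl)) (top-Pos rep top))
    where
    ¬Pos-0 : ¬ Pos D.0ℝ
    ¬Pos-0 (pos 0<ε (N , ε≤0)) = ℚₚ.<-irrefl ≡.refl (ℚₚ.<-≤-trans 0<ε (ε≤0 N ℕₚ.≤-refl))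

  -- p is the palindromic type B polynomial of degree n + 1: the links p_i ≤ p_{d-i} are equalities
  -- and the other links are its unimodality.
  no-excess : ∀ n p → D.IsDescentPolynomial (suc n) (suc n) p → Conclusion n p
  no-excess n p desc =
    (λ deg-p → contradiction deg-p (vanishing-top p rep (typeB-last (suc n)))) ,
    alternatingly-increasing p rep (typeB-last (suc n))
      (λ j l _ → ℕₚ.≤-reflexive (typeB-symmetric (suc n) j (suc l)))
      (λ j l j≤l → ℕₚ.≤-trans (ℕₚ.≤-reflexive (typeB-symmetric (suc n) (suc l) j)) (typeB-unimodal (suc n) j l j≤l)) ,
    (λ a b dec → contradiction (D.IsℐDecomposition.deg-p dec) (vanishing-top p rep (typeB-last (suc n))))
    where
    rep : Represents (D.coeff p) (typeB (suc n)) (suc n)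
    rep = represents {suc n} {0} p desc (typeB-numerator (suc n))

  excess : ∀ n k p → InterlacedZeros n k → D.IsDescentPolynomial (suc n) (suc k ℕ.+ suc n) p →
           Conclusion (suc (k ℕ.+ n)) p
  excess n k p interlaced desc = reversed-≪ , alternatingly-increasing p rep (descent-last′ n k)
      (descent-outer (suc n) k) (descent-inner (suc n) k) , b-≪-a
    where
    d : ℕ
    d = suc (k ℕ.+ n)
    rep : Represents (D.coeff p) (descent (suc n) k) d
    rep = ≡.subst (Represents (D.coeff p) (descent (suc n) k)) (ℕₚ.+-suc k n)
      (represents {suc n} {suc k} p desc (descent-numerator (suc n) k))
    open InterlacedZeros interlaced

    reversed-≪ : (deg-p : D.DegreeAtMost d p) → D.ℐ d p deg-p D.≪ p
    reversed-≪ deg-p = inj₁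
      ((applyUpTo r d , applyUpTo s d , real-zeros p rep (descent-last′ n k) zeros-p ,
          real-zeros q rep-q (descent-first′ n k) zeros-q ,
          inj₂ (≡.trans (Listₚ.length-applyUpTo r d) (≡.sym (Listₚ.length-applyUpTo s d))) ,
          chain-equal d r s order-pq) ,
        same-sign q p rep-q (descent-first′ n k) rep (descent-last′ n k))
      where
      q : D.Poly
      q = D.ℐ d p deg-p
      rep-q : Represents (D.coeff q) (reversed (suc n) k) d
      rep-q = record
        { within = λ j l j+l → ≃-trans (≡⇒≃ (coeff-ℐ d p deg-p j l j+l))
            (Represents.within rep l j (≡.trans (ℕₚ.+-comm l j) j+l))
        ; beyond = λ j d<j → ≡⇒≃ (coeff-applyUpTo-beyond (λ j → D.coeff p (d ∸ j)) (suc d) j d<j)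
        }

    b-≪-a : ∀ a b → D.IsℐDecomposition d p a b → b D.≪ a
    b-≪-a a b dec = inj₁
      ((applyUpTo α d , applyUpTo β (k ℕ.+ n) , real-zeros a rep-a (partA-last n k) zeros-a ,
          real-zeros b rep-b (partB-last n k) zeros-b ,
          inj₁ (≡.trans (Listₚ.length-applyUpTo α d) (≡.cong suc (≡.sym (Listₚ.length-applyUpTo β (k ℕ.+ n))))) ,
          chain-shorter (k ℕ.+ n) α β order-ab) ,
        same-sign b a rep-b (partB-last n k) rep-a (partA-last n k))
      where
      open D.IsℐDecomposition dec
      p-zero : D.coeff p 0 ≃ D.coeff a 0
      p-zero = ≃-trans {y = D.coeff (a D.⊕ (D.X· b)) 0} (mk (sum≋ 0))
        (pointwise λ i → ≡.trans (coeff-⊕ a (D.X· b) 0 i) (ℚₚ.+-identityʳ _))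
      p-suc : ∀ j → D.coeff p (suc j) ≃ D.coeff a (suc j) O.+ D.coeff b j
      p-suc j = ≃-trans {y = D.coeff (a D.⊕ (D.X· b)) (suc j)} (mk (sum≋ (suc j)))
        (pointwise λ i → coeff-⊕ a (D.X· b) (suc j) i)
      a-symmetric : ∀ j l → j ℕ.+ l ≡ d → D.coeff a l ≃ D.coeff a j
      a-symmetric j l j+l = ≃-trans (≃-sym (≡⇒≃ (coeff-ℐ d a deg-a j l j+l))) (mk (sym-a j))
      b-symmetric : ∀ j l → j ℕ.+ l ≡ k ℕ.+ n → D.coeff b l ≃ D.coeff b j
      b-symmetric j l j+l = ≃-trans (≃-sym (≡⇒≃ (coeff-ℐ (k ℕ.+ n) b deg-b j l j+l))) (mk (sym-b j))
      rep-a : Represents (D.coeff a) (partA (suc n) k) d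
      rep-a = record
        { within = a-unique (suc n) k (k ℕ.+ n) (D.coeff p) (D.coeff a) (D.coeff b)
            p-zero p-suc a-symmetric b-symmetric (Represents.within rep)
        ; beyond = λ j d<j → mk (deg-a j d<j)
        }
      rep-b : Represents (D.coeff b) (partB (suc n) k) (k ℕ.+ n)
      rep-b = record
        { within = b-unique (suc n) k (k ℕ.+ n) (D.coeff p) (D.coeff a) (D.coeff b)
            p-zero p-suc a-symmetric b-symmetric (Represents.within rep)
        ; beyond = λ j d<j → mk (deg-b j d<j)
        }

  length≤sum : ∀ {n} (s : Vec ℕ n) → (∀ i → lookup s i ≡ 1 ⊎ lookup s i ≡ 2) → n ℕ.≤ sum s
  length≤sum Vec.[]       _   = z≤n
  length≤sum (x Vec.∷ s) one-or-two =
    ℕₚ.+-mono-≤ (1≤ (one-or-two Data.Fin.zero)) (length≤sum s (one-or-two ∘ Data.Fin.suc))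
    where
    1≤ : x ≡ 1 ⊎ x ≡ 2 → 1 ℕ.≤ x
    1≤ (inj₁ ≡.refl) = s≤s z≤n
    1≤ (inj₂ ≡.refl) = s≤s z≤n

  by-excess : ∀ n k S p → k ℕ.+ suc n ≡ S → D.IsDescentPolynomial (suc n) S p → Conclusion (S ∸ 1) p
  by-excess n zero    _ p ≡.refl desc = no-excess n p desc
  by-excess n (suc k) _ p ≡.refl desc =
    ≡.subst (λ d → Conclusion d p) (≡.sym (ℕₚ.+-suc k n)) (excess n k p (interlaced-zeros n k) desc)

open import Defs
open import Data.Nat using () renaming (_≤_ to _≤ℕ_)

proposition5p6 : (n : ℕ) → 1 ≤ℕ n →
    (s : Vec ℕ n) → (∀ i → lookup s i ≡ 1 ⊎ lookup s i ≡ 2) →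
    (p : Poly) → IsDescentPolynomial n (sum s) p →
    ((deg-p : DegreeAtMost (sum s ∸ 1) p) → ℐ (sum s ∸ 1) p deg-p ≪ p) ×
    AlternatinglyIncreasing p ×
    (∀ a b → IsℐDecomposition (sum s ∸ 1) p a b → b ≪ a)
proposition5p6 (suc n) _ s one-or-two p desc =
  Descents.by-excess n (sum s ∸ suc n) (sum s) p (ℕₚ.m∸n+n≡m (Descents.length≤sum s one-or-two)) desc
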